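{- Let $\mathfrak{u} \in \langle \Sigma \rangle$. Then \[ (\mathrm{Id} \otimes \Delta) \Delta(\mathfrak{u})=(\Delta \otimes \mathrm{Id})\Delta(\mathfrak{u}). \]
   Context: Let $\mathbb F_q$ be the finite field with $q$ elements, of characteristic $p$. Let $\Sigma=\{x_n\}_{n\geq 1}$ be an alphabet with weight $w(x_n)=n$; let $\langle\Sigma\rangle$ be the set of words over $\Sigma$ (the empty word is denoted $1$; the weight of a word is the sum of the weights of its letters), and let $\mathfrak C=\mathbb F_q\langle\Sigma\rangle$ be the $\mathbb F_q$-vector space with basis $\langle\Sigma\rangle$, equipped with concatenation. A nonempty word is written $\mathfrak a=x_a\mathfrak a_-$, where $x_a$ is its first letter. For $a,b,i\in\mathbb N$ put $\Delta^i_{a,b}=(-1)^{a-1}\binom{i-1}{a-1}+(-1)^{b-1}\binom{i-1}{b-1}\in\mathbb F_p$ if $(q-1)\mid i$ and $0<i<a+b$, and $\Delta^i_{a,b}=0$ otherwise. Define $\mathbb F_q$-bilinear products $\diamond$ (diamond) and $\sqcup\!\sqcup$ (shuffle) on $\mathfrak C$ recursively by $1\diamond\mathfrak a=\mathfrak a\diamond 1=\mathfrak a$, $1\sqcup\!\sqcup\mathfrak a=\mathfrak a\sqcup\!\sqcup 1=\mathfrak a$, and for nonempty words $\mathfrak a,\mathfrak b$: $\mathfrak a\diamond\mathfrak b=x_{a+b}(\mathfrak a_-\sqcup\!\sqcup\mathfrak b_-)+\sum_{i+j=a+b}\Delta^j_{a,b}\,x_i(x_j\sqcup\!\sqcup(\mathfrak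 a_-\sqcup\!\sqcup\mathfrak b_-))$, $\mathfrak a\sqcup\!\sqcup\mathfrak b=x_a(\mathfrak a_-\sqcup\!\sqcup\mathfrak b)+x_b(\mathfrak a\sqcup\!\sqcup\mathfrak b_-)+\mathfrak a\diamond\mathfrak b$. The triangle product is $1\triangleright\mathfrak a=\mathfrak a\triangleright 1=\mathfrak a$ and $\mathfrak a\triangleright\mathfrak b=x_a(\mathfrak a_-\sqcup\!\sqcup\mathfrak b)$ for nonempty $\mathfrak a,\mathfrak b$. On $\mathfrak C\otimes\mathfrak C$ the shuffle product is taken componentwise. The coproduct $\Delta:\mathfrak C\to\mathfrak C\otimes\mathfrak C$ is the $\mathbb F_q$-linear map defined on words by induction on weight: $\Delta(1)=1\otimes 1$, $\Delta(x_1)=1\otimes x_1+x_1\otimes 1$; if $\mathfrak u=x_u\mathfrak v$ has depth $>1$ and $\Delta(x_u)=1\otimes x_u+\sum a_u\otimes b_u$, $\Delta(\mathfrak v)=\sum a_{\mathfrak v}\otimes b_{\mathfrak v}$, then $\Delta(\mathfrak u)=1\otimes\mathfrak u+\sum(a_u\triangleright a_{\mathfrak v})\otimes(b_u\sqcup\!\sqcup b_{\mathfrak v})$; and for $w\geq 2$, $\Delta(x_w)=\Delta(x_1)\sqcup\!\sqcup\Delta(x_{w-1})-\Delta(x_1x_{w-1})-\Delta(x_{w-1}x_1)-\sum_{0<j<w}\Delta^j_{1,w-1}\Delta(x_{w-j}x_j)$. -}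

module Defs where

open import Level using (Level; _⊔_)
open import Algebra.Bundles using (CommutativeRing)
open import Data.Nat as ℕ using (ℕ; zero; suc; _∸_)
open import Data.Nat.Divisibility using (_∣?_)
open import Data.Nat.Combinatorics using (_C_)
open import Data.Bool using (if_then_else_)
open import Data.List as List using (List; []; _∷_; _++_; [_]; map; concatMap; upTo; foldr)
import Data.List.Properties as ListP
open import Data.Product using (Σ; ∃; _×_; _,_)
open import Data.Fin using (Fin)
open import Relation.Nullary using (¬_; Dec; yes; no; does)
open import Relation.Binary using (DecidableEquality)
open import Relation.Binary.Bundles using (Setoid)
import Relation.Binary.PropositionalEquality as ≡
open import Function.Bundles using (Inverse)
import Data.Product.Properties as ProdP

record IsField {c ℓ : Level} (F : CommutativeRing c ℓ) : Set (c ⊔ ℓ) where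
  open CommutativeRing F
  field
    1≉0     : ¬ (1# ≈ 0#)
    inverse : ∀ x → ¬ (x ≈ 0#) → Σ Carrier (λ y → x * y ≈ 1#)

HasCardinality : {c ℓ : Level} (F : CommutativeRing c ℓ) (q : ℕ) → Set (c ⊔ ℓ)
HasCardinality F q = Inverse (≡.setoid (Fin q)) (CommutativeRing.setoid F)

-- Words over Σ = {x_n}_{n ≥ 1}: the letter x_n is represented by the
-- natural number n (only words all of whose letters are ≥ 1 are words
-- over Σ; see the hypothesis of the theorem).

Word : Set
Word = List ℕ

module Construction {c ℓ : Level} (F : CommutativeRing c ℓ) (q : ℕ) where
  open CommutativeRing F

  -- Finite formal 𝔽_q-linear combinations of basis elements of type B.
  Lin : Set → Set c
  Lin B = List (Carrier × B)

  -- coefficient of a basis element (elements of the free module are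
  -- compared through their coefficient functions)
  coef : {B : Set} → DecidableEquality B → Lin B → B → Carrier
  coef _≟_ [] b = 0#
  coef _≟_ ((k , b′) ∷ l) b = if does (b′ ≟ b) then k + coef _≟_ l b else coef _≟_ l b

  EqLin : {B : Set} → DecidableEquality B → Lin B → Lin B → Set ℓ
  EqLin _≟_ l l′ = ∀ b → coef _≟_ l b ≈ coef _≟_ l′ b

  scale : {B : Set} → Carrier → Lin B → Lin B
  scale k = map (λ { (k′ , b) → (k * k′ , b) })

  neg : {B : Set} → Lin B → Lin B
  neg = scale (- 1#)

  ext : {B B′ : Set} → (B → Lin B′) → Lin B → Lin B′
  ext f = concatMap (λ { (k , b) → scale k (f b) })

  ext₂ : {B₁ B₂ B′ : Set} → (B₁ → B₂ → Lin B′) → Lin B₁ → Lin B₂ → Lin B′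
  ext₂ f l₁ l₂ = ext (λ b₁ → ext (f b₁) l₂) l₁

  𝔠 : Set c
  𝔠 = Lin Word

  𝔠⊗𝔠 : Set c
  𝔠⊗𝔠 = Lin (Word × Word)

  𝔠⊗𝔠⊗𝔠 : Set c
  𝔠⊗𝔠⊗𝔠 = Lin (Word × Word × Word)

  _≟W_ : DecidableEquality Word
  _≟W_ = ListP.≡-dec ℕ._≟_

  _≟₂_ : DecidableEquality (Word × Word)
  _≟₂_ = ProdP.≡-dec _≟W_ _≟W_

  _≟₃_ : DecidableEquality (Word × Word × Word)
  _≟₃_ = ProdP.≡-dec _≟W_ _≟₂_

  _≈₃_ : 𝔠⊗𝔠⊗𝔠 → 𝔠⊗𝔠⊗𝔠 → Set ℓ
  _≈₃_ = EqLin _≟₃_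

  one : 𝔠
  one = [ (1# , []) ]

  word : Word → 𝔠
  word w = [ (1# , w) ]

  pre : ℕ → 𝔠 → 𝔠
  pre a = map (λ { (k , w) → (k , a ∷ w) })

  natF : ℕ → Carrier
  natF zero = 0#
  natF (suc n) = 1# + natF n

  altSign : ℕ → Carrier → Carrier
  altSign zero x = x
  altSign (suc n) x = - altSign n x

  Δcoef : ℕ → ℕ → ℕ → Carrier
  Δcoef i a b with (q ∸ 1) ∣? i | 0 ℕ.<? i | i ℕ.<? a ℕ.+ b
  ... | yes _ | yes _ | yes _ =
    altSign (a ∸ 1) (natF ((i ∸ 1) C (a ∸ 1))) + altSign (b ∸ 1) (natF ((i ∸ 1) C (b ∸ 1)))
  ... | _ | _ | _ = 0#

  -- Shuffle of a single letter with a word: x_k ⧢ w (the general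
  -- recursive definition specialised to 𝔞 = x_k, i.e. 𝔞₋ = 1):
  --   x_k ⧢ 1 = x_k
  --   x_k ⧢ 𝔟 = x_k 𝔟 + x_b (x_k ⧢ 𝔟₋) + x_k ◇ 𝔟
  --   x_k ◇ 𝔟 = x_{k+b} 𝔟₋ + Σ_{i+j=k+b} Δ^j_{k,b} x_i (x_j ⧢ 𝔟₋)
  lsh : ℕ → Word → 𝔠
  lsh k [] = word [ k ]
  lsh k (b ∷ bs) =
    pre k (word (b ∷ bs))
    ++ pre b (lsh k bs)
    ++ (pre (k ℕ.+ b) (word bs)
        ++ concatMap (λ j → scale (Δcoef j k b) (pre ((k ℕ.+ b) ∸ j) (lsh j bs)))
                     (upTo (suc (k ℕ.+ b))))

  -- The diamond part, given s = 𝔞₋ ⧢ 𝔟₋: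
  --   x_{a+b} s + Σ_{i+j=a+b} Δ^j_{a,b} x_i (x_j ⧢ s)
  diamondPart : ℕ → ℕ → 𝔠 → 𝔠
  diamondPart a b s =
    pre (a ℕ.+ b) s
    ++ concatMap (λ j → scale (Δcoef j a b) (pre ((a ℕ.+ b) ∸ j) (ext (lsh j) s)))
                 (upTo (suc (a ℕ.+ b)))

  shW : Word → Word → 𝔠
  shW [] w = word w
  shW (a ∷ as) [] = word (a ∷ as)
  shW (a ∷ as) (b ∷ bs) =
    pre a (shW as (b ∷ bs)) ++ pre b (shW (a ∷ as) bs) ++ diamondPart a b (shW as bs)

  diamondW : Word → Word → 𝔠
  diamondW [] w = word w
  diamondW (a ∷ as) [] = word (a ∷ as)
  diamondW (a ∷ as) (b ∷ bs) = diamondPart a b (shW as bs)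

  triW : Word → Word → 𝔠
  triW [] w = word w
  triW (a ∷ as) [] = word (a ∷ as)
  triW (a ∷ as) (b ∷ bs) = pre a (shW as (b ∷ bs))

  _⧢_ : 𝔠 → 𝔠 → 𝔠
  _⧢_ = ext₂ shW

  _◇_ : 𝔠 → 𝔠 → 𝔠
  _◇_ = ext₂ diamondW

  _▷_ : 𝔠 → 𝔠 → 𝔠
  _▷_ = ext₂ triW

  tensor : 𝔠 → 𝔠 → 𝔠⊗𝔠
  tensor = ext₂ (λ w v → [ (1# , (w , v)) ])

  _⧢₂_ : 𝔠⊗𝔠 → 𝔠⊗𝔠 → 𝔠⊗𝔠
  _⧢₂_ = ext₂ (λ { (a₁ , b₁) (a₂ , b₂) → tensor (shW a₁ a₂) (shW b₁ b₂) })

  -- Δ on words, given the values dx n = Δ(x_n) on letters: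
  --   Δ(1) = 1 ⊗ 1,  Δ(x_u) = dx u,
  --   Δ(x_u 𝔳) = 1 ⊗ x_u 𝔳 + Σ (a_u ▷ a_𝔳) ⊗ (b_u ⧢ b_𝔳)   (depth > 1),
  -- where Σ a_u ⊗ b_u = Δ(x_u) - 1 ⊗ x_u.
  ΔW : (ℕ → 𝔠⊗𝔠) → Word → 𝔠⊗𝔠
  ΔW dx [] = [ (1# , ([] , [])) ]
  ΔW dx (u ∷ []) = dx u
  ΔW dx (u ∷ v ∷ vs) =
    (1# , ([] , u ∷ v ∷ vs))
    ∷ ext₂ (λ { (a₁ , b₁) (a₂ , b₂) → tensor (triW a₁ a₂) (shW b₁ b₂) })
           (dx u ++ neg [ (1# , ([] , [ u ])) ])
           (ΔW dx (v ∷ vs))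

  -- One step of the recursion defining Δ(x_w), given Δ on letters of
  -- smaller weight (the oracle dx):
  --   Δ(x_1) = 1 ⊗ x_1 + x_1 ⊗ 1,
  --   Δ(x_w) = Δ(x_1) ⧢ Δ(x_{w-1}) - Δ(x_1 x_{w-1}) - Δ(x_{w-1} x_1)
  --            - Σ_{0<j<w} Δ^j_{1,w-1} Δ(x_{w-j} x_j)        (w ≥ 2).
  -- (The value at w = 0 is irrelevant: x_0 is not a letter.)
  ΔXstep : (ℕ → 𝔠⊗𝔠) → ℕ → 𝔠⊗𝔠
  ΔXstep dx zero = []
  ΔXstep dx (suc zero) = (1# , ([] , [ 1 ])) ∷ (1# , ([ 1 ] , [])) ∷ []
  ΔXstep dx (suc (suc k)) =
    (ΔW dx [ 1 ] ⧢₂ ΔW dx [ suc k ])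
    ++ neg (ΔW dx (1 ∷ suc k ∷ []))
    ++ neg (ΔW dx (suc k ∷ 1 ∷ []))
    ++ neg (concatMap (λ j → scale (Δcoef j 1 (suc k)) (ΔW dx ((suc (suc k) ∸ j) ∷ j ∷ [])))
                      (map suc (upTo (suc k))))

  -- ΔXiter n m = Δ(x_m) for 1 ≤ m ≤ n
  ΔXiter : ℕ → ℕ → 𝔠⊗𝔠
  ΔXiter zero = λ _ → []
  ΔXiter (suc n) = ΔXstep (ΔXiter n)

  ΔX : ℕ → 𝔠⊗𝔠
  ΔX w = ΔXiter w w

  Δ : Word → 𝔠⊗𝔠
  Δ = ΔW ΔX

  Δlin : 𝔠 → 𝔠⊗𝔠
  Δlin = ext Δ

  Id⊗Δ : 𝔠⊗𝔠 → 𝔠⊗𝔠⊗𝔠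
  Id⊗Δ = ext (λ { (a , b) → map (λ { (k , (b₁ , b₂)) → (k , (a , b₁ , b₂)) }) (Δ b) })

  Δ⊗Id : 𝔠⊗𝔠 → 𝔠⊗𝔠⊗𝔠
  Δ⊗Id = ext (λ { (a , b) → map (λ { (k , (a₁ , a₂)) → (k , (a₁ , a₂ , b)) }) (Δ a) })

{-# OPTIONS --safe #-}

-- Put x_0 = 1 and L(w) = x_1 ◇ w. The coproduct recursion says exactly that Δ(L y) = 1 ⊗ L y + (L ⊗ Id) Δ(y)
-- for letters y, and Δ(x_1 v) = 1 ⊗ x_1 v + (x_1 ⊗ Id) Δ(v). Since x_1 ◇ x_b v = x_{b+1} v + (words with smaller
-- first letter), the words L^n (x_1 v) span, so sending the letter n of the quasi-shuffle algebra of compositions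
-- to L^n x_1 gives a surjection ψ from quasi-symmetric functions. It is an algebra homomorphism because
-- L (y ▷ z) = L y ▷ z and L (y ◇ z) = L y ◇ z, and it carries deconcatenation to Δ; coassociativity and
-- multiplicativity of Δ are inherited from deconcatenation.
--
-- On letters, L (x_b ◇ x_c) = L x_b ◇ x_c is an identity of generating series. With X(t) = Σ x_n t^{n-1} and
-- W(t) = Σ_{(q-1) | n, n ≥ 0} x_n t^{n-1}, the definition of Δ^j_{a,b} reads X(s) ◇ X(t) = (X(s) - X(t)) ▷ W(s - t), and
-- the identity becomes the addition formula W(u) ⧢ W(v) = W(u + v) ⧢ (W(u) + W(v)). The latter follows from the
-- translation invariance of the sums Σ_{λ ∈ 𝔽_q} (v + λ u)^{i-1} and from (1 + z)^q = 1 + z^q.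

module Submission where

open import Defs
open import Level using (Level; _⊔_)
open import Algebra.Bundles using (CommutativeRing)
open import Data.Nat as ℕ using (ℕ; zero; suc; _∸_; _≤_; z≤n; s≤s)
open import Data.List.Relation.Unary.All using (All; []; _∷_)
open import Algebra.Morphism.Structures using (IsRingHomomorphism)
import Algebra.Properties.CommutativeMonoid.Sum
open import Algebra.Properties.CommutativeSemigroup using (x∙yz≈y∙xz; interchange)
import Algebra.Properties.CommutativeSemiring.Exp
import Algebra.Properties.Ring
import Algebra.Properties.Semiring.Exp
import Algebra.Properties.Semiring.Mult.TCOptimised
import Algebra.Solver.Ring
import Algebra.Solver.Ring.AlmostCommutativeRing as ACR
open import Data.Bool using (if_then_else_; true; false)
open import Data.Empty using (⊥-elim)
open import Data.Fin using (Fin)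
import Data.Fin as Fin
import Data.Fin.Permutation as Perm
import Data.Fin.Properties as Finₚ
import Data.Integer as ℤ
import Data.Integer.Properties as ℤₚ
open import Data.List using (List; []; _∷_; _++_; [_]; map; concatMap; upTo; applyUpTo)
import Data.List.Properties as Listₚ
import Data.List.Relation.Unary.All.Properties as Allₚ
open import Data.Maybe using (Maybe; just; nothing)
open import Data.Nat.Combinatorics using (_C_; nCn≡1; nCk+nC[k+1]≡[n+1]C[k+1]; k>n⇒nCk≡0; nCk≡nC[n∸k])
open import Data.Nat.DivMod using (m≡m%n+[m/n]*n; m%n<n)
open import Data.Nat.Divisibility using (_∣_; divides; _∣?_; m%n≡0⇒n∣m; ∣m+n∣m⇒∣n; ∣m∣n⇒∣m+n; ∣⇒≤; ∣-refl; _∣0)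
open import Data.Nat.Induction using (<-rec)
open import Data.Nat.ListAction using (sum)
import Data.Nat.Properties as ℕₚ
open import Data.Product using (Σ; _×_; _,_; proj₁; proj₂)
open import Data.Sum using (inj₁; inj₂)
open import Data.Vec.Functional using (removeAt)
open import Function using (_∘_)
open import Function.Bundles using (Inverse; mk↔ₛ′)
open import Relation.Binary using (DecidableEquality)
open import Relation.Binary.Definitions using (tri<; tri≈; tri>)
import Relation.Binary.PropositionalEquality as ≡
open ≡ using (_≡_)
import Relation.Binary.Reasoning.Setoid
open import Relation.Nullary using (¬_; Dec; yes; no; does)

-- Two circularities shape the proof, and both are cut by induction on weight. Moving `L` past `▷`
-- and `◇` reassociates shuffles of tails, while associativity of the shuffle is itself obtained
-- through `ψ`; the coproduct of `L y` for a word `y` involves multiplicativity on tails, which also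
-- comes from `ψ`. Since `L` raises the weight by one, these tails are lighter than the words
-- compared, so `Step` and `StepΔ` pass from weight below `N` to weight at most `N`. Surjectivity of
-- `ψ` suffices there: linear functionals may be compared on a spanning set.
--
-- The addition formula is used through its coefficients. Being homogeneous, it is taken at `u = 1`,
-- `v = X` in a power series ring, and the exponent of `X` records `b`. With `x_0 = 1` the series
-- `W` has a simple pole; multiplying by `X` clears the pole at `v = 0` and gives the series
-- `e N j`. The terms whose first factor is `x_0` add up to one minus a truncation of `1 / (1 + X)`,
-- whose coefficients are `alternating`.

-- A ring solver with integer coefficients

module IntegerSolver {c ℓ : Level} (R : CommutativeRing c ℓ) where
  open CommutativeRing R
  open Algebra.Properties.Ring ring
  open ℤ using (ℤ; +_; -[1+_]; _⊖_)
  open Algebra.Properties.Semiring.Mult.TCOptimised semiring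
    using (×-homo-+; ×1-homo-*; 1+×) renaming (_×_ to _·_)
  open Relation.Binary.Reasoning.Setoid setoid

  -- Equality in the ring is not assumed decidable, whereas normalisation has to recognise
  -- cancelling coefficients; integers, acting by multiples of `1#`, allow that.
  embed : ℤ → Carrier
  embed (+ n) = n · 1#
  embed -[1+ n ] = - (suc n · 1#)

  embed-⊖ : ∀ m n → embed (m ⊖ n) ≈ m · 1# + - (n · 1#)
  embed-⊖ m zero = sym (trans (+-congˡ -0#≈0#) (+-identityʳ _))
  embed-⊖ zero (suc n) = sym (+-identityˡ _)
  embed-⊖ (suc m) (suc n) = begin
    embed (suc m ⊖ suc n)  ≡⟨ ≡.cong embed (ℤₚ.[1+m]⊖[1+n]≡m⊖n m n) ⟩
    embed (m ⊖ n)          ≈⟨ embed-⊖ m n ⟩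
    m · 1# + - (n · 1#)    ≈⟨ +-congʳ (trans (+-congʳ (-‿inverseˡ 1#)) (+-identityˡ _)) ⟨
    (- 1# + 1#) + m · 1# + - (n · 1#)        ≈⟨ +-congʳ (+-assoc _ _ _) ⟩
    (- 1# + (1# + m · 1#)) + - (n · 1#)      ≈⟨ +-congʳ (+-comm _ _) ⟩
    ((1# + m · 1#) + - 1#) + - (n · 1#)      ≈⟨ +-assoc _ _ _ ⟩
    (1# + m · 1#) + (- 1# + - (n · 1#))      ≈⟨ +-congˡ (-‿+-comm 1# (n · 1#)) ⟩
    (1# + m · 1#) + - (1# + n · 1#)          ≈⟨ +-cong (1+× m 1#) (-‿cong (1+× n 1#)) ⟨
    suc m · 1# + - (suc n · 1#)              ∎

  embed-neg : ∀ i → embed (ℤ.- i) ≈ - embed i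
  embed-neg (+ zero) = sym -0#≈0#
  embed-neg (+ suc n) = refl
  embed-neg -[1+ n ] = sym (-‿involutive _)

  embed-+ : ∀ i j → embed (i ℤ.+ j) ≈ embed i + embed j
  embed-+ (+ m) (+ n) = ×-homo-+ 1# m n
  embed-+ (+ m) -[1+ n ] = embed-⊖ m (suc n)
  embed-+ -[1+ m ] (+ n) = trans (embed-⊖ n (suc m)) (+-comm _ _)
  embed-+ -[1+ m ] -[1+ n ] = begin
    - (suc (suc (m ℕ.+ n)) · 1#)         ≡⟨ ≡.cong (λ k → - (suc k · 1#)) (≡.sym (ℕₚ.+-suc m n)) ⟩
    - ((suc m ℕ.+ suc n) · 1#)           ≈⟨ -‿cong (×-homo-+ 1# (suc m) (suc n)) ⟩
    - (suc m · 1# + suc n · 1#)          ≈⟨ -‿+-comm _ _ ⟨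
    - (suc m · 1#) + - (suc n · 1#)      ∎

  embed-*⁺ : ∀ m j → embed (+ m ℤ.* j) ≈ m · 1# * embed j
  embed-*⁺ m (+ n) = trans (reflexive (≡.cong embed (≡.sym (ℤₚ.pos-* m n)))) (×1-homo-* m n)
  embed-*⁺ m -[1+ n ] = begin
    embed (+ m ℤ.* -[1+ n ])              ≡⟨ ≡.cong embed (≡.sym (ℤₚ.neg-distribʳ-* (+ m) (+ suc n))) ⟩
    embed (ℤ.- (+ m ℤ.* + suc n))         ≈⟨ embed-neg (+ m ℤ.* + suc n) ⟩
    - embed (+ m ℤ.* + suc n)             ≈⟨ -‿cong (embed-*⁺ m (+ suc n)) ⟩
    - (m · 1# * (suc n · 1#))             ≈⟨ -‿distribʳ-* _ _ ⟩
    m · 1# * - (suc n · 1#)               ∎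

  embed-* : ∀ i j → embed (i ℤ.* j) ≈ embed i * embed j
  embed-* (+ m) j = embed-*⁺ m j
  embed-* -[1+ m ] j = begin
    embed (-[1+ m ] ℤ.* j)                ≡⟨ ≡.cong embed (≡.sym (ℤₚ.neg-distribˡ-* (+ suc m) j)) ⟩
    embed (ℤ.- (+ suc m ℤ.* j))           ≈⟨ embed-neg (+ suc m ℤ.* j) ⟩
    - embed (+ suc m ℤ.* j)               ≈⟨ -‿cong (embed-*⁺ (suc m) j) ⟩
    - (suc m · 1# * embed j)              ≈⟨ -‿distribˡ-* _ _ ⟩
    - (suc m · 1#) * embed j              ∎

  private
    morphism : ℤ.+-*-rawRing ACR.-Raw-AlmostCommutative⟶ ACR.fromCommutativeRing R
    morphism = record
      { ⟦_⟧ = embed ; +-homo = embed-+ ; *-homo = embed-* ; -‿homo = embed-neg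
      ; 0-homo = refl ; 1-homo = refl }

    decide : ∀ i j → Maybe (embed i ≈ embed j)
    decide i j with i ℤ.≟ j
    ... | yes i≡j = just (reflexive (≡.cong embed i≡j))
    ... | no _    = nothing

  open Algebra.Solver.Ring ℤ.+-*-rawRing (ACR.fromCommutativeRing R) morphism decide public
    using (Polynomial; solve; _:=_; _:+_; _:*_; _:-_; :-_; con)

  :0 :1 : ∀ {n} → Polynomial n
  :0 = con (+ 0)
  :1 = con (+ 1)

-- Finite sums over initial segments

module Sums {c ℓ : Level} (R : CommutativeRing c ℓ) where
  open CommutativeRing R
  open Algebra.Properties.Ring ring
  open Relation.Binary.Reasoning.Setoid setoid
  open IntegerSolver R

  opaque
    Σ< : ℕ → (ℕ → Carrier) → Carrier
    Σ< zero f = 0#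
    Σ< (suc n) f = f 0 + Σ< n (f ∘ suc)

    Σ-nil : ∀ (f : ℕ → Carrier) → Σ< 0 f ≈ 0#
    Σ-nil f = refl

    Σ-suc : ∀ n (f : ℕ → Carrier) → Σ< (suc n) f ≈ f 0 + Σ< n (f ∘ suc)
    Σ-suc n f = refl

    Σ-cong< : ∀ n {f g : ℕ → Carrier} → (∀ i → i ℕ.< n → f i ≈ g i) → Σ< n f ≈ Σ< n g
    Σ-cong< zero e = refl
    Σ-cong< (suc n) e = +-cong (e 0 (s≤s z≤n)) (Σ-cong< n (λ i i<n → e (suc i) (s≤s i<n)))

    Σ-cong : ∀ n {f g : ℕ → Carrier} → (∀ i → f i ≈ g i) → Σ< n f ≈ Σ< n g
    Σ-cong n e = Σ-cong< n (λ i _ → e i)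

    Σ-zero : ∀ n {f : ℕ → Carrier} → (∀ i → i ℕ.< n → f i ≈ 0#) → Σ< n f ≈ 0#
    Σ-zero zero e = refl
    Σ-zero (suc n) e = trans (+-cong (e 0 (s≤s z≤n)) (Σ-zero n (λ i i<n → e (suc i) (s≤s i<n)))) (+-identityˡ 0#)

    Σ-+ : ∀ n (f g : ℕ → Carrier) → Σ< n (λ i → f i + g i) ≈ Σ< n f + Σ< n g
    Σ-+ zero f g = sym (+-identityˡ 0#)
    Σ-+ (suc n) f g = trans (+-congˡ (Σ-+ n _ _))
      (solve 4 (λ a b x y → (a :+ b) :+ (x :+ y) := (a :+ x) :+ (b :+ y)) refl _ _ _ _)

    Σ-*ˡ : ∀ n k (f : ℕ → Carrier) → Σ< n (λ i → k * f i) ≈ k * Σ< n f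
    Σ-*ˡ zero k f = sym (zeroʳ k)
    Σ-*ˡ (suc n) k f = trans (+-congˡ (Σ-*ˡ n k _)) (sym (distribˡ _ _ _))

    Σ-*ʳ : ∀ n k (f : ℕ → Carrier) → Σ< n (λ i → f i * k) ≈ Σ< n f * k
    Σ-*ʳ n k f = trans (Σ-cong n (λ i → *-comm _ _)) (trans (Σ-*ˡ n k f) (*-comm _ _))

    Σ-neg : ∀ n (f : ℕ → Carrier) → Σ< n (λ i → - f i) ≈ - Σ< n f
    Σ-neg n f = trans (Σ-cong n (λ i → sym (-1*x≈-x _))) (trans (Σ-*ˡ n (- 1#) f) (-1*x≈-x _))

    Σ-swap : ∀ m n (f : ℕ → ℕ → Carrier) → Σ< m (λ i → Σ< n (f i)) ≈ Σ< n (λ j → Σ< m (λ i → f i j))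
    Σ-swap zero n f = sym (Σ-zero n (λ _ _ → refl))
    Σ-swap (suc m) n f = trans (+-congˡ (Σ-swap m n (f ∘ suc))) (sym (Σ-+ n _ _))

    Σ-last : ∀ n (f : ℕ → Carrier) → Σ< (suc n) f ≈ Σ< n f + f n
    Σ-last zero f = +-comm _ _
    Σ-last (suc n) f = trans (+-congˡ (Σ-last n (f ∘ suc))) (sym (+-assoc _ _ _))

    Σ-split : ∀ m n (f : ℕ → Carrier) → Σ< (m ℕ.+ n) f ≈ Σ< m f + Σ< n (λ i → f (m ℕ.+ i))
    Σ-split zero n f = sym (+-identityˡ _)
    Σ-split (suc m) n f = trans (+-congˡ (Σ-split m n (f ∘ suc))) (sym (+-assoc _ _ _))

    Σ-reverse : ∀ n (f : ℕ → Carrier) → Σ< (suc n) f ≈ Σ< (suc n) (λ i → f (n ∸ i))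
    Σ-reverse zero f = refl
    Σ-reverse (suc n) f = begin
      Σ< (suc (suc n)) f                          ≈⟨ Σ-last (suc n) f ⟩
      Σ< (suc n) f + f (suc n)                    ≈⟨ +-comm _ _ ⟩
      f (suc n) + Σ< (suc n) f                    ≈⟨ +-congˡ (Σ-reverse n f) ⟩
      f (suc n) + Σ< (suc n) (λ i → f (n ∸ i))    ∎

    -- Both sides run over the pairs `(j, k)` with `j + k ≤ n`, by rows and by antidiagonals. The
    -- induction removes the row `j = 0`, which meets every antidiagonal once.
    Σ-triangle : ∀ n (f : ℕ → ℕ → Carrier) →
      Σ< (suc n) (λ j → Σ< (suc (n ∸ j)) (f j)) ≈ Σ< (suc n) (λ s → Σ< (suc s) (λ j → f j (s ∸ j)))
    Σ-triangle zero f = refl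
    Σ-triangle (suc n) f = begin
      Σ< (suc (suc n)) (f 0) + Σ< (suc n) (λ j → Σ< (suc (n ∸ j)) (f (suc j)))
        ≈⟨ +-cong refl (Σ-triangle n (f ∘ suc)) ⟩
      (f 0 0 + Σ< (suc n) (f 0 ∘ suc)) + Σ< (suc n) (λ s → Σ< (suc s) (λ j → f (suc j) (s ∸ j)))
        ≈⟨ +-assoc _ _ _ ⟩
      f 0 0 + (Σ< (suc n) (f 0 ∘ suc) + Σ< (suc n) (λ s → Σ< (suc s) (λ j → f (suc j) (s ∸ j))))
        ≈⟨ +-congˡ (sym (Σ-+ (suc n) (f 0 ∘ suc) (λ s → Σ< (suc s) (λ j → f (suc j) (s ∸ j))))) ⟩
      f 0 0 + Σ< (suc n) (λ s → f 0 (suc s) + Σ< (suc s) (λ j → f (suc j) (s ∸ j)))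
        ≈⟨ +-congʳ (sym (+-identityʳ _)) ⟩
      (f 0 0 + 0#) + Σ< (suc n) (λ s → f 0 (suc s) + Σ< (suc s) (λ j → f (suc j) (s ∸ j))) ∎

    Σ-triangle′ : ∀ n (f : ℕ → ℕ → Carrier) →
      Σ< (suc n) (λ k → Σ< (suc (n ∸ k)) (λ j → f j k)) ≈ Σ< (suc n) (λ s → Σ< (suc s) (λ j → f j (s ∸ j)))
    Σ-triangle′ n f = trans (Σ-triangle n (λ k j → f j k))
      (Σ-cong (suc n) (λ s → trans (Σ-reverse s (λ k → f (s ∸ k) k))
        (Σ-cong< (suc s) (λ i i≤s → reflexive (≡.cong (λ k → f k (s ∸ i)) (ℕₚ.m∸[m∸n]≡n (ℕₚ.≤-pred i≤s)))))))

    Σ-extend : ∀ m n (f : ℕ → Carrier) → m ℕ.≤ n → (∀ i → m ℕ.≤ i → f i ≈ 0#) → Σ< n f ≈ Σ< m f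
    Σ-extend zero n f m≤n e = Σ-zero n (λ i _ → e i z≤n)
    Σ-extend (suc m) (suc n) f (s≤s m≤n) e = +-congˡ (Σ-extend m n (f ∘ suc) m≤n (λ i m≤i → e (suc i) (s≤s m≤i)))

  δ : ℕ → ℕ → Carrier
  δ zero zero = 1#
  δ zero (suc _) = 0#
  δ (suc _) zero = 0#
  δ (suc i) (suc j) = δ i j

  δ-refl : ∀ i → δ i i ≈ 1#
  δ-refl zero = refl
  δ-refl (suc i) = δ-refl i

  δ-≢ : ∀ i j → ¬ (i ≡ j) → δ i j ≈ 0#
  δ-≢ zero zero i≢j with () ← i≢j ≡.refl
  δ-≢ zero (suc j) i≢j = refl
  δ-≢ (suc i) zero i≢j = refl
  δ-≢ (suc i) (suc j) i≢j = δ-≢ i j (i≢j ∘ ≡.cong suc)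

  Σ-δ : ∀ n i (f : ℕ → Carrier) → i ℕ.< n → Σ< n (λ j → δ i j * f j) ≈ f i
  Σ-δ (suc n) zero f i<n = trans (Σ-suc n _) (trans (+-cong (*-identityˡ _) (Σ-zero n (λ _ _ → zeroˡ _))) (+-identityʳ _))
  Σ-δ (suc n) (suc i) f (s≤s i<n) = trans (Σ-suc n _) (trans (+-cong (zeroˡ _) (Σ-δ n i (f ∘ suc) i<n)) (+-identityˡ _))

-- A field with `m + 1` elements: Fermat, binomials, power sums

module FiniteField {c ℓ : Level} (F : CommutativeRing c ℓ) (isField : IsField F)
                   (m : ℕ) (card : HasCardinality F (suc m)) where
  open CommutativeRing F
  open IsField isField
  open Algebra.Properties.Ring ring
  open Algebra.Properties.Semiring.Exp semiring
    using (_^_; ^-congˡ; ^-congʳ; ^-homo-*; ^-assocʳ)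
  open Algebra.Properties.CommutativeSemiring.Exp commutativeSemiring using (^-distrib-*)
  open Relation.Binary.Reasoning.Setoid setoid
  open IntegerSolver F
  open Sums F
  open Construction F (suc m) using (natF)
  open Inverse card using (to; from; inverseˡ; inverseʳ; from-cong)

  to-from : ∀ x → to (from x) ≈ x
  to-from x = inverseˡ ≡.refl

  from-to : ∀ i → from (to i) ≡ i
  from-to i = inverseʳ refl

  _≈?_ : ∀ x y → Dec (x ≈ y)
  x ≈? y with from x Fin.≟ from y
  ... | yes e = yes (trans (sym (to-from x)) (trans (reflexive (≡.cong to e)) (to-from y)))
  ... | no ne = no (λ e → ne (from-cong e))

  cancel : ∀ x y → ¬ (x ≈ 0#) → x * y ≈ 0# → y ≈ 0#
  cancel x y x≉0 xy≈0 with inverse x x≉0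
  ... | x⁻¹ , xx⁻¹≈1 = begin
    y              ≈⟨ *-identityˡ y ⟨
    1# * y         ≈⟨ *-congʳ xx⁻¹≈1 ⟨
    (x * x⁻¹) * y  ≈⟨ solve 3 (λ a b d → (a :* b) :* d := b :* (a :* d)) refl x x⁻¹ y ⟩
    x⁻¹ * (x * y)  ≈⟨ *-congˡ xy≈0 ⟩
    x⁻¹ * 0#       ≈⟨ zeroʳ _ ⟩
    0#             ∎

  x-y≈0⇒x≈y : ∀ {x y} → x - y ≈ 0# → x ≈ y
  x-y≈0⇒x≈y {x} {y} e = begin
    x            ≈⟨ solve 2 (λ a b → a := (a :- b) :+ b) refl x y ⟩
    (x - y) + y  ≈⟨ +-congʳ e ⟩
    0# + y       ≈⟨ +-identityˡ y ⟩
    y            ∎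

  m>0 : 0 ℕ.< m
  m>0 = ℕₚ.n≢0⇒n>0 (λ m≡0 → 1≉0 (begin
    1#             ≈⟨ to-from 1# ⟨
    to (from 1#)   ≡⟨ ≡.cong to (Fin1-unique m m≡0 (from 1#) (from 0#)) ⟩
    to (from 0#)   ≈⟨ to-from 0# ⟩
    0#             ∎))
    where
    Fin1-unique : ∀ k → k ≡ 0 → (i j : Fin (suc k)) → i ≡ j
    Fin1-unique zero _ Fin.zero Fin.zero = ≡.refl

  -- A polynomial is a coefficient function cut off at `n`, so degree below `q` means `suc m`
  -- coefficients.
  horner : ℕ → (ℕ → Carrier) → Carrier → Carrier
  horner zero f x = 0#
  horner (suc n) f x = f 0 + x * horner n (f ∘ suc) x

  horner-cong : ∀ n {f g : ℕ → Carrier} x → (∀ i → f i ≈ g i) → horner n f x ≈ horner n g x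
  horner-cong zero x e = refl
  horner-cong (suc n) x e = +-cong (e 0) (*-congˡ (horner-cong n x (e ∘ suc)))

  horner-+ : ∀ n (f g : ℕ → Carrier) x → horner n (λ i → f i + g i) x ≈ horner n f x + horner n g x
  horner-+ zero f g x = sym (+-identityˡ 0#)
  horner-+ (suc n) f g x = trans (+-congˡ (*-congˡ (horner-+ n (f ∘ suc) (g ∘ suc) x)))
    (solve 5 (λ a b x d e → (a :+ b) :+ x :* (d :+ e) := (a :+ x :* d) :+ (b :+ x :* e)) refl _ _ _ _ _)

  horner-neg : ∀ n (f : ℕ → Carrier) x → horner n (λ i → - f i) x ≈ - horner n f x
  horner-neg zero f x = sym -0#≈0#
  horner-neg (suc n) f x = trans (+-congˡ (*-congˡ (horner-neg n (f ∘ suc) x)))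
    (solve 3 (λ a x d → (:- a) :+ x :* (:- d) := :- (a :+ x :* d)) refl _ _ _)

  horner-zero : ∀ n (f : ℕ → Carrier) x → (∀ i → f i ≈ 0#) → horner n f x ≈ 0#
  horner-zero zero f x e = refl
  horner-zero (suc n) f x e = trans (+-cong (e 0) (trans (*-congˡ (horner-zero n (f ∘ suc) x (e ∘ suc))) (zeroʳ x))) (+-identityˡ 0#)

  horner-δ : ∀ n k x → k ℕ.< n → horner n (δ k) x ≈ x ^ k
  horner-δ (suc n) zero x k<n =
    trans (+-congˡ (trans (*-congˡ (horner-zero n _ x (λ _ → refl))) (zeroʳ x))) (+-identityʳ 1#)
  horner-δ (suc n) (suc k) x (s≤s k<n) = trans (+-identityˡ _) (*-congˡ (horner-δ n k x k<n))

  horner-last : ∀ n (f : ℕ → Carrier) x → horner (suc n) f x ≈ horner n f x + f n * x ^ n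
  horner-last zero f x = solve 2 (λ a x → a :+ x :* :0 := :0 :+ a :* :1) refl (f 0) x
  horner-last (suc n) f x = trans (+-congˡ (*-congˡ (horner-last n (f ∘ suc) x)))
    (solve 5 (λ a x h b p → a :+ x :* (h :+ b :* p) := (a :+ x :* h) :+ b :* (x :* p)) refl _ _ _ _ _)

  -- Synthetic division by `x - a` of a polynomial with `suc n` coefficients: the coefficient of
  -- index `i` is the value at `a` of the part of `f` above index `i`, shifted down.
  quotient : ℕ → (ℕ → Carrier) → Carrier → ℕ → Carrier
  quotient zero f a i = 0#
  quotient (suc n) f a zero = horner (suc n) (f ∘ suc) a
  quotient (suc n) f a (suc i) = quotient n (f ∘ suc) a i

  horner-divide : ∀ n f a x → horner (suc n) f x ≈ horner (suc n) f a + (x - a) * horner n (quotient n f a) x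
  horner-divide zero f a x = solve 3 (λ b a x → b :+ x :* :0 := (b :+ a :* :0) :+ (x :- a) :* :0) refl (f 0) a x
  horner-divide (suc n) f a x = trans (+-congˡ (*-congˡ (horner-divide n (f ∘ suc) a x)))
    (solve 5 (λ b a x e h → b :+ x :* (e :+ (x :- a) :* h) := (b :+ a :* e) :+ (x :- a) :* (e :+ x :* h)) refl
      (f 0) a x (horner (suc n) (f ∘ suc) a) (horner n (quotient n (f ∘ suc) a) x))

  -- The constant coefficient of the quotient is the value of `f ∘ suc` at `a`. Once it vanishes,
  -- the root `a` forces `f 0 ≈ 0#`, and the argument repeats for `f ∘ suc`.
  quotient-zero : ∀ n f a → (∀ i → i ℕ.< n → quotient n f a i ≈ 0#) → horner (suc n) f a ≈ 0# →
                  ∀ i → i ℕ.< suc n → f i ≈ 0#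
  quotient-zero zero f a qz e zero _ = trans (sym (trans (+-congˡ (zeroʳ a)) (+-identityʳ _))) e
  quotient-zero zero f a qz e (suc i) (s≤s ())
  quotient-zero (suc n) f a qz e zero _ = begin
    f 0                                         ≈⟨ +-identityʳ _ ⟨
    f 0 + 0#                                    ≈⟨ +-congˡ (trans (*-congˡ (qz 0 (s≤s z≤n))) (zeroʳ a)) ⟨
    f 0 + a * horner (suc n) (f ∘ suc) a        ≈⟨ e ⟩
    0#                                          ∎
  quotient-zero (suc n) f a qz e (suc i) (s≤s i<n) =
    quotient-zero n (f ∘ suc) a (λ j j<n → qz (suc j) (s≤s j<n)) (qz 0 (s≤s z≤n)) i i<n

  -- After division by the factor of the first root, the quotient vanishes at the other points,
  -- since a difference of distinct points can be cancelled.
  few-roots : ∀ n f (x : Fin n → Carrier) → (∀ i j → x i ≈ x j → i ≡ j) →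
              (∀ i → horner n f (x i) ≈ 0#) → ∀ i → i ℕ.< n → f i ≈ 0#
  few-roots (suc n) f x inj roots = quotient-zero n f (x Fin.zero)
    (few-roots n (quotient n f (x Fin.zero)) (x ∘ Fin.suc) (λ i j e → Finₚ.suc-injective (inj _ _ e)) root)
    (roots Fin.zero)
    where
    root : ∀ i → horner n (quotient n f (x Fin.zero)) (x (Fin.suc i)) ≈ 0#
    root i = cancel (x (Fin.suc i) - x Fin.zero) _
      (λ e → Finₚ.0≢1+n (inj _ _ (sym (x-y≈0⇒x≈y e))))
      (begin
        (x (Fin.suc i) - x Fin.zero) * h           ≈⟨ +-identityˡ _ ⟨
        0# + (x (Fin.suc i) - x Fin.zero) * h      ≈⟨ +-congʳ (roots Fin.zero) ⟨
        horner (suc n) f (x Fin.zero) + (x (Fin.suc i) - x Fin.zero) * h ≈⟨ horner-divide n f _ _ ⟨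
        horner (suc n) f (x (Fin.suc i))           ≈⟨ roots (Fin.suc i) ⟩
        0#                                         ∎)
      where h = horner n (quotient n f (x Fin.zero)) (x (Fin.suc i))

  -- The binomials `C(q, k)` and the power sums are both settled by exhibiting a polynomial of
  -- degree at most `m` that vanishes everywhere.
  vanishing-polynomial : ∀ f → (∀ x → horner (suc m) f x ≈ 0#) → ∀ i → i ℕ.< suc m → f i ≈ 0#
  vanishing-polynomial f roots = few-roots (suc m) f to
    (λ i j e → ≡.trans (≡.sym (from-to i)) (≡.trans (from-cong e) (from-to j))) (λ i → roots (to i))

  permutation : (φ φ⁻¹ : Carrier → Carrier) → (∀ {x y} → x ≈ y → φ x ≈ φ y) → (∀ {x y} → x ≈ y → φ⁻¹ x ≈ φ⁻¹ y) →
                (∀ x → φ (φ⁻¹ x) ≈ x) → (∀ x → φ⁻¹ (φ x) ≈ x) → Perm.Permutation (suc m) (suc m)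
  permutation φ φ⁻¹ φ-cong φ⁻¹-cong rinv linv = mk↔ₛ′ (λ i → from (φ (to i))) (λ i → from (φ⁻¹ (to i)))
    (λ i → ≡.trans (from-cong (trans (φ-cong (to-from _)) (rinv _))) (from-to i))
    (λ i → ≡.trans (from-cong (trans (φ⁻¹-cong (to-from _)) (linv _))) (from-to i))

  module SumOverField {c′ ℓ′ : Level} (A : CommutativeRing c′ ℓ′) where
    private module A = CommutativeRing A
    open Algebra.Properties.CommutativeMonoid.Sum A.+-commutativeMonoid public
      using (sum-cong-≋) renaming (sum to sumFin; ∑-distrib-+ to sumFin-+; sum-remove to sumFin-remove; sum-permute to sumFin-permute)

    sumFin-*ˡ : ∀ {n} k (f : Fin n → A.Carrier) → sumFin (λ i → k A.* f i) A.≈ k A.* sumFin f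
    sumFin-*ˡ {zero} k f = A.sym (A.zeroʳ k)
    sumFin-*ˡ {suc n} k f = A.trans (A.+-congˡ (sumFin-*ˡ k (f ∘ Fin.suc))) (A.sym (A.distribˡ _ _ _))

    opaque
      ΣF : (Carrier → A.Carrier) → A.Carrier
      ΣF f = sumFin (λ i → f (to i))

      ΣF-cong : {f g : Carrier → A.Carrier} → (∀ x → f x A.≈ g x) → ΣF f A.≈ ΣF g
      ΣF-cong e = sum-cong-≋ (λ i → e (to i))

      ΣF-reindex : (f : Carrier → A.Carrier) → (∀ {x y} → x ≈ y → f x A.≈ f y) →
        (φ φ⁻¹ : Carrier → Carrier) → (∀ {x y} → x ≈ y → φ x ≈ φ y) → (∀ {x y} → x ≈ y → φ⁻¹ x ≈ φ⁻¹ y) →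
        (∀ x → φ (φ⁻¹ x) ≈ x) → (∀ x → φ⁻¹ (φ x) ≈ x) → ΣF f A.≈ ΣF (f ∘ φ)
      ΣF-reindex f f-cong φ φ⁻¹ φ-cong φ⁻¹-cong rinv linv =
        A.trans (sumFin-permute (λ i → f (to i)) (permutation φ φ⁻¹ φ-cong φ⁻¹-cong rinv linv))
                (sum-cong-≋ {suc m} {λ i → f (to (from (φ (to i))))} {λ i → f (φ (to i))} (λ i → f-cong (to-from (φ (to i)))))

      ΣF-+ : ∀ f g → ΣF (λ x → f x A.+ g x) A.≈ ΣF f A.+ ΣF g
      ΣF-+ f g = sumFin-+ (λ i → f (to i)) (λ i → g (to i))

      ΣF-*ˡ : ∀ k f → ΣF (λ x → k A.* f x) A.≈ k A.* ΣF f
      ΣF-*ˡ k f = sumFin-*ˡ k (λ i → f (to i))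

  module Π = Algebra.Properties.CommutativeMonoid.Sum *-commutativeMonoid
  open SumOverField F

  product-nonzero : ∀ {n} (f : Fin n → Carrier) → (∀ i → ¬ (f i ≈ 0#)) → ¬ (Π.sum f ≈ 0#)
  product-nonzero {zero} f nz = 1≉0
  product-nonzero {suc n} f nz e = product-nonzero (f ∘ Fin.suc) (nz ∘ Fin.suc) (cancel _ _ (nz Fin.zero) e)

  product-const : ∀ {n} (f : Fin n → Carrier) k → (∀ i → f i ≈ k) → Π.sum f ≈ k ^ n
  product-const {zero} f k e = refl
  product-const {suc n} f k e = *-cong (e Fin.zero) (product-const (f ∘ Fin.suc) k (e ∘ Fin.suc))

  -- Products over the nonzero elements are taken over the whole field, with the factor at `0`
  -- replaced by `1`.
  0↦1 : Carrier → Carrier → Carrier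
  0↦1 k x with x ≈? 0#
  ... | yes _ = 1#
  ... | no _  = k

  0↦1-zero : ∀ k {x} → x ≈ 0# → 0↦1 k x ≈ 1#
  0↦1-zero k {x} e with x ≈? 0#
  ... | yes _ = refl
  ... | no ne = ⊥-elim (ne e)

  0↦1-nonzero : ∀ k {x} → ¬ (x ≈ 0#) → 0↦1 k x ≈ k
  0↦1-nonzero k {x} ne with x ≈? 0#
  ... | yes e = ⊥-elim (ne e)
  ... | no _ = refl

  -- Multiplication by `μ` permutes the nonzero elements, so their product `G` satisfies
  -- `G = μ ^ m * G`, and `G` is nonzero.
  fermat : ∀ μ → ¬ (μ ≈ 0#) → μ ^ m ≈ 1#
  fermat μ μ≉0 with inverse μ μ≉0
  ... | μ⁻¹ , μμ⁻¹≈1 = x-y≈0⇒x≈y (cancel G _ G≉0 (begin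
    G * (μ ^ m - 1#)      ≈⟨ solve 2 (λ g p → g :* (p :- :1) := p :* g :- g) refl G (μ ^ m) ⟩
    μ ^ m * G - G         ≈⟨ +-congʳ G-invariant ⟨
    G - G                 ≈⟨ -‿inverseʳ G ⟩
    0#                    ∎))
    where
    g : Fin (suc m) → Carrier
    g i = 0↦1 (to i) (to i)
    h : Fin (suc m) → Carrier
    h i = 0↦1 μ (to i)
    G = Π.sum g
    g≉0 : ∀ i → ¬ (g i ≈ 0#)
    g≉0 i e with to i ≈? 0#
    ... | yes _ = 1≉0 e
    ... | no ne = ne e
    G≉0 = product-nonzero g g≉0
    mul-inverse : ∀ x → μ * (μ⁻¹ * x) ≈ x
    mul-inverse x = trans (sym (*-assoc _ _ _)) (trans (*-congʳ μμ⁻¹≈1) (*-identityˡ x))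
    inverse-mul : ∀ x → μ⁻¹ * (μ * x) ≈ x
    inverse-mul x = trans (solve 3 (λ a b x → a :* (b :* x) := b :* (a :* x)) refl _ _ _) (mul-inverse x)
    π = permutation (μ *_) (μ⁻¹ *_) *-congˡ *-congˡ mul-inverse inverse-mul
    g-π : ∀ i → g (π Perm.⟨$⟩ʳ i) ≈ h i * g i
    g-π i with to i ≈? 0#
    ... | yes e = trans (0↦1-zero _ (trans (to-from _) (trans (*-congˡ e) (zeroʳ μ)))) (sym (*-identityˡ 1#))
    ... | no ne = trans (0↦1-nonzero _ (λ e → ne (cancel μ _ μ≉0 (trans (sym (to-from _)) e)))) (to-from _)
    i₀ = from 0#
    Πh : Π.sum h ≈ μ ^ m
    Πh = trans (Π.sum-remove {i = i₀} h) (trans (*-cong (0↦1-zero μ (to-from 0#))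
      (product-const (removeAt h i₀) μ (λ j → 0↦1-nonzero μ (λ e →
        Finₚ.punchInᵢ≢i i₀ j (≡.trans (≡.sym (from-to _)) (from-cong e)))))) (*-identityˡ _))
    G-invariant : G ≈ μ ^ m * G
    G-invariant = begin
      G                                       ≈⟨ Π.sum-permute g π ⟩
      Π.sum (λ i → g (π Perm.⟨$⟩ʳ i))         ≈⟨ Π.sum-cong-≋ g-π ⟩
      Π.sum (λ i → h i * g i)                 ≈⟨ Π.∑-distrib-+ h g ⟩
      Π.sum h * G                             ≈⟨ *-congʳ Πh ⟩
      μ ^ m * G                               ∎

  frobenius-fixes : ∀ x → x ^ suc m ≈ x
  frobenius-fixes x with x ≈? 0#
  ... | yes e = trans (*-congʳ e) (trans (zeroˡ _) (sym e))
  ... | no ne = trans (*-congˡ (fermat x ne)) (*-identityʳ x)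

  1^n≈1 : ∀ n → 1# ^ n ≈ 1#
  1^n≈1 zero = refl
  1^n≈1 (suc n) = trans (*-identityˡ _) (1^n≈1 n)

  natF-+ : ∀ a b → natF (a ℕ.+ b) ≈ natF a + natF b
  natF-+ zero b = sym (+-identityˡ _)
  natF-+ (suc a) b = trans (+-congˡ (natF-+ a b)) (sym (+-assoc _ _ _))

  natF-pascal : ∀ n k → natF (suc n C suc k) ≈ natF (n C k) + natF (n C suc k)
  natF-pascal n k = trans (reflexive (≡.cong natF (≡.sym (nCk+nC[k+1]≡[n+1]C[k+1] n k)))) (natF-+ (n C k) (n C suc k))

  natF-nC0 : ∀ n → natF (n C 0) ≈ 1#
  natF-nC0 n = +-identityʳ 1#

  natF-nCn : ∀ n → natF (n C n) ≈ 1#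
  natF-nCn n = trans (reflexive (≡.cong natF (nCn≡1 n))) (+-identityʳ 1#)

  natF-C-zero : ∀ {n k} → n ℕ.< k → natF (n C k) ≈ 0#
  natF-C-zero n<k = reflexive (≡.cong natF (k>n⇒nCk≡0 n<k))

  horner-binomial : ∀ n x → horner (suc n) (λ i → natF (n C i)) x ≈ (1# + x) ^ n
  horner-binomial zero x = trans (+-cong (natF-nC0 0) (zeroʳ x)) (+-identityʳ 1#)
  horner-binomial (suc n) x = begin
    natF (suc n C 0) + x * horner (suc n) (λ i → natF (suc n C suc i)) x
      ≈⟨ +-cong (natF-nC0 (suc n)) (*-congˡ (trans (horner-cong (suc n) x (natF-pascal n))
           (horner-+ (suc n) (λ i → natF (n C i)) (λ i → natF (n C suc i)) x))) ⟩
    1# + x * (horner (suc n) (λ i → natF (n C i)) x + horner (suc n) (λ i → natF (n C suc i)) x)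
      ≈⟨ +-congˡ (*-congˡ (+-cong (horner-binomial n x) (trans (horner-last n (λ i → natF (n C suc i)) x)
           (trans (+-congˡ (trans (*-congʳ (natF-C-zero (ℕₚ.n<1+n n))) (zeroˡ _))) (+-identityʳ _))))) ⟩
    1# + x * ((1# + x) ^ n + horner n (λ i → natF (n C suc i)) x)
      ≈⟨ solve 4 (λ o x p h → o :+ x :* (p :+ h) := (o :+ x :* h) :+ x :* p) refl _ _ _ _ ⟩
    (1# + x * horner n (λ i → natF (n C suc i)) x) + x * (1# + x) ^ n
      ≈⟨ +-congʳ (trans (+-congʳ (sym (natF-nC0 n))) (horner-binomial n x)) ⟩
    (1# + x) ^ n + x * (1# + x) ^ n
      ≈⟨ solve 2 (λ x p → p :+ x :* p := (:1 :+ x) :* p) refl x _ ⟩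
    (1# + x) * (1# + x) ^ n ∎

  -- The polynomial `(1 + x) ^ q - x ^ q - 1` has degree below `q`, and it vanishes everywhere
  -- because each element is its own `q`-th power.
  qCk≈0 : ∀ k → k ℕ.< m → natF (suc m C suc k) ≈ 0#
  qCk≈0 k k<m = trans (sym (trans (+-congˡ -0#≈0#) (+-identityʳ _)))
    (vanishing-polynomial (λ i → natF (suc m C i) - δ 0 i) root (suc k) (s≤s k<m))
    where
    root : ∀ x → horner (suc m) (λ i → natF (suc m C i) - δ 0 i) x ≈ 0#
    root x = begin
      horner (suc m) (λ i → natF (suc m C i) - δ 0 i) x
        ≈⟨ trans (horner-+ (suc m) (λ i → natF (suc m C i)) (λ i → - δ 0 i) x) (+-congˡ (trans (horner-neg (suc m) (δ 0) x) (-‿cong (horner-δ (suc m) 0 x (s≤s z≤n))))) ⟩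
      h - 1#
        ≈⟨ solve 3 (λ h p o → h :- o := (h :+ p) :- (p :+ o)) refl h (x ^ suc m) 1# ⟩
      (h + x ^ suc m) - (x ^ suc m + 1#)
        ≈⟨ +-cong (trans (+-congˡ (sym (trans (*-congʳ (natF-nCn (suc m))) (*-identityˡ _)))) (sym (horner-last (suc m) (λ i → natF (suc m C i)) x)))
                  (-‿cong (+-congʳ (frobenius-fixes x))) ⟩
      horner (suc (suc m)) (λ i → natF (suc m C i)) x - (x + 1#)
        ≈⟨ +-congʳ (trans (horner-binomial (suc m) x) (frobenius-fixes _)) ⟩
      (1# + x) - (x + 1#)
        ≈⟨ solve 2 (λ x o → (o :+ x) :- (x :+ o) := :0) refl x 1# ⟩
      0# ∎
      where
      h = horner (suc m) (λ i → natF (suc m C i)) x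

  power-sum : ℕ → Carrier
  power-sum n = ΣF (_^ n)

  -- Translation by `1#` permutes the field, so the sums of `x + 1#` and of `x` agree.
  ΣF-1 : ΣF (λ _ → 1#) ≈ 0#
  ΣF-1 = begin
    ΣF (λ _ → 1#)                            ≈⟨ solve 2 (λ s x → s := (x :+ s) :- x) refl _ (ΣF (λ x → x)) ⟩
    (ΣF (λ x → x) + ΣF (λ _ → 1#)) - ΣF (λ x → x)   ≈⟨ +-congʳ (ΣF-+ (λ x → x) (λ _ → 1#)) ⟨
    ΣF (λ x → x + 1#) - ΣF (λ x → x)         ≈⟨ +-congʳ (ΣF-reindex (λ x → x) (λ e → e) (_+ 1#) (_- 1#) +-congʳ +-congʳ
      (solve 1 (λ x → (x :- :1) :+ :1 := x) refl) (solve 1 (λ x → (x :+ :1) :- :1 := x) refl)) ⟨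
    ΣF (λ x → x) - ΣF (λ x → x)              ≈⟨ -‿inverseʳ _ ⟩
    0#                                       ∎

  ^-divisible : ∀ n x → m ∣ n → ¬ (x ≈ 0#) → x ^ n ≈ 1#
  ^-divisible .(k ℕ.* m) x (divides k ≡.refl) x≉0 = begin
    x ^ (k ℕ.* m)   ≈⟨ ^-congʳ x (ℕₚ.*-comm k m) ⟩
    x ^ (m ℕ.* k)   ≈⟨ ^-assocʳ x m k ⟨
    (x ^ m) ^ k     ≈⟨ ^-congˡ k (fermat x x≉0) ⟩
    1# ^ k          ≈⟨ 1^n≈1 k ⟩
    1#              ∎

  opaque
    unfolding ΣF

    power-sum-divisible : ∀ n → m ∣ suc n → power-sum (suc n) ≈ - 1#
    power-sum-divisible n m∣n = begin
      power-sum (suc n)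
        ≈⟨ sumFin-remove {i = i₀} (λ i → to i ^ suc n) ⟩
      to i₀ ^ suc n + sumFin (removeAt (λ i → to i ^ suc n) i₀)
        ≈⟨ +-cong (trans (*-congʳ (to-from 0#)) (zeroˡ _)) (sum-cong-≋ (λ j → ^-divisible (suc n) _ m∣n
             (λ e → Finₚ.punchInᵢ≢i i₀ j (≡.trans (≡.sym (from-to _)) (from-cong e))))) ⟩
      0# + sumFin {m} (λ _ → 1#)
        ≈⟨ solve 1 (λ s → :0 :+ s := (:1 :+ s) :- :1) refl _ ⟩
      (1# + sumFin {m} (λ _ → 1#)) - 1#
        ≈⟨ +-congʳ ΣF-1 ⟩
      0# - 1#
        ≈⟨ +-identityˡ _ ⟩
      - 1# ∎
      where
      i₀ : Fin (suc m)
      i₀ = from 0#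

  -- If the sum were nonzero, the substitution `x ↦ μ * x` would give `μ ^ n ≈ 1#`, hence
  -- `μ ^ r ≈ 1#` with `r = n % m`, for all nonzero `μ`. Then `x ^ suc r - x` would vanish
  -- everywhere, although its degree is at most `m` and `r` is positive.
  power-sum-indivisible : ∀ n → ¬ (m ∣ n) → power-sum n ≈ 0#
  power-sum-indivisible n m∤n with power-sum n ≈? 0#
  ... | yes e = e
  ... | no P≉0 = ⊥-elim (1≉0 (begin
    1#                            ≈⟨ solve 1 (λ o → o := o :- :0) refl 1# ⟩
    1# - 0#                       ≈⟨ +-cong (δ-refl (suc r)) (-‿cong (δ-≢ 1 (suc r) (λ e → r≢0 (≡.sym (ℕₚ.suc-injective e))))) ⟨
    δ (suc r) (suc r) - δ 1 (suc r)  ≈⟨ vanishing-polynomial (λ i → δ (suc r) i - δ 1 i) root (suc r) (s≤s r<m) ⟩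
    0#                            ∎))
    where
    instance
      m-nonZero : ℕ.NonZero m
      m-nonZero = ℕ.>-nonZero m>0
    r = n ℕ.% m
    r<m : r ℕ.< m
    r<m = m%n<n n m
    r≢0 : ¬ (r ≡ 0)
    r≢0 e = m∤n (m%n≡0⇒n∣m n m e)
    μ^n≈1 : ∀ μ → ¬ (μ ≈ 0#) → μ ^ n ≈ 1#
    μ^n≈1 μ μ≉0 with inverse μ μ≉0
    ... | μ⁻¹ , μμ⁻¹≈1 = x-y≈0⇒x≈y (cancel (power-sum n) _ P≉0 (begin
      power-sum n * (μ ^ n - 1#)     ≈⟨ solve 2 (λ p x → p :* (x :- :1) := x :* p :- p) refl _ _ ⟩
      μ ^ n * power-sum n - power-sum n   ≈⟨ +-congʳ (ΣF-*ˡ (μ ^ n) (_^ n)) ⟨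
      ΣF (λ x → μ ^ n * x ^ n) - power-sum n  ≈⟨ +-congʳ (ΣF-cong (λ x → ^-distrib-* μ x n)) ⟨
      ΣF (λ x → (μ * x) ^ n) - power-sum n    ≈⟨ +-congʳ (ΣF-reindex (_^ n) (^-congˡ n) (μ *_) (μ⁻¹ *_) *-congˡ *-congˡ
         (λ x → trans (sym (*-assoc _ _ _)) (trans (*-congʳ μμ⁻¹≈1) (*-identityˡ x)))
         (λ x → trans (sym (*-assoc _ _ _)) (trans (*-congʳ (trans (*-comm _ _) μμ⁻¹≈1)) (*-identityˡ x)))) ⟨
      power-sum n - power-sum n      ≈⟨ -‿inverseʳ _ ⟩
      0#                             ∎))
    μ^r≈1 : ∀ μ → ¬ (μ ≈ 0#) → μ ^ r ≈ 1#
    μ^r≈1 μ μ≉0 = begin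
      μ ^ r                             ≈⟨ *-identityʳ _ ⟨
      μ ^ r * 1#                        ≈⟨ *-congˡ (^-divisible _ μ (divides (n ℕ./ m) ≡.refl) μ≉0) ⟨
      μ ^ r * μ ^ (n ℕ./ m ℕ.* m)       ≈⟨ ^-homo-* μ r _ ⟨
      μ ^ (r ℕ.+ n ℕ./ m ℕ.* m)         ≈⟨ ^-congʳ μ (m≡m%n+[m/n]*n n m) ⟨
      μ ^ n                             ≈⟨ μ^n≈1 μ μ≉0 ⟩
      1#                                ∎
    fixed : ∀ x → x ^ suc r ≈ x
    fixed x with x ≈? 0#
    ... | yes e = trans (*-congʳ e) (trans (zeroˡ _) (sym e))
    ... | no ne = trans (*-congˡ (μ^r≈1 x ne)) (*-identityʳ x)
    root : ∀ x → horner (suc m) (λ i → δ (suc r) i - δ 1 i) x ≈ 0#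
    root x = begin
      horner (suc m) (λ i → δ (suc r) i - δ 1 i) x
        ≈⟨ trans (horner-+ (suc m) (δ (suc r)) (λ i → - δ 1 i) x) (+-cong (horner-δ (suc m) (suc r) x (s≤s r<m))
             (trans (horner-neg (suc m) (δ 1) x) (-‿cong (horner-δ (suc m) 1 x (s≤s m>0))))) ⟩
      x ^ suc r - x * 1#    ≈⟨ +-cong (fixed x) (-‿cong (*-identityʳ x)) ⟩
      x - x                 ≈⟨ -‿inverseʳ x ⟩
      0#                    ∎

  ε : ℕ → Carrier
  ε n with m ∣? n
  ... | yes _ = 1#
  ... | no _  = 0#

  ε-yes : ∀ {n} → m ∣ n → ε n ≈ 1#
  ε-yes {n} d with m ∣? n
  ... | yes _ = refl
  ... | no nd = ⊥-elim (nd d)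

  ε-no : ∀ {n} → ¬ (m ∣ n) → ε n ≈ 0#
  ε-no {n} nd with m ∣? n
  ... | yes d = ⊥-elim (nd d)
  ... | no _ = refl

  power-sum-suc : ∀ n → power-sum (suc n) ≈ - ε (suc n)
  power-sum-suc n with m ∣? suc n
  ... | yes d = power-sum-divisible n d
  ... | no nd = trans (power-sum-indivisible (suc n) nd) (sym -0#≈0#)

-- Formal power series

module PowerSeries {c ℓ : Level} (R : CommutativeRing c ℓ) where
  open CommutativeRing R
  open Algebra.Properties.Ring ring
  open Relation.Binary.Reasoning.Setoid setoid
  open IntegerSolver R
  open Sums R

  Series : Set c
  Series = ℕ → Carrier

  const : Carrier → Series
  const k zero = k
  const k (suc n) = 0#

  infixl 7 _⊛_
  opaque
    _⊛_ : Series → Series → Series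
    (f ⊛ g) n = Σ< (suc n) (λ i → f i * g (n ∸ i))

    ⊛-cong : ∀ {f f′ g g′ : Series} → (∀ n → f n ≈ f′ n) → (∀ n → g n ≈ g′ n) → ∀ n → (f ⊛ g) n ≈ (f′ ⊛ g′) n
    ⊛-cong e e′ n = Σ-cong (suc n) (λ i → *-cong (e i) (e′ (n ∸ i)))

    ⊛-comm : ∀ (f g : Series) n → (f ⊛ g) n ≈ (g ⊛ f) n
    ⊛-comm f g n = trans (Σ-reverse n (λ i → f i * g (n ∸ i))) (Σ-cong< (suc n) (λ i i≤n →
      trans (*-congˡ (reflexive (≡.cong g (ℕₚ.m∸[m∸n]≡n (ℕₚ.≤-pred i≤n))))) (*-comm _ _)))

    ⊛-assoc : ∀ (f g h : Series) n → ((f ⊛ g) ⊛ h) n ≈ (f ⊛ (g ⊛ h)) n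
    ⊛-assoc f g h n = begin
      Σ< (suc n) (λ s → Σ< (suc s) (λ j → f j * g (s ∸ j)) * h (n ∸ s))
        ≈⟨ Σ-cong (suc n) (λ s → trans (sym (Σ-*ʳ (suc s) (h (n ∸ s)) (λ j → f j * g (s ∸ j))))
             (Σ-cong< (suc s) (λ j j≤s → trans (*-assoc _ _ _) (*-congˡ (*-congˡ (reflexive (≡.cong h (index s j (ℕₚ.≤-pred j≤s))))))))) ⟩
      Σ< (suc n) (λ s → Σ< (suc s) (λ j → f j * (g (s ∸ j) * h (n ∸ j ∸ (s ∸ j)))))
        ≈⟨ Σ-triangle n (λ j k → f j * (g k * h (n ∸ j ∸ k))) ⟨
      Σ< (suc n) (λ j → Σ< (suc (n ∸ j)) (λ k → f j * (g k * h (n ∸ j ∸ k))))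
        ≈⟨ Σ-cong (suc n) (λ j → Σ-*ˡ (suc (n ∸ j)) (f j) (λ k → g k * h (n ∸ j ∸ k))) ⟩
      Σ< (suc n) (λ j → f j * Σ< (suc (n ∸ j)) (λ k → g k * h (n ∸ j ∸ k))) ∎
      where
      index : ∀ s j → j ℕ.≤ s → n ∸ s ≡ n ∸ j ∸ (s ∸ j)
      index s j j≤s = ≡.trans (≡.cong (n ∸_) (≡.sym (ℕₚ.m+[n∸m]≡n j≤s))) (≡.sym (ℕₚ.∸-+-assoc n j (s ∸ j)))

    const-⊛ : ∀ k (f : Series) n → (const k ⊛ f) n ≈ k * f n
    const-⊛ k f n = trans (Σ-suc n _) (trans (+-congˡ (Σ-zero n (λ _ _ → zeroˡ _))) (+-identityʳ _))

    ⊛-distribˡ : ∀ (f g h : Series) n → (f ⊛ (λ i → g i + h i)) n ≈ (f ⊛ g) n + (f ⊛ h) n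
    ⊛-distribˡ f g h n = trans (Σ-cong (suc n) (λ i → distribˡ (f i) (g (n ∸ i)) (h (n ∸ i)))) (Σ-+ (suc n) (λ i → f i * g (n ∸ i)) (λ i → f i * h (n ∸ i)))

    ⊛-distribʳ : ∀ (f g h : Series) n → ((λ i → g i + h i) ⊛ f) n ≈ (g ⊛ f) n + (h ⊛ f) n
    ⊛-distribʳ f g h n = trans (Σ-cong (suc n) (λ i → distribʳ (f (n ∸ i)) (g i) (h i))) (Σ-+ (suc n) (λ i → g i * f (n ∸ i)) (λ i → h i * f (n ∸ i)))

  ⊛-identityˡ : ∀ (f : Series) n → (const 1# ⊛ f) n ≈ f n
  ⊛-identityˡ f n = trans (const-⊛ 1# f n) (*-identityˡ _)

  series : CommutativeRing c ℓ
  series = record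
    { Carrier = Series
    ; _≈_ = λ f g → ∀ n → f n ≈ g n
    ; _+_ = λ f g n → f n + g n
    ; _*_ = _⊛_
    ; -_ = λ f n → - f n
    ; 0# = λ _ → 0#
    ; 1# = const 1#
    ; isCommutativeRing = record
      { isRing = record
        { +-isAbelianGroup = record
          { isGroup = record
            { isMonoid = record
              { isSemigroup = record
                { isMagma = record
                  { isEquivalence = record { refl = λ _ → refl ; sym = λ e n → sym (e n) ; trans = λ e e′ n → trans (e n) (e′ n) }
                  ; ∙-cong = λ e e′ n → +-cong (e n) (e′ n) }
                ; assoc = λ f g h n → +-assoc _ _ _ }
              ; identity = (λ f n → +-identityˡ _) , (λ f n → +-identityʳ _) }
            ; inverse = (λ f n → -‿inverseˡ _) , (λ f n → -‿inverseʳ _)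
            ; ⁻¹-cong = λ e n → -‿cong (e n) }
          ; comm = λ f g n → +-comm _ _ }
        ; *-cong = λ {f} {f′} {g} {g′} → ⊛-cong {f} {f′} {g} {g′}
        ; *-assoc = ⊛-assoc
        ; *-identity = ⊛-identityˡ , (λ f n → trans (⊛-comm f (const 1#) n) (⊛-identityˡ f n))
        ; distrib = ⊛-distribˡ , ⊛-distribʳ }
      ; *-comm = ⊛-comm } }

  const-0 : ∀ n → const 0# n ≈ 0#
  const-0 zero = refl
  const-0 (suc n) = refl

  const-isRingHomomorphism : IsRingHomomorphism rawRing (CommutativeRing.rawRing series) const
  const-isRingHomomorphism = record
    { isSemiringHomomorphism = record
      { isNearSemiringHomomorphism = record
        { +-isMonoidHomomorphism = record
          { isMagmaHomomorphism = record
            { isRelHomomorphism = record { cong = λ { e zero → e ; e (suc n) → refl } }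
            ; homo = λ { x y zero → refl ; x y (suc n) → sym (+-identityˡ 0#) } }
          ; ε-homo = const-0 }
        ; *-homo = λ { x y zero → sym (const-⊛ x (const y) 0) ; x y (suc n) → sym (trans (const-⊛ x (const y) (suc n)) (zeroʳ x)) } }
      ; 1#-homo = λ _ → refl }
    ; -‿homo = λ { x zero → refl ; x (suc n) → sym -0#≈0# } }

  X : Series
  X = δ 1

  opaque
    unfolding _⊛_

    X-⊛-zero : ∀ f → (X ⊛ f) 0 ≈ 0#
    X-⊛-zero f = Σ-zero 1 (λ { zero _ → zeroˡ _ ; (suc _) (s≤s ()) })

    X-⊛-suc : ∀ f n → (X ⊛ f) (suc n) ≈ f n
    X-⊛-suc f n = begin
      (X ⊛ f) (suc n)                                             ≈⟨ Σ-suc (suc n) _ ⟩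
      0# * f (suc n) + Σ< (suc n) (λ i → δ 0 i * f (n ∸ i))       ≈⟨ +-cong (zeroˡ _) (Σ-δ (suc n) 0 _ (s≤s z≤n)) ⟩
      0# + f n                                                    ≈⟨ +-identityˡ _ ⟩
      f n                                                         ∎

  open Algebra.Properties.Semiring.Exp (CommutativeRing.semiring series) public using () renaming (_^_ to _^ₛ_)

  X^k : ∀ k n → (X ^ₛ k) n ≈ δ k n
  X^k zero zero = refl
  X^k zero (suc n) = refl
  X^k (suc k) zero = X-⊛-zero (X ^ₛ k)
  X^k (suc k) (suc n) = trans (X-⊛-suc (X ^ₛ k) n) (X^k k n)

  X-regular : ∀ f → (∀ n → (X ⊛ f) n ≈ 0#) → ∀ n → f n ≈ 0#
  X-regular f e n = trans (sym (X-⊛-suc f n)) (e (suc n))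

  opaque
    unfolding _⊛_

    -- In the coefficient of index `n` of the product, every term other than `u 0 * f n` contains an
    -- earlier coefficient of `f`.
    unital-regular : ∀ u f → u 0 ≈ 1# → (∀ n → (u ⊛ f) n ≈ 0#) → ∀ n → f n ≈ 0#
    unital-regular u f u₀ e = <-rec (λ n → f n ≈ 0#) (λ n below → begin
      f n                                                    ≈⟨ trans (*-congʳ u₀) (*-identityˡ _) ⟨
      u 0 * f n                                              ≈⟨ +-identityʳ _ ⟨
      u 0 * f n + 0#                                         ≈⟨ +-congˡ (Σ-zero n (λ i i<n →
         trans (*-congˡ (below (ℕₚ.∸-monoʳ-< (s≤s z≤n) i<n))) (zeroʳ _))) ⟨
      u 0 * f n + Σ< n (λ i → u (suc i) * f (n ∸ suc i))     ≈⟨ Σ-suc n _ ⟨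
      (u ⊛ f) n                                              ≈⟨ e n ⟩
      0#                                                     ∎)

  Σ-coefficient : ∀ n (f : ℕ → Series) k → Sums.Σ< series n f k ≈ Σ< n (λ i → f i k)
  Σ-coefficient zero f k = trans (Sums.Σ-nil series f k) (sym (Σ-nil _))
  Σ-coefficient (suc n) f k = trans (Sums.Σ-suc series n f k) (trans (+-congˡ (Σ-coefficient n (f ∘ suc) k)) (sym (Σ-suc n _)))

-- The indicator of the multiples of `q - 1`

module Indicator {c ℓ : Level} (F : CommutativeRing c ℓ) (isField : IsField F)
                 (m : ℕ) (card : HasCardinality F (suc m)) where
  open FiniteField F isField m card public
  open CommutativeRing F
  open IsField isField
  open Algebra.Properties.Ring ring
  open Algebra.Properties.Semiring.Exp semiring using (_^_)
  open Sums F

  ε-+ : ∀ {a} b → m ∣ a → ε (a ℕ.+ b) ≈ ε b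
  ε-+ {a} b d with m ∣? b
  ... | yes e = ε-yes (∣m∣n⇒∣m+n d e)
  ... | no ne = ε-no (λ e → ne (∣m+n∣m⇒∣n e d))

  ε-complement : ∀ {a b} → m ∣ (a ℕ.+ b) → ε a ≈ ε b
  ε-complement {a} {b} d with m ∣? a
  ... | yes e = sym (ε-yes (∣m+n∣m⇒∣n d e))
  ... | no ne = sym (ε-no (λ e → ne (∣m+n∣m⇒∣n (≡.subst (m ∣_) (ℕₚ.+-comm a b) d) e)))

  ε-0 : ε 0 ≈ 1#
  ε-0 = ε-yes (m ∣0)

  ε-small : ∀ {t} → 0 ℕ.< t → t ℕ.< m → ε t ≈ 0#
  ε-small 0<t t<m = ε-no (λ d → ℕₚ.<⇒≱ t<m (∣⇒≤ {{ℕ.>-nonZero 0<t}} d))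

  -- Multiples of `m` behave like even exponents: `m` is even in odd characteristic, and `- 1#` is
  -- `1#` in characteristic two. Fermat covers both at once.
  -1^even : ∀ {n} → m ∣ n → (- 1#) ^ n ≈ 1#
  -1^even {n} d = ^-divisible n (- 1#) d (λ e → 1≉0 (trans (sym (-‿involutive 1#)) (trans (-‿cong e) -0#≈0#)))

  -- At `n = 0` the convention that `0 ^ 0` is `1` makes the sum `q` times `1#`, which is zero; the
  -- term `δ 0 n` accounts for this.
  power-sum-value : ∀ n → power-sum n ≈ δ 0 n - ε n
  power-sum-value zero = trans ΣF-1 (sym (trans (+-congˡ (-‿cong ε-0)) (-‿inverseʳ 1#)))
  power-sum-value (suc n) = trans (power-sum-suc n) (sym (+-identityˡ _))

-- The addition formula for `W`, coefficientwise, in an algebra over the field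

module Identities {c ℓ : Level} (F : CommutativeRing c ℓ) (isField : IsField F)
                  (m : ℕ) (card : HasCardinality F (suc m))
                  {c′ ℓ′ : Level} (A : CommutativeRing c′ ℓ′) (ι : CommutativeRing.Carrier F → CommutativeRing.Carrier A)
                  (hom : IsRingHomomorphism (CommutativeRing.rawRing F) (CommutativeRing.rawRing A) ι) where
  open Indicator F isField m card
  private
    module F where
      open CommutativeRing F public
      open Sums F public using (δ; δ-refl; δ-≢)
      open Algebra.Properties.Semiring.Exp semiring public using (_^_)
  open CommutativeRing A
  open Algebra.Properties.Ring ring
  open Algebra.Properties.Semiring.Exp semiring using (_^_; ^-congˡ; ^-congʳ; ^-homo-*)
  open Algebra.Properties.CommutativeSemiring.Exp commutativeSemiring using (^-distrib-*)
  open IsRingHomomorphism hom using (1#-homo; 0#-homo; *-homo; +-homo; -‿homo) renaming (⟦⟧-cong to ι-cong)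
  open Relation.Binary.Reasoning.Setoid setoid
  open IntegerSolver A
  open Sums A using (Σ<; Σ-nil; Σ-suc; Σ-cong<; Σ-cong; Σ-zero; Σ-+; Σ-*ˡ; Σ-neg; Σ-last; Σ-split; Σ-reverse)
  open Construction F (suc m) using (natF)
  open SumOverField A

  1^ : ∀ n → 1# ^ n ≈ 1#
  1^ zero = refl
  1^ (suc n) = trans (*-identityˡ _) (1^ n)

  ι-pow : ∀ x n → ι (x F.^ n) ≈ ι x ^ n
  ι-pow x zero = 1#-homo
  ι-pow x (suc n) = trans (*-homo _ _) (*-congˡ (ι-pow x n))

  neg-pow : ∀ x n → (- x) ^ n ≈ ι ((F.- F.1#) F.^ n) * x ^ n
  neg-pow x n = begin
    (- x) ^ n                          ≈⟨ ^-congˡ n (-1*x≈-x x) ⟨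
    (- 1# * x) ^ n                     ≈⟨ ^-distrib-* (- 1#) x n ⟩
    (- 1#) ^ n * x ^ n                 ≈⟨ *-congʳ (^-congˡ n (trans (-‿homo F.1#) (-‿cong 1#-homo))) ⟨
    ι (F.- F.1#) ^ n * x ^ n           ≈⟨ *-congʳ (ι-pow (F.- F.1#) n) ⟨
    ι ((F.- F.1#) F.^ n) * x ^ n       ∎

  neg-pow-even : ∀ x {n} → m ∣ n → (- x) ^ n ≈ x ^ n
  neg-pow-even x {n} d = trans (neg-pow x n) (trans (*-congʳ (trans (ι-cong (-1^even d)) 1#-homo)) (*-identityˡ _))

  neg-pow-odd : ∀ x {n} → m ∣ suc n → (- x) ^ n ≈ - (x ^ n)
  neg-pow-odd x {n} d = begin
    (- x) ^ n                          ≈⟨ neg-pow x n ⟩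
    ι s * x ^ n                        ≈⟨ solve 2 (λ s p → s :* p := :- ((:- s) :* p)) refl (ι s) (x ^ n) ⟩
    - (- ι s * x ^ n)                  ≈⟨ -‿cong (*-congʳ (-‿homo s)) ⟨
    - (ι (F.- s) * x ^ n)              ≈⟨ -‿cong (*-congʳ (trans (ι-cong -s≈1) 1#-homo)) ⟩
    - (1# * x ^ n)                     ≈⟨ -‿cong (*-identityˡ _) ⟩
    - (x ^ n)                          ∎
    where
    s = (F.- F.1#) F.^ n
    -s≈1 : F.- s F.≈ F.1#
    -s≈1 = F.trans (F.sym (Algebra.Properties.Ring.-1*x≈-x F.ring s)) (-1^even d)

  binomial : ∀ n x y → (x + y) ^ n ≈ Σ< (suc n) (λ k → ι (natF (n C k)) * (x ^ k * y ^ (n ∸ k)))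
  binomial zero x y = sym (begin
    Σ< 1 (λ k → ι (natF (0 C k)) * (x ^ k * y ^ (0 ∸ k)))   ≈⟨ Σ-last 0 _ ⟩
    Σ< 0 _ + ι (natF 1) * (1# * 1#)                         ≈⟨ +-cong (Σ-nil _) (*-cong (trans (ι-cong (natF-nC0 0)) 1#-homo) (*-identityˡ _)) ⟩
    0# + 1# * 1#                                            ≈⟨ trans (+-identityˡ _) (*-identityˡ _) ⟩
    1#                                                      ∎)
  binomial (suc n) x y = sym (begin
    Σ< (suc (suc n)) (λ k → ι (natF (suc n C k)) * (x ^ k * y ^ (suc n ∸ k)))
      ≈⟨ Σ-suc (suc n) _ ⟩
    b₀ + Σ< (suc n) (λ k → ι (natF (suc n C suc k)) * (x ^ suc k * y ^ (n ∸ k)))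
      ≈⟨ +-cong (*-congʳ (ι-cong (F.trans (natF-nC0 (suc n)) (F.sym (natF-nC0 n))))) (trans (Σ-cong (suc n) (λ k → trans (*-congʳ (trans (ι-cong (natF-pascal n k)) (+-homo _ _)))
           (solve 5 (λ a b x p r → (a :+ b) :* ((x :* p) :* r) := x :* (a :* (p :* r)) :+ b :* ((x :* p) :* r)) refl _ _ _ _ _)))
           (Σ-+ (suc n) _ _)) ⟩
    c₀ + (Σ< (suc n) (λ k → x * (ι (natF (n C k)) * (x ^ k * y ^ (n ∸ k)))) + Σ< (suc n) (λ k → ι (natF (n C suc k)) * (x ^ suc k * y ^ (n ∸ k))))
      ≈⟨ +-congˡ (+-cong (trans (Σ-*ˡ (suc n) x _) (*-congˡ (sym (binomial n x y)))) (trans (Σ-last n _)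
           (trans (+-cong (trans (Σ-cong< n shift) (Σ-*ˡ n y _)) (trans (*-congʳ (trans (ι-cong (natF-C-zero (ℕₚ.n<1+n n))) 0#-homo)) (zeroˡ _))) (+-identityʳ _)))) ⟩
    c₀ + (x * (x + y) ^ n + y * Σ< n (λ k → ι (natF (n C suc k)) * (x ^ suc k * y ^ (n ∸ suc k))))
      ≈⟨ solve 6 (λ b o y yn p s → b :* (o :* (y :* yn)) :+ (p :+ y :* s) := p :+ y :* (b :* (o :* yn) :+ s)) refl (ι (natF (n C 0))) 1# y (y ^ n) (x * (x + y) ^ n) _ ⟩
    x * (x + y) ^ n + y * (ι (natF (n C 0)) * (1# * y ^ n) + Σ< n (λ k → ι (natF (n C suc k)) * (x ^ suc k * y ^ (n ∸ suc k))))
      ≈⟨ +-congˡ (*-congˡ (trans (sym (Σ-suc n _)) (sym (binomial n x y)))) ⟩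
    x * (x + y) ^ n + y * (x + y) ^ n
      ≈⟨ distribʳ _ _ _ ⟨
    (x + y) * (x + y) ^ n ∎)
    where
    b₀ = ι (natF (suc n C 0)) * (1# * y ^ suc n)
    c₀ = ι (natF (n C 0)) * (1# * y ^ suc n)
    shift : ∀ k → k ℕ.< n → ι (natF (n C suc k)) * (x ^ suc k * y ^ (n ∸ k)) ≈ y * (ι (natF (n C suc k)) * (x ^ suc k * y ^ (n ∸ suc k)))
    shift k k<n = trans (*-congˡ (*-congˡ (^-congʳ y (ℕₚ.+-∸-assoc 1 k<n))))
      (solve 4 (λ a p y r → a :* (p :* (y :* r)) := y :* (a :* (p :* r))) refl _ _ _ _)

  -- The polynomials occurring as coefficients of x_{i′} x_i, where i = i₁ + 1 and i′ = i₂ + 1.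
  module Quadratic (i₁ i₂ : ℕ) (m∣i : m ∣ suc i₁) (m∣i′ : m ∣ suc i₂) where
    n₂ : ℕ
    n₂ = i₁ ℕ.+ i₂

    m∣N : m ∣ (suc i₁ ℕ.+ suc i₂)
    m∣N = ∣m∣n⇒∣m+n m∣i m∣i′

    -- The sum runs over the line through `v` in direction `w`, so it is unchanged when `w` is added
    -- to `v`. This invariance is the source of the additive law.
    R : Carrier → Carrier → Carrier
    R w v = ΣF (λ x → (v + ι x * w) ^ i₁)

    -- In the shuffle of two letters whose weights are multiples of `m`, the coefficient of a word
    -- of depth two is the sum of two such halves: `δ` comes from a concatenation, the binomial from
    -- `Δcoef`, where both signs are then `-1`.
    half : ℕ → F.Carrier
    half j = F.δ i₁ j F.- natF (i₁ C j)

    S : Carrier → Carrier → Carrier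
    S w v = Σ< (suc n₂) (λ j → ι (ε (suc j) F.* half j) * (w ^ j * v ^ (n₂ ∸ j)))

    sumFin-ι : ∀ {n} (f : Fin n → F.Carrier) → sumFin (λ i → ι (f i)) ≈ ι (SumOverField.sumFin F f)
    sumFin-ι {zero} f = sym 0#-homo
    sumFin-ι {suc n} f = trans (+-congˡ (sumFin-ι (f ∘ Fin.suc))) (sym (+-homo _ _))

    opaque
      unfolding SumOverField.ΣF

      ΣF-ι : ∀ f → ΣF (λ x → ι (f x)) ≈ ι (SumOverField.ΣF F f)
      ΣF-ι f = sumFin-ι {suc m} (λ i → f (Inverse.to card i))

    ΣF-Σ< : ∀ n (f : F.Carrier → ℕ → Carrier) → ΣF (λ x → Σ< n (f x)) ≈ Σ< n (λ k → ΣF (λ x → f x k))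
    ΣF-Σ< zero f = trans (ΣF-cong (λ x → trans (Σ-nil _) (sym (zeroˡ 1#)))) (trans (ΣF-*ˡ 0# (λ _ → 1#)) (trans (zeroˡ _) (sym (Σ-nil _))))
    ΣF-Σ< (suc n) f = trans (ΣF-cong (λ x → Σ-suc n (f x))) (trans (ΣF-+ (λ x → f x 0) (λ x → Σ< n (f x ∘ suc)))
      (trans (+-congˡ (ΣF-Σ< n (λ x → f x ∘ suc))) (sym (Σ-suc n _))))

    R-expand : ∀ v w → R v w ≈ Σ< (suc i₁) (λ k → ι (natF (i₁ C k) F.* (F.δ 0 (i₁ ∸ k) F.- ε (i₁ ∸ k))) * (w ^ k * v ^ (i₁ ∸ k)))
    R-expand v w = trans (ΣF-cong (λ x → binomial i₁ w (ι x * v))) (trans (ΣF-Σ< (suc i₁) _) (Σ-cong (suc i₁) (λ k → begin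
      ΣF (λ x → ι (natF (i₁ C k)) * (w ^ k * (ι x * v) ^ (i₁ ∸ k)))
        ≈⟨ ΣF-cong (λ x → trans (*-congˡ (*-congˡ (trans (^-distrib-* (ι x) v (i₁ ∸ k)) (*-congʳ (sym (ι-pow x (i₁ ∸ k)))))))
             (solve 4 (λ a p s r → a :* (p :* (s :* r)) := (a :* (p :* r)) :* s) refl _ _ _ _)) ⟩
      ΣF (λ x → (ι (natF (i₁ C k)) * (w ^ k * v ^ (i₁ ∸ k))) * ι (x F.^ (i₁ ∸ k)))
        ≈⟨ trans (ΣF-*ˡ _ _) (*-congˡ (trans (ΣF-ι _) (ι-cong (power-sum-value (i₁ ∸ k))))) ⟩
      (ι (natF (i₁ C k)) * (w ^ k * v ^ (i₁ ∸ k))) * ι (F.δ 0 (i₁ ∸ k) F.- ε (i₁ ∸ k))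
        ≈⟨ solve 3 (λ a p s → (a :* p) :* s := (a :* s) :* p) refl _ _ _ ⟩
      (ι (natF (i₁ C k)) * ι (F.δ 0 (i₁ ∸ k) F.- ε (i₁ ∸ k))) * (w ^ k * v ^ (i₁ ∸ k))
        ≈⟨ *-congʳ (*-homo _ _) ⟨
      ι (natF (i₁ C k) F.* (F.δ 0 (i₁ ∸ k) F.- ε (i₁ ∸ k))) * (w ^ k * v ^ (i₁ ∸ k)) ∎)))

    -- As `m` divides `suc k + (i₁ ∸ k)`, the indicators of the two summands agree. At `k = i₁` both
    -- sides vanish; elsewhere both deltas vanish, and the negated binomial times the indicator is
    -- left on each side.
    coefficient-match : ∀ k → k ℕ.≤ i₁ → ε (suc k) F.* half k F.≈ natF (i₁ C k) F.* (F.δ 0 (i₁ ∸ k) F.- ε (i₁ ∸ k))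
    coefficient-match k k≤i₁ = F.trans
      (F.*-congʳ (ε-complement {suc k} {i₁ ∸ k} (≡.subst (m ∣_) (≡.cong suc (≡.sym (ℕₚ.m+[n∸m]≡n k≤i₁))) m∣i)))
      (cases (k ℕ.≟ i₁))
      where
      cases : Dec (k ≡ i₁) → ε (i₁ ∸ k) F.* half k F.≈ natF (i₁ C k) F.* (F.δ 0 (i₁ ∸ k) F.- ε (i₁ ∸ k))
      cases (yes ≡.refl) = F.trans
        (F.*-congˡ (F.trans (F.+-cong (F.δ-refl k) (F.-‿cong (natF-nCn k))) (F.-‿inverseʳ F.1#)))
        (F.trans (F.zeroʳ _) (F.sym (F.trans (F.*-congˡ (F.trans (F.reflexive (≡.cong (λ t → F.δ 0 t F.- ε t) (ℕₚ.n∸n≡0 k)))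
          (F.trans (F.+-congˡ (F.-‿cong ε-0)) (F.-‿inverseʳ F.1#)))) (F.zeroʳ _))))
      cases (no k≢i₁) = F.trans
        (F.*-congˡ (F.trans (F.+-congʳ (F.δ-≢ i₁ k (k≢i₁ ∘ ≡.sym))) (F.+-identityˡ _)))
        (F.trans (FS.solve 2 (λ e b → e FS.:* (FS.:- b) FS.:= b FS.:* (FS.:- e)) F.refl _ _)
          (F.*-congˡ (F.sym (F.trans (F.+-congʳ (F.δ-≢ 0 (i₁ ∸ k) (λ e → k≢i₁ (ℕₚ.≤-antisym k≤i₁ (ℕₚ.m∸n≡0⇒m≤n (≡.sym e)))))) (F.+-identityˡ _)))))
        where module FS = IntegerSolver F

    -- The condition `m ∣ suc j` in `S` is exactly what the power sums produce when `R v w` is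
    -- expanded by the binomial theorem. Indices above `i₁` contribute nothing.
    S-closed : ∀ w v → S w v ≈ v ^ i₂ * R v w
    S-closed w v = begin
      S w v
        ≈⟨ Σ-split (suc i₁) i₂ _ ⟩
      Σ< (suc i₁) (λ j → ι (ε (suc j) F.* half j) * (w ^ j * v ^ (n₂ ∸ j))) + Σ< i₂ _
        ≈⟨ +-cong (Σ-cong< (suc i₁) (λ k k≤i₁ → low k (ℕₚ.≤-pred k≤i₁))) (Σ-zero i₂ (λ t _ → high t)) ⟩
      Σ< (suc i₁) (λ k → v ^ i₂ * (ι (natF (i₁ C k) F.* (F.δ 0 (i₁ ∸ k) F.- ε (i₁ ∸ k))) * (w ^ k * v ^ (i₁ ∸ k)))) + 0#
        ≈⟨ +-identityʳ _ ⟩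
      Σ< (suc i₁) (λ k → v ^ i₂ * (ι (natF (i₁ C k) F.* (F.δ 0 (i₁ ∸ k) F.- ε (i₁ ∸ k))) * (w ^ k * v ^ (i₁ ∸ k))))
        ≈⟨ trans (Σ-*ˡ (suc i₁) _ _) (*-congˡ (sym (R-expand v w))) ⟩
      v ^ i₂ * R v w ∎
      where
      low : ∀ k → k ℕ.≤ i₁ → ι (ε (suc k) F.* half k) * (w ^ k * v ^ (n₂ ∸ k)) ≈
            v ^ i₂ * (ι (natF (i₁ C k) F.* (F.δ 0 (i₁ ∸ k) F.- ε (i₁ ∸ k))) * (w ^ k * v ^ (i₁ ∸ k)))
      low k k≤i₁ = trans (*-cong (ι-cong (coefficient-match k k≤i₁)) (*-congˡ (trans (^-congʳ v (≡.trans (≡.cong (_∸ k) (ℕₚ.+-comm i₁ i₂)) (ℕₚ.+-∸-assoc i₂ k≤i₁))) (^-homo-* v i₂ (i₁ ∸ k)))))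
        (solve 4 (λ a p s r → a :* (p :* (s :* r)) := s :* (a :* (p :* r))) refl _ _ _ _)
      high : ∀ t → ι (ε (suc (suc i₁ ℕ.+ t)) F.* half (suc i₁ ℕ.+ t)) * (w ^ (suc i₁ ℕ.+ t) * v ^ (n₂ ∸ (suc i₁ ℕ.+ t))) ≈ 0#
      high t = trans (*-congʳ (trans (ι-cong (F.trans (F.*-congˡ (F.trans (F.+-cong
          (F.δ-≢ i₁ (suc i₁ ℕ.+ t) (ℕₚ.<⇒≢ (ℕₚ.m≤m+n (suc i₁) t))) (F.-‿cong (natF-C-zero (ℕₚ.m≤m+n (suc i₁) t)))) (F.-‿inverseʳ F.0#))) (F.zeroʳ _))) 0#-homo)) (zeroˡ _)

    quadratic : ℕ → F.Carrier
    quadratic j = half j F.+ half (n₂ ∸ j)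

    Y : Carrier → Carrier → Carrier
    Y w v = Σ< (suc n₂) (λ j → ι (ε (suc j) F.* quadratic j) * (w ^ j * v ^ (n₂ ∸ j)))

    -- Reversing the summation turns the second half into `S v w`; the indicator survives the
    -- reversal because `m` divides `n₂ + 2`.
    Y-closed : ∀ w v → Y w v ≈ v ^ i₂ * R v w + w ^ i₂ * R w v
    Y-closed w v = begin
      Y w v
        ≈⟨ trans (Σ-cong (suc n₂) (λ j → trans (*-congʳ (trans (ι-cong (F.distribˡ _ _ _)) (+-homo _ _))) (distribʳ _ _ _))) (Σ-+ (suc n₂) _ _) ⟩
      S w v + Σ< (suc n₂) (λ j → ι (ε (suc j) F.* half (n₂ ∸ j)) * (w ^ j * v ^ (n₂ ∸ j)))
        ≈⟨ +-congˡ (Σ-cong< (suc n₂) (λ j j≤n₂ → *-cong (ι-cong (F.*-congʳ (ε-complement {suc j} {suc (n₂ ∸ j)}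
             (≡.subst (m ∣_) (index j (ℕₚ.≤-pred j≤n₂)) m∣N))))
             (trans (*-comm _ _) (*-congˡ (^-congʳ w (≡.sym (ℕₚ.m∸[m∸n]≡n (ℕₚ.≤-pred j≤n₂)))))))) ⟩
      S w v + Σ< (suc n₂) (λ j → ι (ε (suc (n₂ ∸ j)) F.* half (n₂ ∸ j)) * (v ^ (n₂ ∸ j) * w ^ (n₂ ∸ (n₂ ∸ j))))
        ≈⟨ +-congˡ (Σ-reverse n₂ _) ⟨
      S w v + S v w
        ≈⟨ +-cong (S-closed w v) (S-closed v w) ⟩
      v ^ i₂ * R v w + w ^ i₂ * R w v ∎
      where
      index : ∀ j → j ℕ.≤ n₂ → suc i₁ ℕ.+ suc i₂ ≡ suc j ℕ.+ suc (n₂ ∸ j)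
      index j j≤n₂ = ≡.cong suc (≡.trans (ℕₚ.+-suc i₁ i₂) (≡.sym (≡.trans (ℕₚ.+-suc j (n₂ ∸ j)) (≡.cong suc (ℕₚ.m+[n∸m]≡n j≤n₂)))))

    R-cong : ∀ w {v v′} → v ≈ v′ → R w v ≈ R w v′
    R-cong w e = ΣF-cong (λ x → ^-congˡ i₁ (+-congʳ e))

    R-translate : ∀ v u → R v (u + v) ≈ R v u
    R-translate v u = begin
      R v (u + v)                                      ≈⟨ ΣF-cong (λ x → ^-congˡ i₁ (begin
        (u + v) + ι x * v                                ≈⟨ solve 3 (λ u v x → (u :+ v) :+ x :* v := u :+ (x :+ :1) :* v) refl u v (ι x) ⟩
        u + (ι x + 1#) * v                               ≈⟨ +-congˡ (*-congʳ (trans (+-homo _ _) (+-congˡ 1#-homo))) ⟨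
        u + ι (x F.+ F.1#) * v                           ∎)) ⟩
      ΣF (λ x → (u + ι (x F.+ F.1#) * v) ^ i₁)         ≈⟨ ΣF-reindex (λ x → (u + ι x * v) ^ i₁) (λ e → ^-congˡ i₁ (+-congˡ (*-congʳ (ι-cong e))))
        (F._+ F.1#) (F._- F.1#) F.+-congʳ F.+-congʳ
        (FS.solve 1 (λ x → (x FS.:- FS.:1) FS.:+ FS.:1 FS.:= x) F.refl) (FS.solve 1 (λ x → (x FS.:+ FS.:1) FS.:- FS.:1 FS.:= x) F.refl) ⟨
      R v u                                            ∎
      where module FS = IntegerSolver F

    -- The substitution `x ↦ - 1 - x` sends `u + x * (u + v)` to `- (v + x * (u + v))`, and `i₁`,
    -- one less than a multiple of `m`, acts as an odd exponent.
    R-reflect : ∀ u v → R (u + v) u ≈ - R (u + v) v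
    R-reflect u v = begin
      R σ u
        ≈⟨ ΣF-reindex (λ x → (u + ι x * σ) ^ i₁) (λ e → ^-congˡ i₁ (+-congˡ (*-congʳ (ι-cong e)))) reflect reflect
             (λ e → F.+-congˡ (F.-‿cong e)) (λ e → F.+-congˡ (F.-‿cong e)) involutive involutive ⟩
      ΣF (λ x → (u + ι (reflect x) * σ) ^ i₁)
        ≈⟨ ΣF-cong (λ x → trans (^-congˡ i₁ (begin
            u + ι (reflect x) * (u + v)      ≈⟨ +-congˡ (*-congʳ (trans (+-homo _ _) (+-cong (trans (-‿homo _) (-‿cong 1#-homo)) (-‿homo x)))) ⟩
            u + (- 1# - ι x) * (u + v)       ≈⟨ solve 3 (λ u v x → u :+ ((:- :1) :- x) :* (u :+ v) := :- (v :+ x :* (u :+ v))) refl u v (ι x) ⟩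
            - (v + ι x * (u + v))            ∎)) (neg-pow-odd _ m∣i)) ⟩
      ΣF (λ x → - ((v + ι x * σ) ^ i₁))
        ≈⟨ trans (ΣF-cong (λ x → sym (-1*x≈-x _))) (trans (ΣF-*ˡ (- 1#) _) (-1*x≈-x _)) ⟩
      - R σ v ∎
      where
      module FS = IntegerSolver F
      σ = u + v
      reflect : F.Carrier → F.Carrier
      reflect x = F.- F.1# F.- x
      involutive : ∀ x → reflect (reflect x) F.≈ x
      involutive = FS.solve 1 (λ x → (FS.:- FS.:1) FS.:- ((FS.:- FS.:1) FS.:- x) FS.:= x) F.refl

    -- This is the coefficient of `x_{suc i₂} x_{suc i₁}` in
    -- `W(u + v) ⧢ (W(u) + W(v)) = W(u) ⧢ W(v)`. The terms with an outer power of `u + v` cancel by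
    -- reflection, the others are translated.
    Y-additive : ∀ u v → Y (u + v) v + Y (u + v) u ≈ Y u v
    Y-additive u v = begin
      Y σ v + Y σ u
        ≈⟨ +-cong (Y-closed σ v) (Y-closed σ u) ⟩
      (v ^ i₂ * R v σ + σ ^ i₂ * R σ v) + (u ^ i₂ * R u σ + σ ^ i₂ * R σ u)
        ≈⟨ +-cong (+-congʳ (*-congˡ (R-translate v u))) (+-cong (*-congˡ (trans (R-cong u (+-comm u v)) (R-translate u v))) (*-congˡ (R-reflect u v))) ⟩
      (v ^ i₂ * R v u + σ ^ i₂ * R σ v) + (u ^ i₂ * R u v + σ ^ i₂ * - R σ v)
        ≈⟨ solve 4 (λ a b s r → (a :+ s :* r) :+ (b :+ s :* (:- r)) := a :+ b) refl _ _ _ _ ⟩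
      v ^ i₂ * R v u + u ^ i₂ * R u v
        ≈⟨ Y-closed u v ⟨
      Y u v ∎
      where σ = u + v

    -- The additive law at `(1#, z)`, multiplied by `z` so that its terms take the shape of the
    -- series `e`.
    relation : ∀ z → Σ< (suc n₂) (λ j → ι (ε (suc j) F.* quadratic j) *
      ((1# + z) ^ j * (z + z ^ suc (n₂ ∸ j)) - z ^ suc (n₂ ∸ j))) ≈ 0#
    relation z = begin
      Σ< (suc n₂) (λ j → ι (ε (suc j) F.* quadratic j) * (σ ^ j * (z + z ^ suc (n₂ ∸ j)) - z ^ suc (n₂ ∸ j)))
        ≈⟨ Σ-cong (suc n₂) (λ j → trans
             (solve 4 (λ a p z r → a :* (p :* (z :+ z :* r) :- z :* r) := z :* (a :* (p :* :1) :+ a :* (p :* r) :- a :* (:1 :* r))) refl _ _ _ _)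
             (*-congˡ (+-cong (+-congʳ (*-congˡ (*-congˡ (sym (1^ (n₂ ∸ j)))))) (-‿cong (*-congˡ (*-congʳ (sym (1^ j)))))))) ⟩
      Σ< (suc n₂) (λ j → z * (a j * (σ ^ j * 1# ^ (n₂ ∸ j)) + a j * (σ ^ j * z ^ (n₂ ∸ j)) - a j * (1# ^ j * z ^ (n₂ ∸ j))))
        ≈⟨ trans (Σ-*ˡ (suc n₂) z _) (*-congˡ (trans (Σ-+ (suc n₂) _ _) (+-cong (Σ-+ (suc n₂) _ _) (Σ-neg (suc n₂) _)))) ⟩
      z * ((Y σ 1# + Y σ z) - Y 1# z)
        ≈⟨ *-congˡ (+-congʳ (trans (+-comm _ _) (Y-additive 1# z))) ⟩
      z * (Y 1# z - Y 1# z)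
        ≈⟨ trans (*-congˡ (-‿inverseʳ _)) (zeroʳ z) ⟩
      0# ∎
      where
      σ = 1# + z
      a = λ j → ι (ε (suc j) F.* quadratic j)

  -- A geometric progression with ratio `(w / v) ^ m`. When `m ∣ N`, it is `v` times the coefficient
  -- of the letter `x_N` in `W(w) ⧢ W(v)`, apart from the term whose first factor is `x_0`.
  gsum : Carrier → Carrier → ℕ → Carrier
  gsum w v N = Σ< N (λ j → ι (ε (suc j)) * (w ^ j * v ^ (N ∸ suc j)))

  -- Of the first `m` indices only the last satisfies `m ∣ suc t`; this lets the progression advance
  -- in steps of `m`.
  block : ∀ k → m ≡ suc k → (f : ℕ → Carrier) → Σ< m (λ t → ι (ε (suc t)) * f t) ≈ f k
  block k m≡1+k f = begin
    Σ< m (λ t → ι (ε (suc t)) * f t)              ≡⟨ ≡.cong (λ n → Σ< n (λ t → ι (ε (suc t)) * f t)) m≡1+k ⟩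
    Σ< (suc k) (λ t → ι (ε (suc t)) * f t)        ≈⟨ Σ-last k _ ⟩
    Σ< k (λ t → ι (ε (suc t)) * f t) + ι (ε (suc k)) * f k
      ≈⟨ +-cong (Σ-zero k (λ t t<k → trans (*-congʳ (trans (ι-cong (ε-small (s≤s z≤n) (≡.subst (suc t ℕ.<_) (≡.sym m≡1+k) (s≤s t<k)))) 0#-homo)) (zeroˡ _)))
                (trans (*-congʳ (trans (ι-cong (ε-yes (≡.subst (m ∣_) m≡1+k ∣-refl))) 1#-homo)) (*-identityˡ _)) ⟩
    0# + f k                                      ≈⟨ +-identityˡ _ ⟩
    f k                                           ∎

  gsum-step : ∀ w v N → w * gsum w v (m ℕ.+ N) ≈ w ^ m * v ^ N + w ^ m * (w * gsum w v N)
  gsum-step w v N = begin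
    w * gsum w v (m ℕ.+ N)
      ≈⟨ *-congˡ (trans (Σ-split m N _) (+-cong (block k m≡1+k _) (trans (Σ-cong N shift) (Σ-*ˡ N (w ^ m) _)))) ⟩
    w * (w ^ k * v ^ (m ℕ.+ N ∸ suc k) + w ^ m * gsum w v N)
      ≈⟨ solve 5 (λ w p r s g → w :* (p :* r :+ s :* g) := (w :* p) :* r :+ s :* (w :* g)) refl _ _ _ _ _ ⟩
    w ^ suc k * v ^ (m ℕ.+ N ∸ suc k) + w ^ m * (w * gsum w v N)
      ≈⟨ +-congʳ (*-cong (^-congʳ w (≡.sym m≡1+k)) (^-congʳ v (≡.trans (≡.cong (m ℕ.+ N ∸_) (≡.sym m≡1+k)) (ℕₚ.m+n∸m≡n m N)))) ⟩
    w ^ m * v ^ N + w ^ m * (w * gsum w v N) ∎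
    where
    k = ℕ.pred m
    m≡1+k : m ≡ suc k
    m≡1+k = ≡.sym (ℕₚ.suc-pred m {{ℕ.>-nonZero m>0}})
    shift : ∀ t → ι (ε (suc (m ℕ.+ t))) * (w ^ (m ℕ.+ t) * v ^ (m ℕ.+ N ∸ suc (m ℕ.+ t))) ≈ w ^ m * (ι (ε (suc t)) * (w ^ t * v ^ (N ∸ suc t)))
    shift t = trans (*-cong (ι-cong (F.trans (F.reflexive (≡.cong ε (≡.sym (ℕₚ.+-suc m t)))) (ε-+ (suc t) ∣-refl)))
        (*-cong (^-homo-* w m t) (^-congʳ v (≡.trans (≡.cong (m ℕ.+ N ∸_) (≡.sym (ℕₚ.+-suc m t))) (ℕₚ.[m+n]∸[m+o]≡n∸o m N (suc t))))))
      (solve 4 (λ a p s r → a :* ((p :* s) :* r) := p :* (a :* (s :* r))) refl _ _ _ _)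

  -- The closed form of the progression with denominators cleared; the extra factor `w` turns
  -- `w ^ (m - 1)` into `w ^ m`.
  gsum-closed : ∀ w v M → w * ((w ^ m - v ^ m) * gsum w v (M ℕ.* m)) ≈ w ^ m * (w ^ (M ℕ.* m) - v ^ (M ℕ.* m))
  gsum-closed w v zero = begin
    w * ((w ^ m - v ^ m) * gsum w v 0)  ≈⟨ *-congˡ (*-congˡ (Σ-nil _)) ⟩
    w * ((w ^ m - v ^ m) * 0#)          ≈⟨ solve 3 (λ w p r → w :* ((p :- r) :* :0) := p :* (:1 :- :1)) refl _ _ _ ⟩
    w ^ m * (1# - 1#)                   ∎
  gsum-closed w v (suc M) = begin
    w * ((w ^ m - v ^ m) * gsum w v (m ℕ.+ N))
      ≈⟨ solve 3 (λ w d g → w :* (d :* g) := d :* (w :* g)) refl _ _ _ ⟩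
    (w ^ m - v ^ m) * (w * gsum w v (m ℕ.+ N))
      ≈⟨ *-congˡ (gsum-step w v N) ⟩
    (w ^ m - v ^ m) * (w ^ m * v ^ N + w ^ m * (w * gsum w v N))
      ≈⟨ solve 5 (λ w a b r g → (a :- b) :* (a :* r :+ a :* (w :* g)) := (a :- b) :* (a :* r) :+ a :* (w :* ((a :- b) :* g))) refl _ _ _ _ _ ⟩
    (w ^ m - v ^ m) * (w ^ m * v ^ N) + w ^ m * (w * ((w ^ m - v ^ m) * gsum w v N))
      ≈⟨ +-congˡ (*-congˡ (gsum-closed w v M)) ⟩
    (w ^ m - v ^ m) * (w ^ m * v ^ N) + w ^ m * (w ^ m * (w ^ N - v ^ N))
      ≈⟨ solve 4 (λ a b r s → (a :- b) :* (a :* r) :+ a :* (a :* (s :- r)) := a :* (a :* s :- b :* r)) refl _ _ _ _ ⟩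
    w ^ m * (w ^ m * w ^ N - v ^ m * v ^ N)
      ≈⟨ *-congˡ (+-cong (^-homo-* w m N) (-‿cong (^-homo-* v m N))) ⟨
    w ^ m * (w ^ (m ℕ.+ N) - v ^ (m ℕ.+ N)) ∎
    where N = M ℕ.* m

  geometric : ∀ n x → (1# - x) * Σ< n (x ^_) ≈ 1# - x ^ n
  geometric zero x = trans (*-congˡ (Σ-nil _)) (solve 1 (λ x → (:1 :- x) :* :0 := :1 :- :1) refl x)
  geometric (suc n) x = begin
    (1# - x) * Σ< (suc n) (x ^_)               ≈⟨ *-congˡ (Σ-last n _) ⟩
    (1# - x) * (Σ< n (x ^_) + x ^ n)           ≈⟨ distribˡ _ _ _ ⟩
    (1# - x) * Σ< n (x ^_) + (1# - x) * x ^ n  ≈⟨ +-congʳ (geometric n x) ⟩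
    (1# - x ^ n) + (1# - x) * x ^ n            ≈⟨ solve 2 (λ x p → (:1 :- p) :+ (:1 :- x) :* p := :1 :- x :* p) refl _ _ ⟩
    1# - x ^ suc n                             ∎

  -- The coefficient of the single letter `x_N` in the addition formula at `(1, z)`; the terms with
  -- first factor `x_0` add up to `1# - Alt`. The Frobenius hypothesis gives
  -- `σ * (σ ^ m - 1#) = - z * (1# - z ^ m)` and `σ * (σ ^ m - z ^ m) = 1# - z ^ m`, so the three
  -- geometric sums share the denominator `1# - z ^ m`.
  module Linear (z : Carrier) (frobenius : (1# + z) ^ suc m ≈ 1# + z ^ suc m) (M : ℕ) where
    N : ℕ
    N = M ℕ.* m
    σ = 1# + z
    E Alt : Carrier
    E = Σ< N (λ j → ι (ε (suc j)) * (σ ^ j * (z + z ^ (N ∸ suc j)) - z ^ (N ∸ suc j)))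
    Alt = Σ< (suc N) ((- z) ^_)

    E-split : E ≈ (z * gsum σ 1# N + gsum σ z N) - gsum 1# z N
    E-split = trans (Σ-cong N (λ j → trans
        (solve 4 (λ a p z r → a :* (p :* (z :+ r) :- r) := (z :* (a :* (p :* :1)) :+ a :* (p :* r)) :- a :* (:1 :* r)) refl _ _ _ _)
        (+-cong (+-congʳ (*-congˡ (*-congˡ (*-congˡ (sym (1^ (N ∸ suc j))))))) (-‿cong (*-congˡ (*-congʳ (sym (1^ j))))))))
      (trans (Σ-+ N _ _) (+-cong (trans (Σ-+ N _ _) (+-congʳ (Σ-*ˡ N z _))) (Σ-neg N _)))

    -- d₁, …, d₅ vanish; the left-hand side lies in the ideal they generate.
    vanishes : z * (σ * ((1# - z ^ m) * ((E + 1#) - Alt))) ≈ 0#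
    vanishes = begin
      z * (σ * ((1# - Zm) * ((E + 1#) - Alt)))
        ≈⟨ *-congˡ (*-congˡ (*-congˡ (+-congʳ (+-congʳ E-split)))) ⟩
      z * (σ * ((1# - Zm) * ((((z * Ga + Gb) - Gc) + 1#) - Alt)))
        ≈⟨ solve 9 (λ z Zm ZN Sm SN Ga Gb Gc Al →
             let s = :1 :+ z
                 d₁ = s :* ((Sm :- :1) :* Ga) :- Sm :* (SN :- :1)
                 d₂ = s :* ((Sm :- Zm) :* Gb) :- Sm :* (SN :- ZN)
                 d₃ = (:1 :- Zm) :* Gc :- (:1 :- ZN)
                 d₄ = s :* Al :- (:1 :+ z :* ZN)
                 d₅ = s :* Sm :- (:1 :+ z :* Zm)
             in z :* (s :* ((:1 :- Zm) :* ((((z :* Ga :+ Gb) :- Gc) :+ :1) :- Al)))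
                := (z :* s) :* (d₂ :- d₁) :+ ((z :* s) :* (Ga :- Gb) :+ z :* (:1 :- ZN)) :* d₅ :- (z :* s) :* d₃ :- (z :* (:1 :- Zm)) :* d₄)
             refl z Zm ZN Sm SN Ga Gb Gc Alt ⟩
      (z * σ) * (d₂ - d₁) + ((z * σ) * (Ga - Gb) + z * (1# - ZN)) * d₅ - (z * σ) * d₃ - (z * (1# - Zm)) * d₄
        ≈⟨ +-cong (+-cong (+-cong (*-congˡ (+-cong d₂≈0 (-‿cong d₁≈0))) (*-congˡ d₅≈0)) (-‿cong (*-congˡ d₃≈0))) (-‿cong (*-congˡ d₄≈0)) ⟩
      (z * σ) * (0# - 0#) + ((z * σ) * (Ga - Gb) + z * (1# - ZN)) * 0# - (z * σ) * 0# - (z * (1# - Zm)) * 0#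
        ≈⟨ solve 3 (λ a b d → a :* (:0 :- :0) :+ b :* :0 :- a :* :0 :- d :* :0 := :0) refl _ _ _ ⟩
      0# ∎
      where
      Zm = z ^ m
      ZN = z ^ N
      Sm = σ ^ m
      SN = σ ^ N
      Ga = gsum σ 1# N
      Gb = gsum σ z N
      Gc = gsum 1# z N
      d₁ = σ * ((Sm - 1#) * Ga) - Sm * (SN - 1#)
      d₂ = σ * ((Sm - Zm) * Gb) - Sm * (SN - ZN)
      d₃ = (1# - Zm) * Gc - (1# - ZN)
      d₄ = σ * Alt - (1# + z * ZN)
      d₅ = σ * Sm - (1# + z * Zm)
      difference : ∀ {x y} → x ≈ y → x - y ≈ 0#
      difference e = trans (+-congʳ e) (-‿inverseʳ _)
      d₁≈0 : d₁ ≈ 0#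
      d₁≈0 = difference (trans (*-congˡ (*-congʳ (+-congˡ (-‿cong (sym (1^ m)))))) (trans (gsum-closed σ 1# M) (*-congˡ (+-congˡ (-‿cong (1^ N))))))
      d₂≈0 : d₂ ≈ 0#
      d₂≈0 = difference (gsum-closed σ z M)
      d₃≈0 : d₃ ≈ 0#
      d₃≈0 = difference (begin
        (1# - z ^ m) * Gc                  ≈⟨ trans (*-identityˡ _) (*-congʳ (+-congʳ (1^ m))) ⟨
        1# * ((1# ^ m - z ^ m) * Gc)       ≈⟨ gsum-closed 1# z M ⟩
        1# ^ m * (1# ^ N - z ^ N)          ≈⟨ trans (*-cong (1^ m) (+-congʳ (1^ N))) (*-identityˡ _) ⟩
        1# - z ^ N                         ∎)
      d₄≈0 : d₄ ≈ 0#
      d₄≈0 = difference (begin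
        σ * Alt                        ≈⟨ *-congʳ (solve 1 (λ z → :1 :+ z := :1 :- (:- z)) refl z) ⟩
        (1# - (- z)) * Alt             ≈⟨ geometric (suc N) (- z) ⟩
        1# - (- z) * (- z) ^ N         ≈⟨ +-congˡ (-‿cong (*-congˡ (neg-pow-even z (divides M ≡.refl)))) ⟩
        1# - (- z) * z ^ N             ≈⟨ solve 2 (λ z p → :1 :- (:- z) :* p := :1 :+ z :* p) refl _ _ ⟩
        1# + z * z ^ N                 ∎)
      d₅≈0 : d₅ ≈ 0#
      d₅≈0 = difference frobenius

-- The relations as coefficients of power series

module Coefficients {c ℓ : Level} (F : CommutativeRing c ℓ) (isField : IsField F)
                    (m : ℕ) (card : HasCardinality F (suc m)) where
  open Indicator F isField m card public
  open CommutativeRing F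
  open Algebra.Properties.Ring ring
  open Algebra.Properties.Semiring.Exp semiring using (_^_)
  open Relation.Binary.Reasoning.Setoid setoid
  open IntegerSolver F
  open Sums F
  open PowerSeries F
  open Construction F (suc m) using (natF)
  private
    module S = CommutativeRing series
    module I = Identities F isField m card series const const-isRingHomomorphism

  σ : Series
  σ = S.1# S.+ X

  σ-pow : ∀ n k → (σ ^ₛ n) k ≈ natF (n C k)
  σ-pow zero zero = sym (natF-nC0 0)
  σ-pow zero (suc k) = sym (natF-C-zero {0} {suc k} (s≤s z≤n))
  σ-pow (suc n) k = trans (⊛-distribʳ (σ ^ₛ n) S.1# X k) (trans (+-congʳ (⊛-identityˡ (σ ^ₛ n) k)) (step k))
    where
    step : ∀ k → (σ ^ₛ n) k + (X ⊛ (σ ^ₛ n)) k ≈ natF (suc n C k)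
    step zero = trans (+-cong (σ-pow n 0) (X-⊛-zero _)) (trans (+-identityʳ _) (trans (natF-nC0 n) (sym (natF-nC0 (suc n)))))
    step (suc k) = trans (+-cong (σ-pow n (suc k)) (trans (X-⊛-suc _ k) (σ-pow n k))) (trans (+-comm _ _) (sym (natF-pascal n k)))

  frobenius : ∀ k → (σ ^ₛ suc m) k ≈ (S.1# S.+ X ^ₛ suc m) k
  frobenius zero = trans (σ-pow (suc m) 0) (trans (natF-nC0 (suc m)) (sym (trans (+-congˡ (X^k (suc m) 0)) (+-identityʳ 1#))))
  frobenius (suc k) = trans (σ-pow (suc m) (suc k)) (trans (cases (ℕₚ.<-cmp k m)) (sym (trans (+-identityˡ _) (X^k (suc m) (suc k)))))
    where
    cases : _ → natF (suc m C suc k) ≈ δ m k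
    cases (tri< k<m k≢m _) = trans (qCk≈0 k k<m) (sym (δ-≢ m k (k≢m ∘ ≡.sym)))
    cases (tri≈ _ ≡.refl _) = trans (natF-nCn (suc m)) (sym (δ-refl m))
    cases (tri> _ k≢m m<k) = trans (natF-C-zero (s≤s m<k)) (sym (δ-≢ m k (k≢m ∘ ≡.sym)))

  sg : ℕ → Carrier
  sg n = (- 1#) ^ n

  sg² : ∀ n → sg n * sg n ≈ 1#
  sg² zero = *-identityˡ 1#
  sg² (suc n) = trans (solve 1 (λ s → ((:- :1) :* s) :* ((:- :1) :* s) := s :* s) refl (sg n)) (sg² n)

  δ-sym : ∀ i j → δ i j ≈ δ j i
  δ-sym zero zero = refl
  δ-sym zero (suc j) = refl
  δ-sym (suc i) zero = refl
  δ-sym (suc i) (suc j) = δ-sym i j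

  -- The coefficient of index `b` in the expansion of `1 / (1 + X)` truncated after degree `N`.
  alternating : ℕ → ℕ → Carrier
  alternating N b = Σ< (suc N) (λ k → sg k * δ k b)

  alternating-≤ : ∀ N b → b ℕ.≤ N → alternating N b ≈ sg b
  alternating-≤ N b b≤N = trans (Σ-cong (suc N) (λ k → trans (*-comm _ _) (*-congʳ (δ-sym k b)))) (Σ-δ (suc N) b sg (s≤s b≤N))

  alternating-> : ∀ N b → N ℕ.< b → alternating N b ≈ 0#
  alternating-> N b N<b = Σ-zero (suc N) (λ k k≤N → trans (*-congˡ (δ-≢ k b (ℕₚ.<⇒≢ (ℕₚ.<-≤-trans k≤N N<b)))) (zeroʳ _))

  -- With `k = N ∸ suc j`, this is `X` times the coefficient of `x_{suc j} ⧢ x_k` in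
  -- `W(u + v) ⧢ (W(u) + W(v)) - W(u) ⧢ W(v)` at `u = 1`, `v = X`. The factor `X` clears the pole
  -- that occurs at `k = 0`.
  e : ℕ → ℕ → Series
  e N j = σ ^ₛ j S.* (X S.+ X ^ₛ (N ∸ suc j)) S.- X ^ₛ (N ∸ suc j)

  -- The factors `z`, `σ` and `1# - z ^ m` of `vanishes` can be cancelled among power series: `X` is
  -- regular and the other two have constant term `1#`. In positive degree the summand `1#`
  -- disappears.
  linear-relation : ∀ N b → m ∣ N → Σ< N (λ j → ε (suc j) * e N j (suc b)) ≈ alternating N (suc b)
  linear-relation .(M ℕ.* m) b (divides M ≡.refl) = begin
    Σ< N (λ j → ε (suc j) * e N j (suc b))      ≈⟨ trans (Σ-coefficient N _ (suc b)) (Σ-cong N (λ j → const-⊛ (ε (suc j)) (e N j) (suc b))) ⟨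
    L.E (suc b)                                 ≈⟨ +-identityʳ _ ⟨
    L.E (suc b) + 0#                            ≈⟨ x-y≈0⇒x≈y (relation (suc b)) ⟩
    L.Alt (suc b)                               ≈⟨ trans (Σ-coefficient (suc N) _ (suc b)) (Σ-cong (suc N) (λ k →
      trans (I.neg-pow X k (suc b)) (trans (const-⊛ (sg k) (X ^ₛ k) (suc b)) (*-congˡ (X^k k (suc b)))))) ⟩
    alternating N (suc b)                       ∎
    where
    module L = I.Linear X frobenius M
    N = M ℕ.* m
    relation : ∀ n → ((L.E S.+ S.1#) S.- L.Alt) n ≈ 0#
    relation = unital-regular (S.1# S.- X ^ₛ m) _
      (trans (+-congˡ (-‿cong (trans (X^k m 0) (δ-≢ m 0 (ℕₚ.>⇒≢ m>0))))) (trans (+-congˡ -0#≈0#) (+-identityʳ 1#)))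
      (unital-regular σ _ (+-identityʳ 1#) (X-regular _ L.vanishes))

  half : ℕ → ℕ → Carrier
  half i j = δ i j - natF (i C j)

  quadratic : ℕ → ℕ → ℕ → Carrier
  quadratic n i j = half i j + half i (n ∸ j)

  quadratic-relation′ : ∀ i i₂ b → m ∣ suc i → m ∣ suc i₂ →
    Σ< (suc (i ℕ.+ i₂)) (λ j → (ε (suc j) * quadratic (i ℕ.+ i₂) i j) * e (suc (suc (i ℕ.+ i₂))) j b) ≈ 0#
  quadratic-relation′ i i₂ b m∣i m∣i₂ = begin
    Σ< (suc n) (λ j → (ε (suc j) * quadratic n i j) * e (suc (suc n)) j b)
      ≈⟨ Σ-cong< (suc n) (λ j j≤n → *-congˡ (reflexive (≡.cong (λ k → (σ ^ₛ j S.* (X S.+ X ^ₛ k) S.- X ^ₛ k) b) (ℕₚ.+-∸-assoc 1 (ℕₚ.≤-pred j≤n))))) ⟩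
    Σ< (suc n) (λ j → (ε (suc j) * quadratic n i j) * (σ ^ₛ j S.* (X S.+ X ^ₛ suc (n ∸ j)) S.- X ^ₛ suc (n ∸ j)) b)
      ≈⟨ trans (Σ-coefficient (suc n) _ b) (Σ-cong (suc n) (λ j → const-⊛ _ _ b)) ⟨
    _ ≈⟨ I.Quadratic.relation i i₂ m∣i m∣i₂ X b ⟩
    0# ∎
    where n = i ℕ.+ i₂

  quadratic-relation : ∀ n i b → i ℕ.≤ n → m ∣ suc i → m ∣ suc (suc n) →
    Σ< (suc n) (λ j → (ε (suc j) * quadratic n i j) * e (suc (suc n)) j b) ≈ 0#
  quadratic-relation n i b i≤n m∣i m∣N = ≡.subst
    (λ n → Σ< (suc n) (λ j → (ε (suc j) * quadratic n i j) * e (suc (suc n)) j b) ≈ 0#) i+i₂≡n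
    (quadratic-relation′ i (n ∸ i) b m∣i (∣m+n∣m⇒∣n (≡.subst (m ∣_) (≡.sym (≡.cong suc (≡.trans (ℕₚ.+-suc i (n ∸ i)) (≡.cong suc i+i₂≡n)))) m∣N) m∣i))
    where i+i₂≡n = ℕₚ.m+[n∸m]≡n i≤n

  -- The hypotheses split `y` into the linear pattern, weighted by `x`, and quadratic patterns,
  -- weighted by `P`. The quadratic ones contribute nothing. The index `suc n` stands apart because
  -- it belongs to `x_{suc n} ⧢ x_0`, which has no part of depth two.
  relation : ∀ n x (P y : ℕ → Carrier) b → m ∣ suc n →
    (∀ j → j ℕ.< n → y (suc j) ≈ ε (suc j) * x + Σ< n (λ i → (ε (suc i) * P i) * (ε (suc j) * quadratic (ℕ.pred n) i j))) →
    y (suc n) ≈ x →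
    Σ< (suc n) (λ j → y (suc j) * e (suc n) j (suc b)) ≈ x * alternating (suc n) (suc b)
  relation n x P y b m∣N y-low y-top = begin
    Σ< (suc n) (λ j → y (suc j) * e′ j)
      ≈⟨ Σ-last n _ ⟩
    Σ< n (λ j → y (suc j) * e′ j) + y (suc n) * e′ n
      ≈⟨ +-cong (trans (Σ-cong< n (λ j j<n → trans (*-congʳ (y-low j j<n)) (trans (distribʳ _ _ _) (+-cong
             (solve 3 (λ a x g → (a :* x) :* g := x :* (a :* g)) refl _ _ _) (sym (Σ-*ʳ n (e′ j) _)))))) (Σ-+ n _ _))
           (*-congʳ (trans y-top (sym (trans (*-congʳ (ε-yes m∣N)) (*-identityˡ _))))) ⟩
    (Σ< n (λ j → x * (ε (suc j) * e′ j)) + Σ< n (λ j → Σ< n (λ i → ((ε (suc i) * P i) * (ε (suc j) * q i j)) * e′ j))) + (ε (suc n) * x) * e′ n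
      ≈⟨ +-cong (+-cong (Σ-*ˡ n x _) (trans (Σ-swap n n _) (Σ-zero n vanish))) (solve 3 (λ a x g → (a :* x) :* g := x :* (a :* g)) refl _ _ _) ⟩
    (x * Σ< n (λ j → ε (suc j) * e′ j) + 0#) + x * (ε (suc n) * e′ n)
      ≈⟨ solve 3 (λ x s t → (x :* s :+ :0) :+ x :* t := x :* (s :+ t)) refl _ _ _ ⟩
    x * (Σ< n (λ j → ε (suc j) * e′ j) + ε (suc n) * e′ n)
      ≈⟨ *-congˡ (trans (sym (Σ-last n _)) (linear-relation (suc n) b m∣N)) ⟩
    x * alternating (suc n) (suc b) ∎
    where
    e′ : ℕ → Carrier
    e′ j = e (suc n) j (suc b)
    q = quadratic (ℕ.pred n)
    quad : ∀ n i → m ∣ suc n → m ∣ suc i → i ℕ.< n →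
           Σ< n (λ j → (ε (suc j) * quadratic (ℕ.pred n) i j) * e (suc n) j (suc b)) ≈ 0#
    quad (suc n) i m∣N m∣i (s≤s i≤n) = quadratic-relation n i (suc b) i≤n m∣i m∣N
    vanish : ∀ i → i ℕ.< n → Σ< n (λ j → ((ε (suc i) * P i) * (ε (suc j) * q i j)) * e′ j) ≈ 0#
    vanish i i<n with m ∣? suc i
    ... | yes m∣i = trans (Σ-cong n (λ j → *-assoc _ _ _)) (trans (Σ-*ˡ n _ _) (trans (*-congˡ (quad n i m∣N m∣i i<n)) (zeroʳ _)))
    ... | no _ = Σ-zero n (λ j _ → solve 4 (λ p a q g → ((:0 :* p) :* (a :* q)) :* g := :0) refl _ _ _ _)

  X^k-⊛-≤ : ∀ k n f → k ℕ.≤ n → (X ^ₛ k ⊛ f) n ≈ f (n ∸ k)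
  X^k-⊛-≤ zero n f _ = ⊛-identityˡ f n
  X^k-⊛-≤ (suc k) (suc n) f (s≤s k≤n) = trans (⊛-assoc X (X ^ₛ k) f (suc n)) (trans (X-⊛-suc _ n) (X^k-⊛-≤ k n f k≤n))

  X^k-⊛-> : ∀ k n f → n ℕ.< k → (X ^ₛ k ⊛ f) n ≈ 0#
  X^k-⊛-> (suc k) zero f _ = trans (⊛-assoc X (X ^ₛ k) f 0) (X-⊛-zero _)
  X^k-⊛-> (suc k) (suc n) f (s≤s n<k) = trans (⊛-assoc X (X ^ₛ k) f (suc n)) (trans (X-⊛-suc _ n) (X^k-⊛-> k n f n<k))

  e-coefficient : ∀ N j b → e N j (suc b) ≈ (natF (j C b) + (X ^ₛ (N ∸ suc j) ⊛ (σ ^ₛ j)) (suc b)) - δ (N ∸ suc j) (suc b)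
  e-coefficient N j b = +-cong (trans (⊛-distribˡ (σ ^ₛ j) X (X ^ₛ (N ∸ suc j)) (suc b)) (+-cong
    (trans (⊛-comm (σ ^ₛ j) X (suc b)) (trans (X-⊛-suc (σ ^ₛ j) b) (σ-pow j b)))
    (⊛-comm (σ ^ₛ j) _ (suc b)))) (-‿cong (X^k (N ∸ suc j) (suc b)))

  e-coefficient-< : ∀ N j b → N ∸ suc j ℕ.< suc b → e N j (suc b) ≈ natF (j C b) + natF (j C (suc b ∸ (N ∸ suc j)))
  e-coefficient-< N j b k<b = trans (e-coefficient N j b) (trans (+-cong
    (+-congˡ (trans (X^k-⊛-≤ (N ∸ suc j) (suc b) _ (ℕₚ.<⇒≤ k<b)) (σ-pow j (suc b ∸ (N ∸ suc j))))) (trans (-‿cong (δ-≢ _ _ (ℕₚ.<⇒≢ k<b))) -0#≈0#)) (+-identityʳ _))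

  -- If `N ∸ suc j` equals `suc b`, the constant coefficient of `σ ^ₛ j` cancels against the
  -- subtracted power of `X`; if it is larger, neither reaches degree `suc b`.
  e-coefficient-≥ : ∀ N j b → suc b ℕ.≤ N ∸ suc j → e N j (suc b) ≈ natF (j C b)
  e-coefficient-≥ N j b b≤k = trans (e-coefficient N j b) (trans (+-assoc _ _ _) (trans (+-congˡ (tail (ℕₚ.m≤n⇒m<n∨m≡n b≤k))) (+-identityʳ _)))
    where
    tail : _ → (X ^ₛ (N ∸ suc j) ⊛ (σ ^ₛ j)) (suc b) - δ (N ∸ suc j) (suc b) ≈ 0#
    tail (inj₁ b<k) = trans (+-cong (X^k-⊛-> (N ∸ suc j) (suc b) _ b<k) (trans (-‿cong (δ-≢ _ _ (ℕₚ.>⇒≢ b<k))) -0#≈0#)) (+-identityˡ 0#)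
    tail (inj₂ b≡k) rewrite ≡.sym b≡k = trans (+-cong
      (trans (X^k-⊛-≤ (suc b) (suc b) _ ℕₚ.≤-refl) (trans (reflexive (≡.cong (σ ^ₛ j) (ℕₚ.n∸n≡0 b))) (trans (σ-pow j 0) (natF-nC0 j))))
      (-‿cong (δ-refl b))) (-‿inverseʳ 1#)

-- Associativity on letters: `x_1 ◇ (x_b ◇ x_c) = (x_1 ◇ x_b) ◇ x_c`

module Key {c ℓ : Level} (F : CommutativeRing c ℓ) (isField : IsField F)
           (m : ℕ) (card : HasCardinality F (suc m)) where
  open Coefficients F isField m card
  open CommutativeRing F
  open Algebra.Properties.Ring ring
  open Algebra.Properties.Semiring.Exp semiring using (^-homo-*)
  open Relation.Binary.Reasoning.Setoid setoid
  open IntegerSolver F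
  open Sums F
  open Construction F (suc m) using (natF; altSign; Δcoef)

  -- The coefficient of x_{a+b-j} (x_j ⧢ s) in (x_a ◇ x_b) ▷ s, where x_0 = 1.
  D : ℕ → ℕ → ℕ → Carrier
  D zero a b = 1#
  D (suc j) a b = Δcoef (suc j) a b

  altSign-sg : ∀ n x → altSign n x ≈ sg n * x
  altSign-sg zero x = sym (*-identityˡ x)
  altSign-sg (suc n) x = trans (-‿cong (altSign-sg n x)) (solve 2 (λ s x → :- (s :* x) := ((:- :1) :* s) :* x) refl _ _)

  D-in : ∀ j a b → suc j ℕ.< suc a ℕ.+ suc b →
         D (suc j) (suc a) (suc b) ≈ ε (suc j) * (sg a * natF (j C a) + sg b * natF (j C b))
  D-in j a b j<a+b with m ∣? suc j | suc j ℕ.<? suc a ℕ.+ suc b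
  ... | yes _ | yes _ = trans (+-cong (altSign-sg a _) (altSign-sg b _)) (sym (*-identityˡ _))
  ... | yes _ | no j≮ = ⊥-elim (j≮ j<a+b)
  ... | no _  | _ = sym (zeroˡ _)

  D-out : ∀ j a b → a ℕ.+ b ℕ.≤ suc j → D (suc j) a b ≈ 0#
  D-out j a b a+b≤j with m ∣? suc j | suc j ℕ.<? a ℕ.+ b
  ... | yes _ | yes j< = ⊥-elim (ℕₚ.<⇒≱ j< a+b≤j)
  ... | yes _ | no _ = refl
  ... | no _  | _ = refl

  Δcoef-0 : ∀ a b → Δcoef 0 a b ≈ 0#
  Δcoef-0 a b with m ∣? 0 | 0 ℕ.<? 0
  ... | yes _ | no _ = refl
  ... | no _  | _ = refl

  Δcoef-sym : ∀ j a b → Δcoef j a b ≈ Δcoef j b a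
  Δcoef-sym j a b with m ∣? j | 0 ℕ.<? j | j ℕ.<? a ℕ.+ b | j ℕ.<? b ℕ.+ a
  ... | no _ | _ | _ | _ = refl
  ... | yes _ | no _ | _ | _ = refl
  ... | yes _ | yes _ | yes p | yes _ = +-comm _ _
  ... | yes _ | yes _ | yes p | no ¬p = ⊥-elim (¬p (≡.subst (j ℕ.<_) (ℕₚ.+-comm a b) p))
  ... | yes _ | yes _ | no ¬p | yes p = ⊥-elim (¬p (≡.subst (j ℕ.<_) (ℕₚ.+-comm b a) p))
  ... | yes _ | yes _ | no _ | no _ = refl

  D-sym : ∀ j a b → D j a b ≈ D j b a
  D-sym zero a b = refl
  D-sym (suc j) a b = Δcoef-sym (suc j) a b

  sg-even : ∀ {k} n → m ∣ k → sg (k ℕ.+ n) ≈ sg n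
  sg-even {k} n d = trans (^-homo-* (- 1#) k n) (trans (*-congʳ (-1^even d)) (*-identityˡ _))

  sg-suc : ∀ n → sg (suc n) ≈ - sg n
  sg-suc n = -1*x≈-x (sg n)

  ε-sg : ∀ k n → ε k * sg (k ℕ.+ n) ≈ ε k * sg n
  ε-sg k n with m ∣? k
  ... | yes d = *-congˡ (sg-even n d)
  ... | no _ = trans (zeroˡ _) (sym (zeroˡ _))

  -- In this range the binomial belonging to `suc b` vanishes and the one belonging to `1` is `1`.
  D-1-below : ∀ k b → k ℕ.< suc b → D k 1 (suc b) ≈ ε k
  D-1-below zero b _ = sym ε-0
  D-1-below (suc k) b k<b = begin
    D (suc k) 1 (suc b)                                     ≈⟨ D-in k 0 b (ℕₚ.m≤n⇒m≤1+n k<b) ⟩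
    ε (suc k) * (1# * natF (k C 0) + sg b * natF (k C b))   ≈⟨ *-congˡ (+-cong (*-congˡ (natF-nC0 k)) (*-congˡ (natF-C-zero (ℕₚ.≤-pred k<b)))) ⟩
    ε (suc k) * (1# * 1# + sg b * 0#)                       ≈⟨ solve 2 (λ e s → e :* (:1 :* :1 :+ s :* :0) := e) refl _ _ ⟩
    ε (suc k)                                               ∎

  -- At `k = suc b` both binomials are `1`, and their signs are opposite when `m ∣ k`. Larger `k`
  -- are out of range.
  D-1-above : ∀ k b → suc b ℕ.≤ k → D k 1 (suc b) ≈ 0#
  D-1-above (suc k) b (s≤s b≤k) with ℕₚ.m≤n⇒m<n∨m≡n b≤k
  ... | inj₁ b<k = D-out k 1 (suc b) (s≤s b<k)
  ... | inj₂ ≡.refl = begin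
    D (suc k) 1 (suc k)                                     ≈⟨ D-in k 0 k (ℕₚ.n<1+n (suc k)) ⟩
    ε (suc k) * (1# * natF (k C 0) + sg k * natF (k C k))   ≈⟨ *-congˡ (+-cong (*-congˡ (natF-nC0 k)) (*-congˡ (natF-nCn k))) ⟩
    ε (suc k) * (1# * 1# + sg k * 1#)                       ≈⟨ solve 2 (λ e s → e :* (:1 :* :1 :+ s :* :1) := e :* :1 :- e :* ((:- :1) :* s)) refl _ _ ⟩
    ε (suc k) * sg 0 - ε (suc k) * sg (suc k)               ≈⟨ +-congˡ (-‿cong (trans (*-congˡ (reflexive (≡.cong sg (≡.sym (ℕₚ.+-identityʳ (suc k)))))) (ε-sg (suc k) 0))) ⟩
    ε (suc k) * sg 0 - ε (suc k) * sg 0                     ≈⟨ -‿inverseʳ _ ⟩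
    0#                                                      ∎

  -- The two binomials agree by symmetry, and `m ∣ suc (a + b)` makes their signs opposite. Hence
  -- `x_{suc a} ◇ x_{suc b}` has no word of depth two with first letter `x_1`.
  D-top : ∀ a b → D (a ℕ.+ suc b) (suc a) (suc b) ≈ 0#
  D-top a b = begin
    D (a ℕ.+ suc b) (suc a) (suc b)             ≡⟨ ≡.cong (λ n → D n (suc a) (suc b)) (ℕₚ.+-suc a b) ⟩
    D (suc n) (suc a) (suc b)                   ≈⟨ D-in n a b (≡.subst (suc n ℕ.<_) (≡.cong suc (≡.sym (ℕₚ.+-suc a b))) (ℕₚ.n<1+n (suc n))) ⟩
    ε (suc n) * (sg a * natF (n C a) + sg b * natF (n C b))
      ≈⟨ *-congˡ (+-congʳ (*-congˡ (reflexive (≡.cong natF (≡.trans (nCk≡nC[n∸k] (ℕₚ.m≤m+n a b)) (≡.cong (n C_) (ℕₚ.m+n∸m≡n a b))))))) ⟩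
    ε (suc n) * (sg a * natF (n C b) + sg b * natF (n C b))
      ≈⟨ trans (solve 4 (λ e s t x → e :* (s :* x :+ t :* x) := (e :* s :+ e :* t) :* x) refl _ _ _ _)
           (*-congʳ (trans (+-congˡ (sym (ε-sg (suc n) b))) (+-congˡ (*-congˡ sign)))) ⟩
    (ε (suc n) * sg a + ε (suc n) * - sg a) * natF (n C b)
      ≈⟨ solve 3 (λ e s x → (e :* s :+ e :* (:- s)) :* x := :0) refl _ _ _ ⟩
    0# ∎
    where
    n = a ℕ.+ b
    sign : sg (suc n ℕ.+ b) ≈ - sg a
    sign = begin
      sg (suc (a ℕ.+ b ℕ.+ b))       ≈⟨ sg-suc (a ℕ.+ b ℕ.+ b) ⟩
      - sg (a ℕ.+ b ℕ.+ b)           ≈⟨ -‿cong (trans (^-homo-* (- 1#) (a ℕ.+ b) b) (*-congʳ (^-homo-* (- 1#) a b))) ⟩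
      - ((sg a * sg b) * sg b)       ≈⟨ -‿cong (trans (*-assoc _ _ _) (trans (*-congˡ (sg² b)) (*-identityʳ _))) ⟩
      - sg a                         ∎

  -- x stands for the value of a linear functional on the letters, p for its value on the words of depth two.
  module Functional (x : ℕ → Carrier) (p : ℕ → ℕ → Carrier) where
    letters : ℕ → ℕ → Carrier
    letters i zero = x i
    letters i (suc j) = p i (suc j)

    -- The value of the functional on x_j ⧢ x_k.
    shuffle : ℕ → ℕ → Carrier
    shuffle zero k = x k
    shuffle (suc j) zero = x (suc j)
    shuffle (suc j) (suc k) = p (suc j) (suc k) + (p (suc k) (suc j) +
      Σ< (suc (suc j ℕ.+ suc k)) (λ i → D i (suc j) (suc k) * letters (suc j ℕ.+ suc k ∸ i) i))

    -- Let the weights `suc j` and `suc k` of the letters be multiples of `m`. The word with second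
    -- letter `x_{suc i}` gets `δ i k + δ i j` from the two concatenations and, for such a multiple
    -- `suc i`, `- C(i, j) - C(i, k)` from the diamond, which together make `quadratic`.
    shuffle-expand : ∀ n j → m ∣ suc n → j ℕ.< n → ε (suc j) * (ε (n ∸ j) * shuffle (suc j) (n ∸ j)) ≈
      ε (suc j) * x (suc n) + Σ< n (λ i → (ε (suc i) * p (n ∸ i) (suc i)) * (ε (suc j) * quadratic (ℕ.pred n) i j))
    shuffle-expand n j m∣N j<n = lemma (n ∸ suc j) (ℕₚ.+-∸-assoc 1 j<n) (≡.trans (≡.cong suc (ℕₚ.+-comm j _)) (≡.trans (≡.sym (ℕₚ.+-suc _ j)) (ℕₚ.m∸n+n≡m j<n)))
      where
      lemma : ∀ k → n ∸ j ≡ suc k → suc (j ℕ.+ k) ≡ n → ε (suc j) * (ε (n ∸ j) * shuffle (suc j) (n ∸ j)) ≈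
        ε (suc j) * x (suc n) + Σ< n (λ i → (ε (suc i) * p (n ∸ i) (suc i)) * (ε (suc j) * quadratic (ℕ.pred n) i j))
      lemma k n∸j≡1+k ≡.refl with m ∣? suc j
      ... | no _ = trans (zeroˡ _) (sym (trans (+-cong (zeroˡ _) (Σ-zero n (λ i _ → solve 2 (λ a b → a :* (:0 :* b) := :0) refl _ _))) (+-identityˡ 0#)))
      ... | yes m∣j = begin
        1# * (ε (n ∸ j) * shuffle (suc j) (n ∸ j))
          ≈⟨ trans (*-identityˡ _) (trans (*-cong (ε-yes (≡.subst (m ∣_) (≡.sym n∸j≡1+k) m∣k)) (reflexive (≡.cong (shuffle (suc j)) n∸j≡1+k))) (*-identityˡ _)) ⟩
        p (suc j) (suc k) + (p (suc k) (suc j) + Σ< (suc (suc j ℕ.+ suc k)) (λ i → D i (suc j) (suc k) * letters (suc j ℕ.+ suc k ∸ i) i))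
          ≈⟨ +-congˡ (+-congˡ (trans (Σ-suc _ _) (+-cong (trans (*-identityˡ _) (reflexive (≡.cong x (≡.cong suc (ℕₚ.+-suc j k)))))
               (trans (reflexive (≡.cong (λ t → Σ< t (λ i → D (suc i) (suc j) (suc k) * p (suc j ℕ.+ suc k ∸ suc i) (suc i))) (≡.cong suc (ℕₚ.+-suc j k))))
               (trans (Σ-last n _) (trans (+-congˡ (trans (*-congʳ (D-out n (suc j) (suc k) (ℕₚ.≤-reflexive (≡.cong suc (ℕₚ.+-suc j k))))) (zeroˡ _))) (+-identityʳ _))))))) ⟩
        p (suc j) (suc k) + (p (suc k) (suc j) + (x (suc n) + Σ< n (λ i → D (suc i) (suc j) (suc k) * p (suc j ℕ.+ suc k ∸ suc i) (suc i))))
          ≈⟨ solve 4 (λ a b x s → a :+ (b :+ (x :+ s)) := :1 :* x :+ ((a :+ b) :+ s)) refl _ _ _ _ ⟩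
        1# * x (suc n) + ((p (suc j) (suc k) + p (suc k) (suc j)) + Σ< n (λ i → D (suc i) (suc j) (suc k) * p (suc j ℕ.+ suc k ∸ suc i) (suc i)))
          ≈⟨ +-congˡ (+-congʳ (+-cong pick-k pick-j)) ⟩
        1# * x (suc n) + ((Σ< n (λ i → δ k i * (ε (suc i) * p (n ∸ i) (suc i))) + Σ< n (λ i → δ j i * (ε (suc i) * p (n ∸ i) (suc i)))) +
                     Σ< n (λ i → D (suc i) (suc j) (suc k) * p (suc j ℕ.+ suc k ∸ suc i) (suc i)))
          ≈⟨ +-congˡ (trans (+-congʳ (sym (Σ-+ n _ _))) (sym (Σ-+ n _ _))) ⟩
        1# * x (suc n) + Σ< n (λ i → (δ k i * (ε (suc i) * p (n ∸ i) (suc i)) + δ j i * (ε (suc i) * p (n ∸ i) (suc i))) +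
                                  D (suc i) (suc j) (suc k) * p (suc j ℕ.+ suc k ∸ suc i) (suc i))
          ≈⟨ +-congˡ (Σ-cong< n term) ⟩
        1# * x (suc n) + Σ< n (λ i → (ε (suc i) * p (n ∸ i) (suc i)) * (1# * quadratic (ℕ.pred n) i j)) ∎
        where
        j+k+2 : suc j ℕ.+ suc k ≡ suc n
        j+k+2 = ≡.cong suc (ℕₚ.+-suc j k)
        m∣k : m ∣ suc k
        m∣k = ∣m+n∣m⇒∣n (≡.subst (m ∣_) (≡.sym j+k+2) m∣N) m∣j
        pick-k : p (suc j) (suc k) ≈ Σ< n (λ i → δ k i * (ε (suc i) * p (n ∸ i) (suc i)))
        pick-k = sym (trans (Σ-δ n k _ (s≤s (ℕₚ.m≤n+m k j))) (trans (*-cong (ε-yes m∣k) (reflexive (≡.cong (λ t → p t (suc k)) (ℕₚ.m+n∸n≡m (suc j) k)))) (*-identityˡ _)))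
        pick-j : p (suc k) (suc j) ≈ Σ< n (λ i → δ j i * (ε (suc i) * p (n ∸ i) (suc i)))
        pick-j = sym (trans (Σ-δ n j _ (s≤s (ℕₚ.m≤m+n j k))) (trans (*-cong (ε-yes m∣j) (reflexive (≡.cong (λ t → p t (suc j)) n∸j≡1+k))) (*-identityˡ _)))
        minus : ∀ {t} → m ∣ suc t → sg t ≈ - 1#
        minus {t} d = trans (sym (-‿involutive _)) (-‿cong (trans (sym (sg-suc t)) (-1^even d)))
        term : ∀ i → i ℕ.< n → (δ k i * (ε (suc i) * p (n ∸ i) (suc i)) + δ j i * (ε (suc i) * p (n ∸ i) (suc i))) +
                                  D (suc i) (suc j) (suc k) * p (suc j ℕ.+ suc k ∸ suc i) (suc i)
             ≈ (ε (suc i) * p (n ∸ i) (suc i)) * (1# * quadratic (ℕ.pred n) i j)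
        term i i<n = begin
          (δ k i * P + δ j i * P) + D (suc i) (suc j) (suc k) * p (suc j ℕ.+ suc k ∸ suc i) (suc i)
            ≈⟨ +-cong (+-cong (*-congʳ (δ-sym k i)) (*-congʳ (δ-sym j i))) (*-cong (trans (D-in i j k (ℕₚ.<-≤-trans (s≤s i<n) (ℕₚ.≤-reflexive (≡.sym j+k+2))))
                 (*-congˡ (+-cong (*-congʳ (minus m∣j)) (*-congʳ (minus m∣k))))) (reflexive (≡.cong (λ t → p t (suc i)) (≡.cong (_∸ suc i) j+k+2)))) ⟩
          (δ i k * P + δ i j * P) + (ε (suc i) * (- 1# * natF (i C j) + - 1# * natF (i C k))) * p (n ∸ i) (suc i)
            ≈⟨ solve 6 (λ dk dj e q a b → (dk :* (e :* q) :+ dj :* (e :* q)) :+ (e :* ((:- :1) :* a :+ (:- :1) :* b)) :* q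
                  := (e :* q) :* (:1 :* ((dj :- a) :+ (dk :- b)))) refl (δ i k) (δ i j) (ε (suc i)) (p (n ∸ i) (suc i)) (natF (i C j)) (natF (i C k)) ⟩
          P * (1# * (half i j + half i k))
            ≈⟨ *-congˡ (*-congˡ (+-congˡ (reflexive (≡.cong (half i) (≡.sym (ℕₚ.m+n∸m≡n j k)))))) ⟩
          P * (1# * quadratic (ℕ.pred n) i j) ∎
          where P = ε (suc i) * p (n ∸ i) (suc i)

    -- The weight with which `x_j ⧢ x_{N ∸ j}` enters a product of two values of `W`: both indices
    -- have to be multiples of `m`.
    y : ℕ → ℕ → Carrier
    y N j = ε j * (ε (N ∸ j) * shuffle j (N ∸ j))

    y-relation : ∀ N b → m ∣ N → Σ< N (λ j → y N (suc j) * e N j (suc b)) ≈ y N 0 * alternating N (suc b)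
    y-relation zero b m∣N = trans (Σ-nil _) (sym (trans (*-congˡ (alternating-> 0 (suc b) (s≤s z≤n))) (zeroʳ _)))
    y-relation (suc n) b m∣N = trans
      (relation n (x (suc n)) (λ i → p (n ∸ i) (suc i)) (y (suc n)) b m∣N (λ j j<n → shuffle-expand n j m∣N j<n) top)
      (*-congʳ (sym (trans (trans (*-congʳ ε-0) (*-identityˡ _)) (trans (*-congʳ (ε-yes m∣N)) (*-identityˡ _)))))
      where
      top : y (suc n) (suc n) ≈ x (suc n)
      top = begin
        ε (suc n) * (ε (n ∸ n) * shuffle (suc n) (n ∸ n))   ≡⟨ ≡.cong (λ t → ε (suc n) * (ε t * shuffle (suc n) t)) (ℕₚ.n∸n≡0 n) ⟩
        ε (suc n) * (ε 0 * x (suc n))                       ≈⟨ trans (*-congʳ (ε-yes m∣N)) (trans (*-identityˡ _) (trans (*-congʳ ε-0) (*-identityˡ _))) ⟩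
        x (suc n)                                           ∎

  D-1-below′ : ∀ k i → k ℕ.< i → D k 1 i ≈ ε k
  D-1-below′ k (suc i) k<i = D-1-below k i k<i

  -- The coefficient of the letter of weight `b + c + 1 - j - k` followed by `x_j ⧢ x_k`, in
  -- `x_1 ◇ (x_b ◇ x_c)` minus `(x_1 ◇ x_b) ◇ x_c`.
  commutator : ℕ → ℕ → ℕ → ℕ → Carrier
  commutator b c j k = D j b c * D k 1 (b ℕ.+ c ∸ j) - D k 1 b * D j (suc b ∸ k) c

  -- The difference of two indicators is `ε N` when `suc b ≤ N` and zero otherwise. Writing the `1#`
  -- as the square of `sg (suc b)` brings in `alternating`.
  commutator-0 : ∀ b c N → N ℕ.< suc b ℕ.+ c → commutator (suc b) c 0 N ≈ ε N * (sg (suc b) * alternating N (suc b))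
  commutator-0 b c N N<b+c with N ℕ.<? suc b
  ... | yes N<b = begin
    1# * D N 1 (suc b ℕ.+ c) - D N 1 (suc b) * 1#   ≈⟨ +-cong (*-congˡ (D-1-below′ N _ N<b+c)) (-‿cong (*-congʳ (D-1-below N b N<b))) ⟩
    1# * ε N - ε N * 1#                             ≈⟨ solve 2 (λ e s → :1 :* e :- e :* :1 := e :* (s :* :0)) refl (ε N) (sg (suc b)) ⟩
    ε N * (sg (suc b) * 0#)                         ≈⟨ *-congˡ (*-congˡ (alternating-> N (suc b) N<b)) ⟨
    ε N * (sg (suc b) * alternating N (suc b))      ∎
  ... | no N≮b = begin
    1# * D N 1 (suc b ℕ.+ c) - D N 1 (suc b) * 1#   ≈⟨ +-cong (*-congˡ (D-1-below′ N _ N<b+c)) (-‿cong (*-congʳ (D-1-above N b (ℕₚ.≮⇒≥ N≮b)))) ⟩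
    1# * ε N - 0# * 1#                              ≈⟨ solve 1 (λ e → :1 :* e :- :0 :* :1 := e :* :1) refl (ε N) ⟩
    ε N * 1#                                        ≈⟨ *-congˡ (sg² (suc b)) ⟨
    ε N * (sg (suc b) * sg (suc b))                 ≈⟨ *-congˡ (*-congˡ (alternating-≤ N (suc b) (ℕₚ.≮⇒≥ N≮b))) ⟨
    ε N * (sg (suc b) * alternating N (suc b))      ∎

  -- The binomials belonging to `c` cancel, or vanish when `k ≥ suc b`, so `c` drops out. The sign
  -- `sg (suc b ∸ k)` may be replaced by `sg (suc b)` since `ε k` restricts to `m ∣ k`; the
  -- remaining binomials form a coefficient of `e`.
  commutator-suc : ∀ b c N j → N ℕ.< suc b ℕ.+ suc c → suc j ℕ.≤ N →
    commutator (suc b) (suc c) (suc j) (N ∸ suc j) ≈ - sg (suc b) * ((ε (suc j) * ε (N ∸ suc j)) * e N j (suc b))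
  commutator-suc b c N j N<b+c j≤N = cases (k ℕ.<? suc b)
    where
    k = N ∸ suc j
    j+k≡N : suc j ℕ.+ k ≡ N
    j+k≡N = ℕₚ.m+[n∸m]≡n j≤N
    j<b+c : suc j ℕ.< suc b ℕ.+ suc c
    j<b+c = ℕₚ.≤-<-trans j≤N N<b+c
    first : D (suc j) (suc b) (suc c) * D k 1 (suc b ℕ.+ suc c ∸ suc j) ≈ (ε (suc j) * (sg b * natF (j C b) + sg c * natF (j C c))) * ε k
    first = *-cong (D-in j b c j<b+c) (D-1-below′ k _ (ℕₚ.m+n≤o⇒m≤o∸n (suc k)
      (≡.subst (λ t → suc t ℕ.≤ suc b ℕ.+ suc c) (≡.trans (≡.sym j+k≡N) (ℕₚ.+-comm (suc j) k)) N<b+c)))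
    cases : Dec (k ℕ.< suc b) → commutator (suc b) (suc c) (suc j) k ≈ - sg (suc b) * ((ε (suc j) * ε k) * e N j (suc b))
    cases (yes k<b) = begin
      D (suc j) (suc b) (suc c) * D k 1 (suc b ℕ.+ suc c ∸ suc j) - D k 1 (suc b) * D (suc j) (suc (suc b) ∸ k) (suc c)
        ≈⟨ +-cong first (-‿cong (*-cong (D-1-below k b k<b) (trans (reflexive (≡.cong (λ t → D (suc j) t (suc c)) (ℕₚ.+-∸-assoc 1 k≤b)))
             (D-in j (suc b ∸ k) c j<)))) ⟩
      (ε (suc j) * (sg b * natF (j C b) + sg c * natF (j C c))) * ε k - ε k * (ε (suc j) * (sg (suc b ∸ k) * natF (j C (suc b ∸ k)) + sg c * natF (j C c)))
        ≈⟨ solve 8 (λ ej ek s₁ x t y s₂ w → (ej :* (s₁ :* x :+ t :* y)) :* ek :- ek :* (ej :* (s₂ :* w :+ t :* y))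
                    := s₁ :* ((ej :* ek) :* x) :- (ek :* s₂) :* (ej :* w)) refl _ _ _ _ _ _ _ _ ⟩
      sg b * ((ε (suc j) * ε k) * natF (j C b)) - (ε k * sg (suc b ∸ k)) * (ε (suc j) * natF (j C (suc b ∸ k)))
        ≈⟨ +-congˡ (-‿cong (*-congʳ (sym (trans (*-congˡ (reflexive (≡.cong sg (≡.sym (ℕₚ.m+[n∸m]≡n k≤b))))) (ε-sg k (suc b ∸ k)))))) ⟩
      sg b * ((ε (suc j) * ε k) * natF (j C b)) - (ε k * (- 1# * sg b)) * (ε (suc j) * natF (j C (suc b ∸ k)))
        ≈⟨ solve 5 (λ ej ek s x w → s :* ((ej :* ek) :* x) :- (ek :* ((:- :1) :* s)) :* (ej :* w) := (:- ((:- :1) :* s)) :* ((ej :* ek) :* (x :+ w))) refl _ _ _ _ _ ⟩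
      - sg (suc b) * ((ε (suc j) * ε k) * (natF (j C b) + natF (j C (suc b ∸ k))))
        ≈⟨ *-congˡ (*-congˡ (e-coefficient-< N j b k<b)) ⟨
      - sg (suc b) * ((ε (suc j) * ε k) * e N j (suc b)) ∎
      where
      k≤b = ℕₚ.<⇒≤ k<b
      j< : suc j ℕ.< suc (suc b ∸ k) ℕ.+ suc c
      j< = s≤s (≡.subst (suc j ℕ.≤_) (ℕₚ.+-∸-comm (suc c) k≤b)
        (ℕₚ.m+n≤o⇒m≤o∸n (suc j) (ℕₚ.≤-trans (ℕₚ.≤-reflexive j+k≡N) (ℕₚ.<⇒≤ N<b+c))))
    cases (no k≮b) = begin
      D (suc j) (suc b) (suc c) * D k 1 (suc b ℕ.+ suc c ∸ suc j) - D k 1 (suc b) * D (suc j) (suc (suc b) ∸ k) (suc c)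
        ≈⟨ +-cong first (-‿cong (*-congʳ (D-1-above k b b≤k))) ⟩
      (ε (suc j) * (sg b * natF (j C b) + sg c * natF (j C c))) * ε k - 0# * D (suc j) (suc (suc b) ∸ k) (suc c)
        ≈⟨ +-congʳ (*-congʳ (*-congˡ (+-congˡ (*-congˡ (natF-C-zero j<c))))) ⟩
      (ε (suc j) * (sg b * natF (j C b) + sg c * 0#)) * ε k - 0# * D (suc j) (suc (suc b) ∸ k) (suc c)
        ≈⟨ solve 6 (λ ej ek s x t d → (ej :* (s :* x :+ t :* :0)) :* ek :- :0 :* d := (:- ((:- :1) :* s)) :* ((ej :* ek) :* x)) refl _ _ _ _ _ _ ⟩
      - sg (suc b) * ((ε (suc j) * ε k) * natF (j C b))
        ≈⟨ *-congˡ (*-congˡ (e-coefficient-≥ N j b b≤k)) ⟨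
      - sg (suc b) * ((ε (suc j) * ε k) * e N j (suc b)) ∎
      where
      b≤k = ℕₚ.≮⇒≥ k≮b
      j<c : j ℕ.< c
      j<c = ℕₚ.≤-pred (ℕₚ.+-cancelˡ-< (suc b) (suc j) (suc c) (ℕₚ.≤-<-trans (ℕₚ.+-monoˡ-≤ (suc j) b≤k)
        (≡.subst (ℕ._< suc b ℕ.+ suc c) (≡.trans (≡.sym j+k≡N) (ℕₚ.+-comm (suc j) k)) N<b+c)))

  -- Here the leading letter would be `x_1`. Each product vanishes by itself: inside the range, the
  -- first by `D-1-above` on the diagonal and the second by `D-top`.
  commutator-top : ∀ b c j k → j ℕ.+ k ≡ suc b ℕ.+ suc c → commutator (suc b) (suc c) j k ≈ 0#
  commutator-top b c j k j+k≡n = trans (+-cong (first (j ℕ.<? n)) (trans (-‿cong (second (k ℕ.<? suc b))) -0#≈0#)) (+-identityˡ 0#)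
    where
    n = suc b ℕ.+ suc c
    first : Dec (j ℕ.< n) → D j (suc b) (suc c) * D k 1 (n ∸ j) ≈ 0#
    first (no j≮n) = trans (*-congʳ (out j (ℕₚ.≮⇒≥ j≮n))) (zeroˡ _)
      where
      out : ∀ j → n ℕ.≤ j → D j (suc b) (suc c) ≈ 0#
      out (suc j) n≤j = D-out j (suc b) (suc c) n≤j
    first (yes j<n) = trans (*-congˡ (diagonal k (n ∸ j) (ℕₚ.m<n⇒0<n∸m j<n) (≡.trans (≡.cong (_∸ j) (≡.sym j+k≡n)) (ℕₚ.m+n∸m≡n j k)))) (zeroʳ _)
      where
      diagonal : ∀ k i → 0 ℕ.< i → i ≡ k → D k 1 i ≈ 0#
      diagonal k (suc i) _ ≡.refl = D-1-above (suc i) i ℕₚ.≤-refl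
    second : Dec (k ℕ.< suc b) → D k 1 (suc b) * D j (suc (suc b) ∸ k) (suc c) ≈ 0#
    second (no k≮b) = trans (*-congʳ (D-1-above k b (ℕₚ.≮⇒≥ k≮b))) (zeroˡ _)
    second (yes k<b) = trans (*-congˡ (trans (reflexive (≡.cong₂ (λ s t → D s t (suc c)) j≡ (ℕₚ.+-∸-assoc 1 k≤b))) (D-top (suc b ∸ k) c))) (zeroʳ _)
      where
      k≤b = ℕₚ.<⇒≤ k<b
      j≡ : j ≡ (suc b ∸ k) ℕ.+ suc c
      j≡ = ≡.trans (≡.sym (ℕₚ.m+n∸n≡m j k)) (≡.trans (≡.cong (_∸ k) j+k≡n) (ℕₚ.+-∸-comm (suc c) k≤b))

  -- Here the leading letter would be `x_0`, and each product has a factor whose index is out of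
  -- range.
  commutator-over : ∀ b c j k → j ℕ.+ k ≡ suc (suc b ℕ.+ suc c) → commutator (suc b) (suc c) j k ≈ 0#
  commutator-over b c j k j+k≡n = trans (+-cong (first (j ℕ.<? n)) (trans (-‿cong (second (k ℕ.<? suc b))) -0#≈0#)) (+-identityˡ 0#)
    where
    n = suc b ℕ.+ suc c
    out : ∀ j a d → a ℕ.+ d ℕ.≤ j → 0 ℕ.< j → D j a d ≈ 0#
    out (suc j) a d n≤j _ = D-out j a d n≤j
    first : Dec (j ℕ.< n) → D j (suc b) (suc c) * D k 1 (n ∸ j) ≈ 0#
    first (no j≮n) = trans (*-congʳ (out j (suc b) (suc c) (ℕₚ.≮⇒≥ j≮n) (ℕₚ.<-≤-trans (s≤s z≤n) (ℕₚ.≮⇒≥ j≮n)))) (zeroˡ _)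
    first (yes j<n) = trans (*-congˡ (out k 1 (n ∸ j) (ℕₚ.≤-reflexive (≡.sym k≡)) (≡.subst (0 ℕ.<_) (≡.sym k≡) (s≤s z≤n)))) (zeroʳ _)
      where
      k≡ : k ≡ suc (n ∸ j)
      k≡ = ≡.trans (≡.sym (ℕₚ.m+n∸m≡n j k)) (≡.trans (≡.cong (_∸ j) j+k≡n) (ℕₚ.+-∸-assoc 1 (ℕₚ.<⇒≤ j<n)))
    second : Dec (k ℕ.< suc b) → D k 1 (suc b) * D j (suc (suc b) ∸ k) (suc c) ≈ 0#
    second (no k≮b) = trans (*-congʳ (D-1-above k b (ℕₚ.≮⇒≥ k≮b))) (zeroˡ _)
    second (yes k<b) = trans (*-congˡ (out j _ (suc c) (ℕₚ.≤-reflexive (≡.sym j≡)) (≡.subst (0 ℕ.<_) (≡.sym j≡) (ℕₚ.m≤n⇒m≤o+n (suc (suc b) ∸ k) (s≤s z≤n))))) (zeroʳ _)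
      where
      j≡ : j ≡ (suc (suc b) ∸ k) ℕ.+ suc c
      j≡ = ≡.trans (≡.sym (ℕₚ.m+n∸n≡m j k)) (≡.trans (≡.cong (_∸ k) j+k≡n) (ℕₚ.+-∸-comm (suc c) (ℕₚ.m≤n⇒m≤1+n (ℕₚ.<⇒≤ k<b))))

  module _ (x : ℕ → Carrier) (p : ℕ → ℕ → Carrier) where
    open Functional x p

    -- Up to the factor `sg (suc b)`, the term at `j = 0` and the sum of the other terms are the two
    -- sides of `y-relation`, with opposite signs.
    commutator-vanishes : ∀ b c N → N ℕ.≤ suc (suc b ℕ.+ suc c) →
      Σ< (suc N) (λ j → commutator (suc b) (suc c) j (N ∸ j) * shuffle j (N ∸ j)) ≈ 0#
    commutator-vanishes b c N N≤ with ℕₚ.m≤n⇒m<n∨m≡n N≤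
    ... | inj₂ ≡.refl = Σ-zero (suc N) (λ j j≤N → trans (*-congʳ (commutator-over b c j (N ∸ j) (ℕₚ.m+[n∸m]≡n (ℕₚ.≤-pred j≤N)))) (zeroˡ _))
    ... | inj₁ (s≤s N≤n) with ℕₚ.m≤n⇒m<n∨m≡n N≤n
    ... | inj₂ ≡.refl = Σ-zero (suc N) (λ j j≤N → trans (*-congʳ (commutator-top b c j (N ∸ j) (ℕₚ.m+[n∸m]≡n (ℕₚ.≤-pred j≤N)))) (zeroˡ _))
    ... | inj₁ N<n = begin
      Σ< (suc N) (λ j → commutator (suc b) (suc c) j (N ∸ j) * shuffle j (N ∸ j))
        ≈⟨ trans (Σ-suc N _) (+-cong
             (trans (*-congʳ (commutator-0 b (suc c) N N<n)) (trans (solve 4 (λ e s a t → (e :* (s :* a)) :* t := s :* (a :* (:1 :* (e :* t)))) refl _ _ _ _) (*-congˡ (*-congˡ (*-congʳ (sym ε-0))))))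
             (Σ-cong< N (λ j j<N → trans (*-congʳ (commutator-suc b c N j N<n j<N))
               (solve 5 (λ s ej ek g t → ((:- s) :* ((ej :* ek) :* g)) :* t := (:- s) :* ((ej :* (ek :* t)) :* g)) refl _ _ _ _ _)))) ⟩
      sg (suc b) * (alternating N (suc b) * y N 0) + Σ< N (λ j → - sg (suc b) * (y N (suc j) * e N j (suc b)))
        ≈⟨ +-congˡ (trans (Σ-*ˡ N _ _) (*-congˡ y-rel)) ⟩
      sg (suc b) * (alternating N (suc b) * y N 0) + - sg (suc b) * (y N 0 * alternating N (suc b))
        ≈⟨ solve 3 (λ s a y → s :* (a :* y) :+ (:- s) :* (y :* a) := :0) refl _ _ _ ⟩
      0# ∎
      where
      -- When `m` does not divide `N`, it cannot divide both `j` and `N ∸ j`, so all weights vanish.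
      y-zero : ∀ j → j ℕ.≤ N → ¬ (m ∣ N) → Dec (m ∣ j) → y N j ≈ 0#
      y-zero j j≤N m∤N (no m∤j) = trans (*-congʳ (ε-no m∤j)) (zeroˡ _)
      y-zero j j≤N m∤N (yes m∣j) = trans (*-congˡ (trans (*-congʳ (ε-no (λ d → m∤N (≡.subst (m ∣_) (ℕₚ.m+[n∸m]≡n j≤N) (∣m∣n⇒∣m+n m∣j d))))) (zeroˡ _))) (zeroʳ _)
      cases : Dec (m ∣ N) → Σ< N (λ j → y N (suc j) * e N j (suc b)) ≈ y N 0 * alternating N (suc b)
      cases (yes m∣N) = y-relation N b m∣N
      cases (no m∤N) = trans (Σ-zero N (λ j j<N → trans (*-congʳ (y-zero (suc j) j<N m∤N (m ∣? suc j))) (zeroˡ _)))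
                             (sym (trans (*-congʳ (y-zero 0 z≤n m∤N (m ∣? 0))) (zeroˡ _)))
      y-rel = cases (m ∣? N)

  module _ (x : ℕ → ℕ → Carrier) (p : ℕ → ℕ → ℕ → Carrier) where
    private
      y : ℕ → ℕ → ℕ → Carrier
      y i = Functional.shuffle (x i) (p i)

    -- The associativity x_1 ◇ (x_b ◇ x_c) = (x_1 ◇ x_b) ◇ x_c, tested against functionals.
    key : ∀ b c → Σ< (suc (suc b ℕ.+ suc c)) (λ j → D j (suc b) (suc c) *
            Σ< (suc (suc (suc b ℕ.+ suc c ∸ j))) (λ k → D k 1 (suc b ℕ.+ suc c ∸ j) * y (suc (suc b ℕ.+ suc c ∸ j) ∸ k) j k))
        ≈ Σ< (suc (suc (suc b))) (λ k → D k 1 (suc b) *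
            Σ< (suc ((suc (suc b) ∸ k) ℕ.+ suc c)) (λ j → D j (suc (suc b) ∸ k) (suc c) * y ((suc (suc b) ∸ k) ℕ.+ suc c ∸ j) j k))
    key b c = begin
      Σ< (suc n) (λ j → D j (suc b) (suc c) * Σ< (suc (suc (n ∸ j))) (λ k → D k 1 (n ∸ j) * y (suc (n ∸ j) ∸ k) j k))
        -- Both double sums are enlarged to the triangle `j + k ≤ suc n`; the added coefficients are
        -- zero.
        ≈⟨ sym (Σ-extend (suc n) (suc (suc n)) _ (ℕₚ.n≤1+n _) (λ i n<i → trans (*-congʳ (D-≥ i n<i)) (zeroˡ _))) ⟩
      Σ< (suc (suc n)) (λ j → D j (suc b) (suc c) * Σ< (suc (suc (n ∸ j))) (λ k → D k 1 (n ∸ j) * y (suc (n ∸ j) ∸ k) j k))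
        ≈⟨ Σ-cong (suc (suc n)) left ⟩
      Σ< (suc (suc n)) (λ j → Σ< (suc (suc n ∸ j)) (f j))
        ≈⟨ Σ-triangle (suc n) f ⟩
      Σ< (suc (suc n)) (λ s → Σ< (suc s) (λ j → f j (s ∸ j)))
        -- On the antidiagonal `j + k = s` the leading letter is fixed, hence so is the functional,
        -- and `commutator-vanishes` applies to it.
        ≈⟨ Σ-cong< (suc (suc n)) (λ s s≤n → x-y≈0⇒x≈y (trans (+-congˡ (sym (Σ-neg (suc s) _))) (trans (sym (Σ-+ (suc s) _ _)) (trans
             (Σ-cong< (suc s) (λ j j≤s → term s j (ℕₚ.≤-pred j≤s)))
             (commutator-vanishes (x (suc n ∸ s)) (p (suc n ∸ s)) b c s (ℕₚ.≤-pred s≤n)))))) ⟩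
      Σ< (suc (suc n)) (λ s → Σ< (suc s) (λ j → g j (s ∸ j)))
        ≈⟨ Σ-triangle′ (suc n) g ⟨
      Σ< (suc (suc n)) (λ k → Σ< (suc (suc n ∸ k)) (λ j → g j k))
        ≈⟨ Σ-cong (suc (suc n)) right ⟩
      Σ< (suc (suc n)) (λ k → D k 1 (suc b) * Σ< (suc ((suc (suc b) ∸ k) ℕ.+ suc c)) (λ j → D j (suc (suc b) ∸ k) (suc c) * y ((suc (suc b) ∸ k) ℕ.+ suc c ∸ j) j k))
        ≈⟨ Σ-extend (suc (suc (suc b))) (suc (suc n)) _ (s≤s (s≤s (ℕₚ.m≤m+n (suc b) (suc c)))) (λ k b<k → trans (*-congʳ (D-1-above k b (ℕₚ.<⇒≤ (ℕₚ.<⇒≤ b<k)))) (zeroˡ _)) ⟩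
      Σ< (suc (suc (suc b))) (λ k → D k 1 (suc b) * Σ< (suc ((suc (suc b) ∸ k) ℕ.+ suc c)) (λ j → D j (suc (suc b) ∸ k) (suc c) * y ((suc (suc b) ∸ k) ℕ.+ suc c ∸ j) j k)) ∎
      where
      n = suc b ℕ.+ suc c
      f g : ℕ → ℕ → Carrier
      f j k = (D j (suc b) (suc c) * D k 1 (n ∸ j)) * y (suc n ∸ j ∸ k) j k
      g j k = (D k 1 (suc b) * D j (suc (suc b) ∸ k) (suc c)) * y (suc n ∸ k ∸ j) j k
      D-≥ : ∀ j → n ℕ.< j → D j (suc b) (suc c) ≈ 0#
      D-≥ (suc j) n<j = D-out j (suc b) (suc c) (ℕₚ.<⇒≤ n<j)
      left : ∀ j → D j (suc b) (suc c) * Σ< (suc (suc (n ∸ j))) (λ k → D k 1 (n ∸ j) * y (suc (n ∸ j) ∸ k) j k) ≈ Σ< (suc (suc n ∸ j)) (f j)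
      left j with j ℕ.≤? n
      ... | yes j≤n = trans (sym (Σ-*ˡ (suc (suc (n ∸ j))) _ _)) (trans
              (Σ-cong (suc (suc (n ∸ j))) (λ k → trans (sym (*-assoc _ _ _)) (*-congˡ (reflexive (≡.cong (λ t → y (t ∸ k) j k) (≡.sym (ℕₚ.+-∸-assoc 1 j≤n)))))))
              (reflexive (≡.cong (λ t → Σ< (suc t) (f j)) (≡.sym (ℕₚ.+-∸-assoc 1 j≤n)))))
      ... | no j≰n = trans (*-congʳ (D-≥ j (ℕₚ.≰⇒> j≰n))) (trans (zeroˡ _) (sym (Σ-zero (suc (suc n ∸ j)) (λ k _ →
              trans (*-congʳ (trans (*-congʳ (D-≥ j (ℕₚ.≰⇒> j≰n))) (zeroˡ _))) (zeroˡ _)))))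
      right : ∀ k → Σ< (suc (suc n ∸ k)) (λ j → g j k) ≈
              D k 1 (suc b) * Σ< (suc ((suc (suc b) ∸ k) ℕ.+ suc c)) (λ j → D j (suc (suc b) ∸ k) (suc c) * y ((suc (suc b) ∸ k) ℕ.+ suc c ∸ j) j k)
      right k with k ℕ.≤? suc b
      ... | yes k≤b = trans (reflexive (≡.cong (λ t → Σ< (suc t) (λ j → (D k 1 (suc b) * D j (suc (suc b) ∸ k) (suc c)) * y (t ∸ j) j k)) (ℕₚ.+-∸-comm (suc c) (ℕₚ.m≤n⇒m≤1+n k≤b))))
              (trans (Σ-cong (suc ((suc (suc b) ∸ k) ℕ.+ suc c)) (λ j → *-assoc _ _ _)) (Σ-*ˡ (suc ((suc (suc b) ∸ k) ℕ.+ suc c)) _ _))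
      ... | no k≰b = trans (Σ-zero (suc (suc n ∸ k)) (λ j _ → trans (*-congʳ (trans (*-congʳ D≈0) (zeroˡ _))) (zeroˡ _)))
              (sym (trans (*-congʳ D≈0) (zeroˡ _)))
        where D≈0 = D-1-above k b (ℕₚ.<⇒≤ (ℕₚ.≰⇒> k≰b))
      term : ∀ s j → j ℕ.≤ s → f j (s ∸ j) - g j (s ∸ j) ≈ commutator (suc b) (suc c) j (s ∸ j) * y (suc n ∸ s) j (s ∸ j)
      term s j j≤s = trans (+-cong (*-congˡ (reflexive (≡.cong (λ t → y t j (s ∸ j)) index)))
                                   (-‿cong (*-congˡ (reflexive (≡.cong (λ t → y t j (s ∸ j)) index′)))))
        (solve 3 (λ a b t → a :* t :- b :* t := (a :- b) :* t) refl _ _ _)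
        where
        index : suc n ∸ j ∸ (s ∸ j) ≡ suc n ∸ s
        index = ≡.trans (ℕₚ.∸-+-assoc (suc n) j (s ∸ j)) (≡.cong (suc n ∸_) (ℕₚ.m+[n∸m]≡n j≤s))
        index′ : suc n ∸ (s ∸ j) ∸ j ≡ suc n ∸ s
        index′ = ≡.trans (ℕₚ.∸-+-assoc (suc n) (s ∸ j) j) (≡.cong (suc n ∸_) (ℕₚ.m∸n+n≡m j≤s))

-- Formal combinations as linear functionals

module Integral {c ℓ : Level} (F : CommutativeRing c ℓ) (q : ℕ) where
  open CommutativeRing F
  open Algebra.Properties.Ring ring
  open Relation.Binary.Reasoning.Setoid setoid
  open IntegerSolver F
  open Sums F
  open Construction F q

  private variable
    B B′ B₁ B₂ : Set

  opaque
    -- Combinations are compared by integrating against all g, so that linear maps respect equality for free.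
    ∫ : Lin B → (B → Carrier) → Carrier
    ∫ [] g = 0#
    ∫ ((k , b) ∷ l) g = k * g b + ∫ l g

    ∫-nil : (g : B → Carrier) → ∫ [] g ≈ 0#
    ∫-nil g = refl

    ∫-cons : ∀ k (b : B) l g → ∫ ((k , b) ∷ l) g ≈ k * g b + ∫ l g
    ∫-cons k b l g = refl

    coef-∫ : (_≟_ : DecidableEquality B) (l : Lin B) (b : B) →
             coef _≟_ l b ≈ ∫ l (λ b′ → if does (b′ ≟ b) then 1# else 0#)
    coef-∫ _≟_ [] b = refl
    coef-∫ _≟_ ((k , b′) ∷ l) b with does (b′ ≟ b)
    ... | true = +-cong (sym (*-identityʳ k)) (coef-∫ _≟_ l b)
    ... | false = trans (coef-∫ _≟_ l b) (sym (trans (+-congʳ (zeroʳ k)) (+-identityˡ _)))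

    ∫-cong : (l : Lin B) {g h : B → Carrier} → (∀ b → g b ≈ h b) → ∫ l g ≈ ∫ l h
    ∫-cong [] e = refl
    ∫-cong ((k , b) ∷ l) e = +-cong (*-congˡ (e b)) (∫-cong l e)

    ∫-cong-All : ∀ {ℓ′} {P : B → Set ℓ′} (l : Lin B) → All (λ kb → P (proj₂ kb)) l → {g h : B → Carrier} →
                 (∀ b → P b → g b ≈ h b) → ∫ l g ≈ ∫ l h
    ∫-cong-All [] [] e = refl
    ∫-cong-All ((k , b) ∷ l) (pb ∷ pl) e = +-cong (*-congˡ (e b pb)) (∫-cong-All l pl e)

    ∫-++ : (l l′ : Lin B) (g : B → Carrier) → ∫ (l ++ l′) g ≈ ∫ l g + ∫ l′ g
    ∫-++ [] l′ g = sym (+-identityˡ _)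
    ∫-++ ((k , b) ∷ l) l′ g = trans (+-congˡ (∫-++ l l′ g)) (sym (+-assoc _ _ _))

    ∫-scale : ∀ k (l : Lin B) (g : B → Carrier) → ∫ (scale k l) g ≈ k * ∫ l g
    ∫-scale k [] g = sym (zeroʳ k)
    ∫-scale k ((k′ , b) ∷ l) g = trans (+-cong (*-assoc _ _ _) (∫-scale k l g)) (sym (distribˡ _ _ _))

    ∫-ext : (f : B → Lin B′) (l : Lin B) (g : B′ → Carrier) → ∫ (ext f l) g ≈ ∫ l (λ b → ∫ (f b) g)
    ∫-ext f [] g = refl
    ∫-ext f ((k , b) ∷ l) g = trans (∫-++ (scale k (f b)) (ext f l) g) (+-cong (∫-scale k (f b) g) (∫-ext f l g))

    ∫-map : {f : Carrier × B → Carrier × B′} (h : B → B′) → (∀ k b → f (k , b) ≡ (k , h b)) →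
            (l : Lin B) (g : B′ → Carrier) → ∫ (map f l) g ≈ ∫ l (λ b → g (h b))
    ∫-map h e [] g = refl
    ∫-map h e ((k , b) ∷ l) g rewrite e k b = +-congˡ (∫-map h e l g)

    ∫-+ : (l : Lin B) (g h : B → Carrier) → ∫ l (λ b → g b + h b) ≈ ∫ l g + ∫ l h
    ∫-+ [] g h = sym (+-identityˡ 0#)
    ∫-+ ((k , b) ∷ l) g h = trans (+-congˡ (∫-+ l g h))
      (solve 5 (λ k a b x y → k :* (a :+ b) :+ (x :+ y) := (k :* a :+ x) :+ (k :* b :+ y)) refl _ _ _ _ _)

    ∫-*ˡ : (l : Lin B) (k : Carrier) (g : B → Carrier) → ∫ l (λ b → k * g b) ≈ k * ∫ l g
    ∫-*ˡ [] k g = sym (zeroʳ k)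
    ∫-*ˡ ((k′ , b) ∷ l) k g = trans (+-congˡ (∫-*ˡ l k g)) (solve 4 (λ k k′ a x → k′ :* (k :* a) :+ k :* x := k :* (k′ :* a :+ x)) refl _ _ _ _)

  ∫-0 : (l : Lin B) → ∫ l (λ _ → 0#) ≈ 0#
  ∫-0 l = trans (∫-cong l (λ _ → sym (zeroˡ 1#))) (trans (∫-*ˡ l 0# (λ _ → 1#)) (zeroˡ _))

  ∫-neg : (l : Lin B) (g : B → Carrier) → ∫ l (λ b → - g b) ≈ - ∫ l g
  ∫-neg l g = trans (∫-cong l (λ b → sym (-1*x≈-x (g b)))) (trans (∫-*ˡ l (- 1#) g) (-1*x≈-x _))

  ∫-neg-list : (l : Lin B) (g : B → Carrier) → ∫ (neg l) g ≈ - ∫ l g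
  ∫-neg-list l g = trans (∫-scale (- 1#) l g) (-1*x≈-x _)

  ∫-Σ : (l : Lin B) (n : ℕ) (f : ℕ → B → Carrier) → ∫ l (λ b → Σ< n (λ i → f i b)) ≈ Σ< n (λ i → ∫ l (f i))
  ∫-Σ l zero f = trans (trans (∫-cong l (λ b → Σ-nil _)) (∫-0 l)) (sym (Σ-nil _))
  ∫-Σ l (suc n) f = trans (trans (∫-cong l (λ b → Σ-suc n _)) (∫-+ l (f 0) _)) (trans (+-congˡ (∫-Σ l n (f ∘ suc))) (sym (Σ-suc n _)))

  ∫-swap : (l : Lin B) (l′ : Lin B′) (g : B → B′ → Carrier) →
           ∫ l (λ b → ∫ l′ (λ b′ → g b b′)) ≈ ∫ l′ (λ b′ → ∫ l (λ b → g b b′))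
  ∫-swap [] l′ g = trans (∫-nil _) (sym (trans (∫-cong l′ (λ _ → ∫-nil _)) (∫-0 l′)))
  ∫-swap ((k , b) ∷ l) l′ g = trans (∫-cons k b l _) (trans (+-cong (sym (∫-*ˡ l′ k (g b))) (∫-swap l l′ g))
    (trans (sym (∫-+ l′ _ _)) (∫-cong l′ (λ b′ → sym (∫-cons k b l _)))))

  ∫-single : ∀ (b : B) g → ∫ [ (1# , b) ] g ≈ g b
  ∫-single b g = trans (∫-cons 1# b [] g) (trans (+-cong (*-identityˡ _) (∫-nil g)) (+-identityʳ _))

  ∫-applyUpTo : ∀ n (h : ℕ → ℕ) (f : ℕ → Lin B) g → ∫ (concatMap f (applyUpTo h n)) g ≈ Σ< n (λ j → ∫ (f (h j)) g)
  ∫-applyUpTo zero h f g = trans (∫-nil g) (sym (Σ-nil _))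
  ∫-applyUpTo (suc n) h f g = trans (∫-++ (f (h 0)) _ g) (trans (+-congˡ (∫-applyUpTo n (h ∘ suc) f g)) (sym (Σ-suc n _)))

  ∫-pre : ∀ a (l : 𝔠) g → ∫ (pre a l) g ≈ ∫ l (λ w → g (a ∷ w))
  ∫-pre a = ∫-map (a ∷_) (λ _ _ → ≡.refl)

  ∫-ext₂ : (f : B₁ → B₂ → Lin B) (l₁ : Lin B₁) (l₂ : Lin B₂) (g : B → Carrier) →
           ∫ (ext₂ f l₁ l₂) g ≈ ∫ l₁ (λ b₁ → ∫ l₂ (λ b₂ → ∫ (f b₁ b₂) g))
  ∫-ext₂ f l₁ l₂ g = trans (∫-ext _ l₁ g) (∫-cong l₁ (λ b₁ → ∫-ext _ l₂ g))

  ∫-tensor : ∀ a b g → ∫ (tensor a b) g ≈ ∫ a (λ w → ∫ b (λ v → g (w , v)))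
  ∫-tensor a b g = trans (∫-ext₂ _ a b g) (∫-cong a (λ w → ∫-cong b (λ v → ∫-single (w , v) g)))

  Functional : Set → Set c
  Functional B = (B → Carrier) → Carrier

  -- `T` lies in the span of the functionals `K b` with `P b`. With `K` evaluation this bounds the
  -- words occurring in a combination; with `K` integration over `ψ p` it expresses membership in
  -- the image of `ψ`.
  Combination : (B → Functional B′) → (B → Set) → Functional B′ → Set (c ⊔ ℓ)
  Combination K P T = Σ (Lin _) (λ l → All (λ kb → P (proj₂ kb)) l × (∀ g → T g ≈ ∫ l (λ b → K b g)))

  Supported : (B → Set) → Functional B → Set (c ⊔ ℓ)
  Supported = Combination (λ b g → g b)

  module _ {K : B → Functional B′} {P : B → Set} where
    combination-cong : {T U : Functional B′} → (∀ g → T g ≈ U g) → Combination K P U → Combination K P T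
    combination-cong e (l , Pl , U≈) = l , Pl , λ g → trans (e g) (U≈ g)

    combination-0 : Combination K P (λ _ → 0#)
    combination-0 = [] , [] , λ g → sym (∫-nil _)

    combination-return : ∀ b → P b → Combination K P (K b)
    combination-return b Pb = [ (1# , b) ] , Pb ∷ [] , λ g → sym (∫-single b _)

    combination-+ : {T U : Functional B′} → Combination K P T → Combination K P U → Combination K P (λ g → T g + U g)
    combination-+ (l , Pl , T≈) (l′ , Pl′ , U≈) = l ++ l′ , Allₚ.++⁺ Pl Pl′ , λ g → trans (+-cong (T≈ g) (U≈ g)) (sym (∫-++ l l′ _))

    combination-* : ∀ k {T : Functional B′} → Combination K P T → Combination K P (λ g → k * T g)
    combination-* k (l , Pl , T≈) = scale k l , Allₚ.map⁺ Pl , λ g → trans (*-congˡ (T≈ g)) (sym (∫-scale k l _))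

    combination-Σ : ∀ n (T : ℕ → Functional B′) → (∀ i → Combination K P (T i)) → Combination K P (λ g → Σ< n (λ i → T i g))
    combination-Σ zero T s = combination-cong (λ g → Σ-nil _) combination-0
    combination-Σ (suc n) T s = combination-cong (λ g → Σ-suc n _) (combination-+ (s 0) (combination-Σ n (T ∘ suc) (s ∘ suc)))

    -- Two test functions are compared on the spanning family only. In this way validity and weight
    -- of words become available under an integral.
    combination-≈ : {T : Functional B′} → Combination K P T → ∀ {g h} → (∀ b → P b → K b g ≈ K b h) → T g ≈ T h
    combination-≈ (l , Pl , T≈) e = trans (T≈ _) (trans (∫-cong-All l Pl e) (sym (T≈ _)))

  -- Composition of linear maps: `φ` pulls a test function back, and it is enough to treat each
  -- spanning functional `K b` after this pullback.
  combination-bind : {K : B → Functional B′} {P : B → Set} {K′ : B₁ → Functional B₂} {P′ : B₁ → Set} {T : Functional B′} →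
    (φ : (B₂ → Carrier) → B′ → Carrier) → Combination K P T →
    (∀ b → P b → Combination K′ P′ (λ g → K b (φ g))) → Combination K′ P′ (λ g → T (φ g))
  combination-bind {K = K} {P = P} {K′ = K′} {P′ = P′} φ (l , Pl , T≈) s = combination-cong (λ g → T≈ _) (go l Pl)
    where
    go : ∀ l → All (λ kb → P (proj₂ kb)) l → Combination K′ P′ (λ g → ∫ l (λ b → K b (φ g)))
    go [] [] = combination-cong (λ g → ∫-nil _) combination-0
    go ((k , b) ∷ l) (pb ∷ pl) = combination-cong (λ g → ∫-cons k b l _) (combination-+ (combination-* k (s b pb)) (go l pl))

-- Shuffle, diamond and triangle products on words

module Shuffle {c ℓ : Level} (F : CommutativeRing c ℓ) (isField : IsField F)
               (m : ℕ) (card : HasCardinality F (suc m)) where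
  open CommutativeRing F
  open Algebra.Properties.Ring ring
  open Relation.Binary.Reasoning.Setoid setoid
  open IntegerSolver F
  open Sums F
  open Construction F (suc m)
  open Key F isField m card using (D; D-sym; D-out; Δcoef-0)
  open Integral F (suc m)

  letter : ℕ → Word
  letter zero = []
  letter (suc j) = [ suc j ]

  -- x_j ⧢ w, with x_0 = 1.
  T : ℕ → Word → 𝔠
  T zero w = word w
  T (suc j) w = lsh (suc j) w

  -- (x_a ◇ x_b) ▷ w
  Dia : ℕ → ℕ → Word → 𝔠
  Dia a b w = diamondPart a b (word w)

  -- The common shape of all diamond parts: `t j` stands for `x_j ⧢ s`, and with `x_0 = 1` the
  -- summand `j = 0` is the term with first letter `x_{a+b}`.
  terms : ℕ → ℕ → (ℕ → Functional Word) → Functional Word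
  terms a b t g = Σ< (suc (a ℕ.+ b)) (λ j → D j a b * t j (λ z → g (a ℕ.+ b ∸ j ∷ z)))

  Δ-sum : ∀ a b (f : ℕ → 𝔠) (t : ℕ → Functional Word) → (∀ j g → ∫ (f (suc j)) g ≈ t (suc j) g) → ∀ g →
    t 0 (λ z → g (a ℕ.+ b ∷ z)) + ∫ (concatMap (λ j → scale (Δcoef j a b) (pre (a ℕ.+ b ∸ j) (f j))) (upTo (suc (a ℕ.+ b)))) g ≈ terms a b t g
  Δ-sum a b f t f≈t g = begin
    t 0 _ + ∫ (concatMap (λ j → scale (Δcoef j a b) (pre (a ℕ.+ b ∸ j) (f j))) (upTo (suc (a ℕ.+ b)))) g
      ≈⟨ +-congˡ (trans (∫-applyUpTo (suc (a ℕ.+ b)) (λ j → j) _ g) (Σ-suc _ _)) ⟩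
    t 0 _ + (∫ (scale (Δcoef 0 a b) (pre (a ℕ.+ b) (f 0))) g + Σ< (a ℕ.+ b) (λ j → ∫ (scale (Δcoef (suc j) a b) (pre (a ℕ.+ b ∸ suc j) (f (suc j)))) g))
      -- The formal sum also has an index `j = 0`, but `Δcoef` is zero there; the summand `j = 0` of
      -- `terms` is the separate leading term.
      ≈⟨ +-cong (sym (*-identityˡ _)) (trans (+-cong (trans (∫-scale _ _ g) (trans (*-congʳ (Δcoef-0 a b)) (zeroˡ _)))
           (Σ-cong (a ℕ.+ b) (λ j → trans (∫-scale _ _ g) (*-congˡ (trans (∫-pre _ _ g) (f≈t j _)))))) (+-identityˡ _)) ⟩
    1# * t 0 _ + Σ< (a ℕ.+ b) (λ j → Δcoef (suc j) a b * t (suc j) (λ z → g (a ℕ.+ b ∸ suc j ∷ z)))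
      ≈⟨ Σ-suc (a ℕ.+ b) _ ⟨
    terms a b t g ∎

  ∫-diamondPart : ∀ a b s g → ∫ (diamondPart a b s) g ≈ ∫ s (λ w → terms a b (λ j → ∫ (T j w)) g)
  ∫-diamondPart a b s g = begin
    ∫ (diamondPart a b s) g
      ≈⟨ trans (∫-++ (pre (a ℕ.+ b) s) _ g) (+-congʳ (trans (∫-pre _ s g) (∫-cong s (λ w → sym (∫-single w _))))) ⟩
    ∫ s (λ w → ∫ (word w) (λ z → g (a ℕ.+ b ∷ z))) + ∫ (concatMap (λ j → scale (Δcoef j a b) (pre (a ℕ.+ b ∸ j) (ext (lsh j) s))) (upTo (suc (a ℕ.+ b)))) g
      ≈⟨ Δ-sum a b (λ j → ext (lsh j) s) (λ j h → ∫ s (λ w → ∫ (T j w) h)) (λ j h → ∫-ext _ s h) g ⟩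
    terms a b (λ j h → ∫ s (λ w → ∫ (T j w) h)) g
      ≈⟨ Σ-cong (suc (a ℕ.+ b)) (λ j → sym (∫-*ˡ s _ _)) ⟩
    Σ< (suc (a ℕ.+ b)) (λ j → ∫ s (λ w → D j a b * ∫ (T j w) (λ z → g (a ℕ.+ b ∸ j ∷ z))))
      ≈⟨ ∫-Σ s (suc (a ℕ.+ b)) _ ⟨
    ∫ s (λ w → terms a b (λ j → ∫ (T j w)) g) ∎

  ∫-Dia : ∀ a b w g → ∫ (Dia a b w) g ≈ terms a b (λ j → ∫ (T j w)) g
  ∫-Dia a b w g = trans (∫-diamondPart a b (word w) g) (∫-single w _)

  ∫-diamond : ∀ a b s g → ∫ (diamondPart a b s) g ≈ ∫ s (λ w → ∫ (Dia a b w) g)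
  ∫-diamond a b s g = trans (∫-diamondPart a b s g) (∫-cong s (λ w → sym (∫-Dia a b w g)))

  sh-cons : ∀ a as b bs g → ∫ (shW (a ∷ as) (b ∷ bs)) g ≈
    ∫ (shW as (b ∷ bs)) (λ w → g (a ∷ w)) + (∫ (shW (a ∷ as) bs) (λ w → g (b ∷ w)) + ∫ (shW as bs) (λ s → ∫ (Dia a b s) g))
  sh-cons a as b bs g = trans (∫-++ (pre a (shW as (b ∷ bs))) _ g) (+-cong (∫-pre a _ g)
    (trans (∫-++ (pre b (shW (a ∷ as) bs)) _ g) (+-cong (∫-pre b _ g) (∫-diamond a b (shW as bs) g))))

  sh-nilˡ : ∀ w g → ∫ (shW [] w) g ≈ g w
  sh-nilˡ w g = ∫-single w g

  sh-nilʳ : ∀ w g → ∫ (shW w []) g ≈ g w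
  sh-nilʳ [] g = ∫-single [] g
  sh-nilʳ (a ∷ as) g = ∫-single (a ∷ as) g

  lsh-cons : ∀ k b bs g → ∫ (lsh k (b ∷ bs)) g ≈ g (k ∷ b ∷ bs) + (∫ (lsh k bs) (λ w → g (b ∷ w)) + ∫ (Dia k b bs) g)
  lsh-cons k b bs g = trans (∫-++ (pre k (word (b ∷ bs))) _ g) (+-cong (trans (∫-pre k (word (b ∷ bs)) g) (∫-single _ _))
    (trans (∫-++ (pre b (lsh k bs)) _ g) (+-cong (∫-pre b _ g) (begin
      ∫ (pre (k ℕ.+ b) (word bs) ++ _) g
        ≈⟨ trans (∫-++ (pre (k ℕ.+ b) (word bs)) _ g) (+-congʳ (∫-pre _ (word bs) g)) ⟩
      ∫ (word bs) (λ z → g (k ℕ.+ b ∷ z)) + ∫ (concatMap (λ j → scale (Δcoef j k b) (pre (k ℕ.+ b ∸ j) (lsh j bs))) (upTo (suc (k ℕ.+ b)))) g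
        ≈⟨ Δ-sum k b (λ j → lsh j bs) (λ j → ∫ (T j bs)) (λ j h → refl) g ⟩
      terms k b (λ j → ∫ (T j bs)) g
        ≈⟨ ∫-Dia k b bs g ⟨
      ∫ (Dia k b bs) g ∎))))

  lsh-sh : ∀ k w g → ∫ (lsh k w) g ≈ ∫ (shW [ k ] w) g
  lsh-sh k [] g = refl
  lsh-sh k (b ∷ bs) g = trans (lsh-cons k b bs g) (sym (trans (sh-cons k [] b bs g)
    (+-cong (sh-nilˡ (b ∷ bs) _) (+-cong (sym (lsh-sh k bs _)) (sh-nilˡ bs _)))))

  T-sh : ∀ j w g → ∫ (T j w) g ≈ ∫ (shW (letter j) w) g
  T-sh zero w g = refl
  T-sh (suc j) w g = lsh-sh (suc j) w g

  Dia-sym : ∀ a b w g → ∫ (Dia a b w) g ≈ ∫ (Dia b a w) g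
  Dia-sym a b w g = trans (∫-Dia a b w g) (trans (Σ-cong (suc (a ℕ.+ b)) (λ j → *-congʳ (D-sym j a b)))
    (trans (reflexive (≡.cong (λ n → Σ< (suc n) (λ j → D j b a * ∫ (T j w) (λ z → g (n ∸ j ∷ z)))) (ℕₚ.+-comm a b))) (sym (∫-Dia b a w g))))

  sh-comm : ∀ u v g → ∫ (shW u v) g ≈ ∫ (shW v u) g
  sh-comm [] v g = trans (sh-nilˡ v g) (sym (sh-nilʳ v g))
  sh-comm (a ∷ as) [] g = trans (sh-nilʳ (a ∷ as) g) (sym (sh-nilˡ (a ∷ as) g))
  sh-comm (a ∷ as) (b ∷ bs) g = begin
    ∫ (shW (a ∷ as) (b ∷ bs)) g
      ≈⟨ sh-cons a as b bs g ⟩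
    ∫ (shW as (b ∷ bs)) _ + (∫ (shW (a ∷ as) bs) _ + ∫ (shW as bs) (λ s → ∫ (Dia a b s) g))
      ≈⟨ +-cong (sh-comm as (b ∷ bs) _) (+-cong (sh-comm (a ∷ as) bs _) (trans (sh-comm as bs _) (∫-cong (shW bs as) (λ s → Dia-sym a b s g)))) ⟩
    ∫ (shW (b ∷ bs) as) _ + (∫ (shW bs (a ∷ as)) _ + ∫ (shW bs as) (λ s → ∫ (Dia b a s) g))
      ≈⟨ solve 3 (λ x y z → x :+ (y :+ z) := y :+ (x :+ z)) refl _ _ _ ⟩
    ∫ (shW bs (a ∷ as)) _ + (∫ (shW (b ∷ bs) as) _ + ∫ (shW bs as) (λ s → ∫ (Dia b a s) g))
      ≈⟨ sh-cons b bs a as g ⟨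
    ∫ (shW (b ∷ bs) (a ∷ as)) g ∎

  tri-cons : ∀ a as v g → ∫ (triW (a ∷ as) v) g ≈ ∫ (shW as v) (λ w → g (a ∷ w))
  tri-cons a as [] g = trans (∫-single (a ∷ as) g) (sym (sh-nilʳ as _))
  tri-cons a as (b ∷ bs) g = ∫-pre a _ g

  diamond-cons : ∀ a as b bs g → ∫ (diamondW (a ∷ as) (b ∷ bs)) g ≈ ∫ (shW as bs) (λ s → ∫ (Dia a b s) g)
  diamond-cons a as b bs g = ∫-diamond a b (shW as bs) g

  data Valid : Word → Set where
    []  : Valid []
    suc : ∀ a {w} → Valid w → Valid (suc a ∷ w)

  OfWeight : ℕ → Word → Set
  OfWeight n w = Valid w × sum w ≡ n

  data NonEmpty : Word → Set where
    cons : ∀ {a w} → NonEmpty (a ∷ w)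

  sh-split : ∀ {u v} → NonEmpty u → NonEmpty v → ∀ g →
             ∫ (shW u v) g ≈ ∫ (triW u v) g + (∫ (triW v u) g + ∫ (diamondW u v) g)
  sh-split {a ∷ as} {b ∷ bs} cons cons g = trans (sh-cons a as b bs g)
    (+-cong (sym (tri-cons a as (b ∷ bs) g)) (+-cong (trans (sh-comm (a ∷ as) bs _) (sym (tri-cons b bs (a ∷ as) g))) (sym (diamond-cons a as b bs g))))

  diamond-comm : ∀ {u v} → NonEmpty u → NonEmpty v → ∀ g → ∫ (diamondW u v) g ≈ ∫ (diamondW v u) g
  diamond-comm {a ∷ as} {b ∷ bs} cons cons g = trans (diamond-cons a as b bs g)
    (trans (sh-comm as bs _) (trans (∫-cong (shW bs as) (λ s → Dia-sym a b s g)) (sym (diamond-cons b bs a as g))))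

  valid-letter : ∀ j → Valid (letter j)
  valid-letter zero = []
  valid-letter (suc j) = suc j []

  sum-letter : ∀ j → sum (letter j) ≡ j
  sum-letter zero = ≡.refl
  sum-letter (suc j) = ℕₚ.+-identityʳ (suc j)

  supported-prefix : ∀ a {n} {t : Functional Word} → Supported (OfWeight n) t →
                     Supported (OfWeight (suc a ℕ.+ n)) (λ g → t (λ w → g (suc a ∷ w)))
  supported-prefix a s = combination-bind _ s (λ { b (vb , ≡.refl) → combination-return (suc a ∷ b) (suc a vb , ≡.refl) })

  supported-weight : ∀ {n n′} {t : Functional Word} → n ≡ n′ → Supported (OfWeight n) t → Supported (OfWeight n′) t
  supported-weight ≡.refl s = s

  -- The last index `j = suc a + suc b` would put `x_0` in front; its coefficient is out of range,
  -- so only valid words remain.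
  supported-terms : ∀ a b n (t : ℕ → Functional Word) → (∀ j → Supported (OfWeight (j ℕ.+ n)) (t j)) →
                    Supported (OfWeight (suc a ℕ.+ suc b ℕ.+ n)) (terms (suc a) (suc b) t)
  supported-terms a b n t s = combination-Σ _ _ term
    where
    N = suc a ℕ.+ suc b
    term : ∀ j → Supported (OfWeight (N ℕ.+ n)) (λ g → D j (suc a) (suc b) * t j (λ z → g (N ∸ j ∷ z)))
    term zero = combination-* 1# (supported-prefix (a ℕ.+ suc b) (s 0))
    term (suc j) = cases (suc j ℕ.<? N)
      where
      nonzero : ∀ i → N ∸ suc j ≡ i → suc j ℕ.< N → Supported (OfWeight (N ℕ.+ n)) (λ g → t (suc j) (λ z → g (i ∷ z)))
      nonzero zero eq j<N = ⊥-elim (ℕₚ.<⇒≱ j<N (ℕₚ.m∸n≡0⇒m≤n eq))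
      nonzero (suc i) eq j<N = supported-weight weight (supported-prefix i (s (suc j)))
        where
        weight : suc i ℕ.+ (suc j ℕ.+ n) ≡ N ℕ.+ n
        weight = ≡.trans (≡.sym (ℕₚ.+-assoc (suc i) (suc j) n)) (≡.cong (ℕ._+ n) (≡.trans (≡.cong (ℕ._+ suc j) (≡.sym eq)) (ℕₚ.m∸n+n≡m (ℕₚ.<⇒≤ j<N))))
      cases : Dec (suc j ℕ.< N) → Supported (OfWeight (N ℕ.+ n)) (λ g → D (suc j) (suc a) (suc b) * t (suc j) (λ z → g (N ∸ suc j ∷ z)))
      cases (no j≮N) = combination-cong (λ g → trans (*-congʳ (D-out j (suc a) (suc b) (ℕₚ.≮⇒≥ j≮N))) (zeroˡ _)) combination-0
      cases (yes j<N) = combination-* _ (nonzero (N ∸ suc j) ≡.refl j<N)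

  supported-lsh : ∀ k {w} → Valid w → Supported (OfWeight (suc k ℕ.+ sum w)) (∫ (lsh (suc k) w))
  supported-T : ∀ j {w} → Valid w → Supported (OfWeight (j ℕ.+ sum w)) (∫ (T j w))
  supported-Dia : ∀ a b {w} → Valid w → Supported (OfWeight (suc a ℕ.+ suc b ℕ.+ sum w)) (∫ (Dia (suc a) (suc b) w))

  supported-lsh k [] = combination-cong (λ g → ∫-single _ g) (combination-return [ suc k ] (suc k [] , ≡.refl))
  supported-lsh k (suc b {w} vw) = combination-cong (λ g → lsh-cons (suc k) (suc b) w g)
    (combination-+ (combination-return _ (suc k (suc b vw) , ≡.refl))
    (combination-+ (supported-weight (x∙yz≈y∙xz ℕₚ.+-commutativeSemigroup (suc b) (suc k) (sum w)) (supported-prefix b (supported-lsh k vw)))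
      (supported-weight (ℕₚ.+-assoc (suc k) (suc b) (sum w)) (supported-Dia k b vw))))
  supported-T zero vw = combination-cong (λ g → ∫-single _ g) (combination-return _ (vw , ≡.refl))
  supported-T (suc j) vw = supported-lsh j vw
  supported-Dia a b {w} vw = combination-cong (λ g → ∫-Dia (suc a) (suc b) w g) (supported-terms a b (sum w) (λ j → ∫ (T j w)) (λ j → supported-T j vw))

  supported-sh : ∀ {u v} → Valid u → Valid v → Supported (OfWeight (sum u ℕ.+ sum v)) (∫ (shW u v))
  supported-sh [] vv = combination-cong (λ g → sh-nilˡ _ g) (combination-return _ (vv , ≡.refl))
  supported-sh {u} vu@(suc a va) [] = combination-cong (λ g → sh-nilʳ u g) (combination-return _ (vu , ≡.sym (ℕₚ.+-identityʳ _)))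
  supported-sh vu@(suc a {as} va) vv@(suc b {bs} vb) = combination-cong (λ g → sh-cons (suc a) as (suc b) bs g)
    (combination-+ (supported-weight (≡.sym (ℕₚ.+-assoc (suc a) (sum as) _)) (supported-prefix a (supported-sh va vv)))
    (combination-+ (supported-weight (x∙yz≈y∙xz ℕₚ.+-commutativeSemigroup (suc b) (suc a ℕ.+ sum as) (sum bs)) (supported-prefix b (supported-sh vu vb)))
      (combination-bind _ (supported-sh va vb) (λ { s (vs , weight) → supported-weight (total s weight) (supported-Dia a b vs) }))))
    where
    total : ∀ s → sum s ≡ sum as ℕ.+ sum bs → (suc a ℕ.+ suc b) ℕ.+ sum s ≡ (suc a ℕ.+ sum as) ℕ.+ (suc b ℕ.+ sum bs)
    total s weight = ≡.trans (≡.cong (suc a ℕ.+ suc b ℕ.+_) weight) (interchange ℕₚ.+-commutativeSemigroup (suc a) (suc b) (sum as) (sum bs))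

-- The quasi-shuffle algebra of compositions

module QuasiShuffle {c ℓ : Level} (F : CommutativeRing c ℓ) (q : ℕ) where
  open CommutativeRing F
  open Relation.Binary.Reasoning.Setoid setoid
  open IntegerSolver F
  open Construction F q
  open Integral F q

  -- In the quasi-shuffle algebra the letter n has weight n + 1.
  weight : Word → ℕ
  weight [] = 0
  weight (n ∷ p) = suc n ℕ.+ weight p

  quasi : Word → Word → 𝔠
  quasi [] r = word r
  quasi (n ∷ p) [] = word (n ∷ p)
  quasi (n ∷ p) (k ∷ r) = pre n (quasi p (k ∷ r)) ++ (pre k (quasi (n ∷ p) r) ++ pre (suc (n ℕ.+ k)) (quasi p r))

  quasi-cons : ∀ n p k r g → ∫ (quasi (n ∷ p) (k ∷ r)) g ≈
    ∫ (quasi p (k ∷ r)) (λ w → g (n ∷ w)) + (∫ (quasi (n ∷ p) r) (λ w → g (k ∷ w)) + ∫ (quasi p r) (λ w → g (suc (n ℕ.+ k) ∷ w)))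
  quasi-cons n p k r g = trans (∫-++ (pre n (quasi p (k ∷ r))) _ g) (+-cong (∫-pre n _ g)
    (trans (∫-++ (pre k (quasi (n ∷ p) r)) _ g) (+-cong (∫-pre k _ g) (∫-pre _ _ g))))

  quasi-nilʳ : ∀ p g → ∫ (quasi p []) g ≈ g p
  quasi-nilʳ [] g = ∫-single [] g
  quasi-nilʳ (n ∷ p) g = ∫-single (n ∷ p) g

  OfWeightQ : ℕ → Word → Set
  OfWeightQ n p = weight p ≡ n

  supported-prefixQ : ∀ n {k} {t : Functional Word} → Supported (OfWeightQ k) t →
                      Supported (OfWeightQ (suc n ℕ.+ k)) (λ g → t (λ w → g (n ∷ w)))
  supported-prefixQ n s = combination-bind _ s (λ { p ≡.refl → combination-return (n ∷ p) ≡.refl })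

  supported-weightQ : ∀ {n n′} {t : Functional Word} → n ≡ n′ → Supported (OfWeightQ n) t → Supported (OfWeightQ n′) t
  supported-weightQ ≡.refl s = s

  supported-quasi : ∀ p r → Supported (OfWeightQ (weight p ℕ.+ weight r)) (∫ (quasi p r))
  supported-quasi [] r = combination-cong (λ g → ∫-single r g) (combination-return r ≡.refl)
  supported-quasi (n ∷ p) [] = combination-cong (λ g → ∫-single (n ∷ p) g) (combination-return (n ∷ p) (≡.sym (ℕₚ.+-identityʳ _)))
  supported-quasi (n ∷ p) (k ∷ r) = combination-cong (λ g → quasi-cons n p k r g)
    (combination-+ (supported-weightQ (≡.sym (ℕₚ.+-assoc (suc n) (weight p) _)) (supported-prefixQ n (supported-quasi p (k ∷ r))))
    (combination-+ (supported-weightQ (x∙yz≈y∙xz ℕₚ.+-commutativeSemigroup (suc k) (suc n ℕ.+ weight p) (weight r)) (supported-prefixQ k (supported-quasi (n ∷ p) r)))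
      (supported-weightQ (≡.trans (≡.cong (λ t → suc (t ℕ.+ (weight p ℕ.+ weight r))) (≡.sym (ℕₚ.+-suc n k))) (interchange ℕₚ.+-commutativeSemigroup (suc n) (suc k) (weight p) (weight r)))
        (supported-prefixQ (suc (n ℕ.+ k)) (supported-quasi p r)))))

  -- Terms are sorted by the nonempty set of first letters that merge into the new first letter,
  -- which gives seven kinds. Expansion yields nine terms on each side: the terms led by `l` alone
  -- on the left, and by `n` alone on the right, are split in three and have to be reassembled by
  -- `quasi-cons`.
  quasi-assoc : ∀ p r t g → ∫ (quasi p r) (λ w → ∫ (quasi w t) g) ≈ ∫ (quasi r t) (λ w → ∫ (quasi p w) g)
  quasi-assoc [] r t g = trans (∫-single r _) (∫-cong (quasi r t) (λ w → sym (∫-single w g)))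
  quasi-assoc (n ∷ p) [] t g = trans (∫-single (n ∷ p) _) (sym (∫-single t _))
  quasi-assoc (n ∷ p) (k ∷ r) [] g = trans (∫-cong (quasi (n ∷ p) (k ∷ r)) (λ w → quasi-nilʳ w g)) (sym (∫-single (k ∷ r) _))
  quasi-assoc P@(n ∷ p) R@(k ∷ r) T@(l ∷ t) g = begin
    ∫ (quasi P R) (λ w → ∫ (quasi w T) g)
      ≈⟨ quasi-cons n p k r _ ⟩
    ∫ (quasi p R) (λ w → ∫ (quasi (n ∷ w) T) g) + (∫ (quasi P r) (λ w → ∫ (quasi (k ∷ w) T) g) + ∫ (quasi p r) (λ w → ∫ (quasi (suc (n ℕ.+ k) ∷ w) T) g))
      ≈⟨ +-cong (left (quasi p R) n) (+-cong (left (quasi P r) k) (left (quasi p r) (suc (n ℕ.+ k)))) ⟩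
    (a₁ + (b₁ + c₁)) + ((a₂ + (b₂ + c₂)) + (a₃ + (b₃ + c₃)))
      ≈⟨ solve 9 (λ a₁ b₁ c₁ a₂ b₂ c₂ a₃ b₃ c₃ → (a₁ :+ (b₁ :+ c₁)) :+ ((a₂ :+ (b₂ :+ c₂)) :+ (a₃ :+ (b₃ :+ c₃)))
           := a₁ :+ (a₂ :+ ((b₁ :+ (b₂ :+ b₃)) :+ (a₃ :+ (c₁ :+ (c₂ :+ c₃)))))) refl a₁ b₁ c₁ a₂ b₂ c₂ a₃ b₃ c₃ ⟩
    a₁ + (a₂ + ((b₁ + (b₂ + b₃)) + (a₃ + (c₁ + (c₂ + c₃)))))
      ≈⟨ +-cong (quasi-assoc p R T _) (+-cong (quasi-assoc P r T _) (+-cong (trans (sym (quasi-cons n p k r _)) (quasi-assoc P R t _))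
           (+-cong (quasi-assoc p r T _) (+-cong (quasi-assoc p R t _) (+-cong (quasi-assoc P r t _)
             (trans (quasi-assoc p r t _) (∫-cong (quasi r t) (λ w → ∫-cong (quasi p w) (λ z → reflexive (≡.cong (λ i → g (i ∷ z)) index)))))))))) ⟩
    d₁ + (e₂ + (e₁ + (f₁ + (f₂ + (e₃ + f₃)))))
      ≈⟨ +-congʳ (quasi-cons k r l t _) ⟩
    (d₂ + (d₃ + d₄)) + (e₂ + (e₁ + (f₁ + (f₂ + (e₃ + f₃)))))
      ≈⟨ solve 9 (λ d₂ d₃ d₄ e₁ e₂ e₃ f₁ f₂ f₃ → (d₂ :+ (d₃ :+ d₄)) :+ (e₂ :+ (e₁ :+ (f₁ :+ (f₂ :+ (e₃ :+ f₃)))))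
           := (d₂ :+ (e₂ :+ f₁)) :+ ((d₃ :+ (e₁ :+ f₂)) :+ (d₄ :+ (e₃ :+ f₃)))) refl d₂ d₃ d₄ e₁ e₂ e₃ f₁ f₂ f₃ ⟩
    (d₂ + (e₂ + f₁)) + ((d₃ + (e₁ + f₂)) + (d₄ + (e₃ + f₃)))
      ≈⟨ +-cong (right (quasi r T) k) (+-cong (right (quasi R t) l) (right (quasi r t) (suc (k ℕ.+ l)))) ⟨
    ∫ (quasi r T) (λ w → ∫ (quasi P (k ∷ w)) g) + (∫ (quasi R t) (λ w → ∫ (quasi P (l ∷ w)) g) + ∫ (quasi r t) (λ w → ∫ (quasi P (suc (k ℕ.+ l) ∷ w)) g))
      ≈⟨ quasi-cons k r l t _ ⟨
    ∫ (quasi R T) (λ w → ∫ (quasi P w) g) ∎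
    where
    index : suc (suc (n ℕ.+ k) ℕ.+ l) ≡ suc (n ℕ.+ suc (k ℕ.+ l))
    index = ≡.cong suc (≡.trans (≡.cong suc (ℕₚ.+-assoc n k l)) (≡.sym (ℕₚ.+-suc n (k ℕ.+ l))))
    A B E : 𝔠 → ℕ → Carrier
    A s i = ∫ s (λ w → ∫ (quasi w T) (λ z → g (i ∷ z)))
    B s i = ∫ s (λ w → ∫ (quasi (i ∷ w) t) (λ z → g (l ∷ z)))
    E s i = ∫ s (λ w → ∫ (quasi w t) (λ z → g (suc (i ℕ.+ l) ∷ z)))
    left : ∀ s i → ∫ s (λ w → ∫ (quasi (i ∷ w) T) g) ≈ A s i + (B s i + E s i)
    left s i = trans (∫-cong s (λ w → quasi-cons i w l t g)) (trans (∫-+ s _ _) (+-congˡ (∫-+ s _ _)))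
    A′ B′ C′ : 𝔠 → ℕ → Carrier
    A′ s i = ∫ s (λ w → ∫ (quasi p (i ∷ w)) (λ z → g (n ∷ z)))
    B′ s i = ∫ s (λ w → ∫ (quasi P w) (λ z → g (i ∷ z)))
    C′ s i = ∫ s (λ w → ∫ (quasi p w) (λ z → g (suc (n ℕ.+ i) ∷ z)))
    right : ∀ s i → ∫ s (λ w → ∫ (quasi P (i ∷ w)) g) ≈ A′ s i + (B′ s i + C′ s i)
    right s i = trans (∫-cong s (λ w → quasi-cons n p i w g)) (trans (∫-+ s _ _) (+-congˡ (∫-+ s _ _)))
    a₁ = A (quasi p R) n
    b₁ = B (quasi p R) n
    c₁ = E (quasi p R) n
    a₂ = A (quasi P r) k
    b₂ = B (quasi P r) k
    c₂ = E (quasi P r) k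
    a₃ = A (quasi p r) (suc (n ℕ.+ k))
    b₃ = B (quasi p r) (suc (n ℕ.+ k))
    c₃ = E (quasi p r) (suc (n ℕ.+ k))
    d₁ = ∫ (quasi R T) (λ w → ∫ (quasi p w) (λ z → g (n ∷ z)))
    d₂ = A′ (quasi r T) k
    d₃ = A′ (quasi R t) l
    d₄ = A′ (quasi r t) (suc (k ℕ.+ l))
    e₂ = B′ (quasi r T) k
    e₁ = B′ (quasi R t) l
    e₃ = B′ (quasi r t) (suc (k ℕ.+ l))
    f₁ = C′ (quasi r T) k
    f₂ = C′ (quasi R t) l
    f₃ = C′ (quasi r t) (suc (k ℕ.+ l))

-- The map `ψ` and associativity of the shuffle

module Presentation {c ℓ : Level} (F : CommutativeRing c ℓ) (isField : IsField F)
                    (m : ℕ) (card : HasCardinality F (suc m)) where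
  open CommutativeRing F
  open Algebra.Properties.Ring ring
  open Relation.Binary.Reasoning.Setoid setoid
  open IntegerSolver F
  open Sums F
  open Construction F (suc m)
  open Key F isField m card using (D; D-out; key; module Functional)
  open Integral F (suc m)
  open Shuffle F isField m card
  open QuasiShuffle F (suc m)

  -- w ↦ x_1 ◇ w, extended by 0 to the empty word.
  L : Word → 𝔠
  L [] = []
  L (b ∷ v) = Dia 1 b v

  LP : ℕ → Word → 𝔠
  LP zero w = word (1 ∷ w)
  LP (suc n) w = ext L (LP n w)

  ψ : Word → 𝔠
  ψ [] = one
  ψ (n ∷ p) = ext (LP n) (ψ p)

  LP-suc : ∀ n w g → ∫ (LP (suc n) w) g ≈ ∫ (LP n w) (λ w′ → ∫ (L w′) g)
  LP-suc n w g = ∫-ext L (LP n w) g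

  ψ-cons : ∀ n p g → ∫ (ψ (n ∷ p)) g ≈ ∫ (ψ p) (λ w → ∫ (LP n w) g)
  ψ-cons n p g = ∫-ext (LP n) (ψ p) g

  ψ-suc : ∀ n p g → ∫ (ψ (suc n ∷ p)) g ≈ ∫ (ψ (n ∷ p)) (λ w → ∫ (L w) g)
  ψ-suc n p g = trans (ψ-cons (suc n) p g) (trans (∫-cong (ψ p) (λ w → LP-suc n w g)) (sym (ψ-cons n p _)))

  supported-L : ∀ {y} → Valid y → Supported (OfWeight (suc (sum y))) (∫ (L y))
  supported-L [] = combination-cong (λ g → ∫-nil g) combination-0
  supported-L (suc b vw) = supported-Dia 0 b vw

  supported-LP : ∀ n {w} → Valid w → Supported (OfWeight (suc n ℕ.+ sum w)) (∫ (LP n w))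
  supported-LP zero vw = combination-cong (λ g → ∫-single _ g) (combination-return _ (suc 0 vw , ≡.refl))
  supported-LP (suc n) {w} vw = combination-cong (λ g → LP-suc n w g)
    (combination-bind _ (supported-LP n vw) (λ { w′ (vw′ , eq) → supported-weight (≡.cong suc eq) (supported-L vw′) }))

  supported-ψ : ∀ p → Supported (OfWeight (weight p)) (∫ (ψ p))
  supported-ψ [] = combination-cong (λ g → ∫-single [] g) (combination-return [] ([] , ≡.refl))
  supported-ψ (n ∷ p) = combination-cong (λ g → ψ-cons n p g)
    (combination-bind _ (supported-ψ p) (λ { w (vw , eq) → supported-weight (≡.cong (suc n ℕ.+_) eq) (supported-LP n vw) }))

  nonEmpty : ∀ {n w} → OfWeight (suc n) w → NonEmpty w
  nonEmpty ([] , ())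
  nonEmpty (suc a vw , _) = cons

  Image : ℕ → Functional Word → Set (c ⊔ ℓ)
  Image n = Combination (λ p → ∫ (ψ p)) (OfWeightQ n)

  -- The outer induction is on weight, the inner one on the first letter. The leading term
  -- `L (suc b ∷ v)` is reached from a word of smaller weight, because `L` sends `ψ (i ∷ p)` to
  -- `ψ (suc i ∷ p)`; the terms subtracted have the same weight and a smaller first letter.
  image : ∀ n u → Valid u → sum u ≡ n → Image n (λ g → g u)
  image = <-rec (λ n → ∀ u → Valid u → sum u ≡ n → Image n (λ g → g u)) step
    where
    step : ∀ n → (∀ {k} → k ℕ.< n → ∀ u → Valid u → sum u ≡ k → Image k (λ g → g u)) → ∀ u → Valid u → sum u ≡ n → Image n (λ g → g u)
    step n below .[] [] ≡.refl = combination-cong (λ g → sym (∫-single [] g)) (combination-return [] ≡.refl)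
    step n below .(suc a ∷ v) (suc a {v} vv) eq = by-letter (suc a) a (ℕₚ.n<1+n a) v vv eq
      where
      -- The bound `k` carries the inner induction, since the tail `v` changes together with the
      -- first letter.
      by-letter : ∀ k a → a ℕ.< k → ∀ v → Valid v → suc a ℕ.+ sum v ≡ n → Image n (λ g → g (suc a ∷ v))
      by-letter (suc k) zero a<k v vv ≡.refl = combination-bind (λ g w → g (1 ∷ w)) (below (ℕₚ.n<1+n (sum v)) v vv ≡.refl)
        (λ p eq → combination-cong (λ g → trans (∫-cong (ψ p) (λ w → sym (∫-single (1 ∷ w) g))) (sym (ψ-cons 0 p g))) (combination-return (0 ∷ p) (≡.cong suc eq)))
      by-letter (suc k) (suc b) (s≤s b<k) v vv ≡.refl = combination-cong
        (λ g → trans (solve 2 (λ x s → x := (:1 :* x :+ s) :+ (:- :1) :* s) refl (g (suc (suc b) ∷ v)) (tail g))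
          (+-congʳ (trans (+-congʳ (*-congˡ (sym (∫-single v _)))) (trans (sym (Σ-suc _ _)) (sym (∫-Dia 1 (suc b) v g))))))
        (combination-+ leading (combination-* (- 1#) (combination-Σ _ _ lower)))
        where
        tail : Functional Word
        tail g = Σ< (suc (suc b)) (λ j → D (suc j) 1 (suc b) * ∫ (T (suc j) v) (λ z → g (suc b ∸ j ∷ z)))
        leading : Image n (∫ (L (suc b ∷ v)))
        leading = combination-bind (λ g w → ∫ (L w) g) (below (ℕₚ.n<1+n (suc b ℕ.+ sum v)) (suc b ∷ v) (suc b vv) ≡.refl)
          (λ { [] () ; (i ∷ p) eq → combination-cong (λ g → sym (ψ-suc i p g)) (combination-return (suc i ∷ p) (≡.cong suc eq)) })
        lower : ∀ j → Image n (λ g → D (suc j) 1 (suc b) * ∫ (T (suc j) v) (λ z → g (suc b ∸ j ∷ z)))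
        lower j = cases (suc j ℕ.<? suc (suc b))
          where
          nonzero : ∀ i → suc b ∸ j ≡ i → suc j ℕ.< suc (suc b) → Image n (λ g → ∫ (T (suc j) v) (λ z → g (i ∷ z)))
          nonzero zero eq j<b = ⊥-elim (ℕₚ.<⇒≱ j<b (s≤s (ℕₚ.m∸n≡0⇒m≤n eq)))
          nonzero (suc i) eq j<b = combination-bind _ (supported-T (suc j) vv) (λ { z (vz , weight-z) → by-letter k i
              (ℕₚ.≤-trans (≡.subst (ℕ._≤ suc b) eq (ℕₚ.m∸n≤m (suc b) j)) b<k) z vz
              (≡.trans (≡.cong (suc i ℕ.+_) weight-z) (≡.trans (≡.sym (ℕₚ.+-assoc (suc i) (suc j) (sum v)))
                (≡.cong (ℕ._+ sum v) (≡.trans (≡.cong (ℕ._+ suc j) (≡.sym eq)) (≡.trans (ℕₚ.+-suc (suc b ∸ j) j) (≡.cong suc (ℕₚ.m∸n+n≡m (ℕₚ.<⇒≤ (ℕₚ.≤-pred j<b)))))))))  })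
          cases : Dec (suc j ℕ.< suc (suc b)) → Image n (λ g → D (suc j) 1 (suc b) * ∫ (T (suc j) v) (λ z → g (suc b ∸ j ∷ z)))
          cases (no j≮b) = combination-cong (λ g → trans (*-congʳ (D-out j 1 (suc b) (ℕₚ.≮⇒≥ j≮b))) (zeroˡ _)) combination-0
          cases (yes j<b) = combination-* _ (nonzero (suc b ∸ j) ≡.refl j<b)

  image-≈ : ∀ u → Valid u → (g h : Word → Carrier) → (∀ p → weight p ≡ sum u → ∫ (ψ p) g ≈ ∫ (ψ p) h) → g u ≈ h u
  image-≈ u vu g h e = combination-≈ (image (sum u) u vu ≡.refl) e

  Assoc : Word → Word → Word → Set (c ⊔ ℓ)
  Assoc u v w = ∀ g → ∫ (shW u v) (λ z → ∫ (shW z w) g) ≈ ∫ (shW v w) (λ z → ∫ (shW u z) g)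

  ∫T-letters : ∀ j k (f : Word → Carrier) →
    ∫ (T j (letter k)) f ≈ Functional.shuffle (λ n → f (letter n)) (λ i j → f (i ∷ j ∷ [])) j k
  ∫T-letters zero k f = ∫-single _ f
  ∫T-letters (suc j) zero f = ∫-single _ f
  ∫T-letters (suc j) (suc k) f = trans (lsh-cons (suc j) (suc k) [] f) (+-congˡ (+-cong (∫-single _ _)
    (trans (∫-Dia (suc j) (suc k) [] f) (Σ-cong (suc (suc j ℕ.+ suc k)) (λ { zero → *-congˡ (∫-single _ _) ; (suc i) → *-congˡ (∫-single _ _) })))))

  -- Values are compared only where the coefficient can be nonzero; the bound on `j` then supplies
  -- the weight estimates for the induction.
  D-cong-≤ : ∀ j a b {x y : Carrier} → 0 ℕ.< a ℕ.+ b → (j ℕ.< a ℕ.+ b → x ≈ y) → D j a b * x ≈ D j a b * y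
  D-cong-≤ zero a b 0<n e = *-congˡ (e 0<n)
  D-cong-≤ (suc j) a b {x} {y} _ e = cases (suc j ℕ.<? a ℕ.+ b)
    where
    cases : Dec (suc j ℕ.< a ℕ.+ b) → D (suc j) a b * x ≈ D (suc j) a b * y
    cases (yes j<n) = *-congˡ (e j<n)
    cases (no j≮n) = trans (trans (*-congʳ (D-out j a b (ℕₚ.≮⇒≥ j≮n))) (zeroˡ _)) (sym (trans (*-congʳ (D-out j a b (ℕₚ.≮⇒≥ j≮n))) (zeroˡ _)))

  -- Associativity is assumed for total weight below `N` and proved up to `N`; each statement inside
  -- carries a bound of its own total weight by `N`.
  module Step (N : ℕ) (assoc : ∀ u v w → Valid u → Valid v → Valid w → sum u ℕ.+ (sum v ℕ.+ sum w) ℕ.< N → Assoc u v w) where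

    assoc-T : ∀ j y z → Valid y → Valid z → j ℕ.+ (sum y ℕ.+ sum z) ℕ.< N → ∀ g →
              ∫ (T j y) (λ w → ∫ (shW w z) g) ≈ ∫ (shW y z) (λ s → ∫ (T j s) g)
    assoc-T j y z vy vz below g = trans (T-sh j y _) (trans
      (assoc (letter j) y z (valid-letter j) vy vz (≡.subst (λ t → t ℕ.+ _ ℕ.< N) (≡.sym (sum-letter j)) below) g)
      (∫-cong (shW y z) (λ s → sym (T-sh j s g))))

    T-T : ∀ j k s → Valid s → j ℕ.+ (k ℕ.+ sum s) ℕ.< N → ∀ g →
          ∫ (T k s) (λ s′ → ∫ (T j s′) g) ≈ ∫ (T j (letter k)) (λ z → ∫ (shW z s) g)
    T-T j k s vs below g = trans (T-sh k s _) (sym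
      (assoc-T j (letter k) s (valid-letter k) vs (≡.subst (λ t → j ℕ.+ (t ℕ.+ sum s) ℕ.< N) (≡.sym (sum-letter k)) below) g))

    T-letter-comm : ∀ j k g → ∫ (T k (letter j)) g ≈ ∫ (T j (letter k)) g
    T-letter-comm j k g = trans (T-sh k (letter j) g) (trans (sh-comm (letter k) (letter j) g) (sym (T-sh j (letter k) g)))

    -- Both sides put the same letters in front of `x_j ⧢ y ⧢ z`, bracketed differently. The letter
    -- in front has weight at least one, so associativity is used below `N`.
    L-tri : ∀ y z → Valid y → NonEmpty y → Valid z → suc (sum y ℕ.+ sum z) ℕ.≤ N → ∀ g →
            ∫ (L y) (λ w → ∫ (triW w z) g) ≈ ∫ (triW y z) (λ w → ∫ (L w) g)
    L-tri .(suc a ∷ y) z (suc a {y} vy) cons vz below g = begin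
      ∫ (Dia 1 (suc a) y) (λ w → ∫ (triW w z) g)
        ≈⟨ ∫-Dia 1 (suc a) y _ ⟩
      Σ< (suc (suc (suc a))) (λ j → D j 1 (suc a) * ∫ (T j y) (λ s → ∫ (triW (suc (suc a) ∸ j ∷ s) z) g))
        ≈⟨ Σ-cong (suc (suc (suc a))) (λ j → trans (*-congˡ (∫-cong (T j y) (λ s → tri-cons (suc (suc a) ∸ j) s z g)))
             (trans (D-cong-≤ j 1 (suc a) (s≤s z≤n) (λ j≤a → assoc-T j y z vy vz (bound j j≤a) _)) (sym (∫-*ˡ (shW y z) _ _)))) ⟩
      Σ< (suc (suc (suc a))) (λ j → ∫ (shW y z) (λ s → D j 1 (suc a) * ∫ (T j s) (λ w → g (suc (suc a) ∸ j ∷ w))))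
        ≈⟨ ∫-Σ (shW y z) _ _ ⟨
      ∫ (shW y z) (λ s → terms 1 (suc a) (λ j → ∫ (T j s)) g)
        ≈⟨ ∫-cong (shW y z) (λ s → ∫-Dia 1 (suc a) s g) ⟨
      ∫ (shW y z) (λ s → ∫ (L (suc a ∷ s)) g)
        ≈⟨ tri-cons (suc a) y z _ ⟨
      ∫ (triW (suc a ∷ y) z) (λ w → ∫ (L w) g) ∎
      where
      bound : ∀ j → j ℕ.< suc (suc a) → j ℕ.+ (sum y ℕ.+ sum z) ℕ.< N
      bound j (s≤s j≤a) = ℕₚ.<-≤-trans (s≤s (ℕₚ.+-monoˡ-≤ _ j≤a)) (ℕₚ.≤-trans (ℕₚ.≤-reflexive (≡.cong suc (≡.sym (ℕₚ.+-assoc (suc a) (sum y) (sum z))))) below)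

    -- The tails enter only through their shuffle: associativity in smaller weight replaces them by
    -- the words `s` of `y ⧢ z`. What is left concerns letters, and is `key` for the functionals
    -- that shuffle a word with `s` and put a letter `i` in front.
    L-diamond : ∀ y z → Valid y → NonEmpty y → Valid z → NonEmpty z → suc (sum y ℕ.+ sum z) ℕ.≤ N → ∀ g →
                ∫ (L y) (λ w → ∫ (diamondW w z) g) ≈ ∫ (diamondW y z) (λ w → ∫ (L w) g)
    L-diamond .(suc b ∷ y) .(suc d ∷ z) (suc b {y} vy) cons (suc d {z} vz) cons below g = begin
      ∫ (Dia 1 (suc b) y) (λ w → ∫ (diamondW w (suc d ∷ z)) g)
        ≈⟨ ∫-Dia 1 (suc b) y _ ⟩
      Σ< (suc (suc (suc b))) (λ k → D k 1 (suc b) * ∫ (T k y) (λ v → ∫ (diamondW (suc (suc b) ∸ k ∷ v) (suc d ∷ z)) g))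
        ≈⟨ Σ-cong (suc (suc (suc b))) (λ k → trans (*-congˡ (∫-cong (T k y) (λ v → diamond-cons (suc (suc b) ∸ k) v (suc d) z g)))
             (trans (D-cong-≤ k 1 (suc b) (s≤s z≤n) (λ k≤b → assoc-T k y z vy vz (bound k k≤b) _)) (sym (∫-*ˡ (shW y z) _ _)))) ⟩
      Σ< (suc (suc (suc b))) (λ k → ∫ (shW y z) (λ s → D k 1 (suc b) * ∫ (T k s) (λ s′ → ∫ (Dia (suc (suc b) ∸ k) (suc d) s′) g)))
        ≈⟨ ∫-Σ (shW y z) _ _ ⟨
      ∫ (shW y z) (λ s → Σ< (suc (suc (suc b))) (λ k → D k 1 (suc b) * ∫ (T k s) (λ s′ → ∫ (Dia (suc (suc b) ∸ k) (suc d) s′) g)))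
        ≈⟨ combination-≈ (supported-sh vy vz) (λ { s (vs , weight-s) → pointwise s vs (bound′ s weight-s) }) ⟩
      ∫ (shW y z) (λ s → ∫ (Dia (suc b) (suc d) s) (λ w → ∫ (L w) g))
        ≈⟨ diamond-cons (suc b) y (suc d) z _ ⟨
      ∫ (diamondW (suc b ∷ y) (suc d ∷ z)) (λ w → ∫ (L w) g) ∎
      where
      n = suc b ℕ.+ suc d
      bound : ∀ k → k ℕ.< suc (suc b) → k ℕ.+ (sum y ℕ.+ sum z) ℕ.< N
      bound k (s≤s k≤b) = ℕₚ.<-≤-trans (s≤s (ℕₚ.+-mono-≤ k≤b (ℕₚ.+-monoʳ-≤ (sum y) (ℕₚ.m≤n+m (sum z) (suc d)))))
        (ℕₚ.≤-trans (ℕₚ.≤-reflexive (≡.cong suc (≡.sym (ℕₚ.+-assoc (suc b) (sum y) _)))) below)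
      bound′ : ∀ s → sum s ≡ sum y ℕ.+ sum z → n ℕ.+ sum s ℕ.< N
      bound′ s eq = ℕₚ.≤-trans (ℕₚ.≤-reflexive (≡.cong suc (≡.trans (≡.cong (n ℕ.+_) eq) (interchange ℕₚ.+-commutativeSemigroup (suc b) (suc d) (sum y) (sum z))))) below
      pointwise : ∀ s → Valid s → n ℕ.+ sum s ℕ.< N →
        Σ< (suc (suc (suc b))) (λ k → D k 1 (suc b) * ∫ (T k s) (λ s′ → ∫ (Dia (suc (suc b) ∸ k) (suc d) s′) g)) ≈
        ∫ (Dia (suc b) (suc d) s) (λ w → ∫ (L w) g)
      pointwise s vs below-s = begin
        Σ< (suc (suc (suc b))) (λ k → D k 1 (suc b) * ∫ (T k s) (λ s′ → ∫ (Dia (i k) (suc d) s′) g))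
          ≈⟨ Σ-cong (suc (suc (suc b))) (λ k → D-cong-≤ k 1 (suc b) (s≤s z≤n) (left k)) ⟩
        Σ< (suc (suc (suc b))) (λ k → D k 1 (suc b) * Σ< (suc (i k ℕ.+ suc d)) (λ j → D j (i k) (suc d) * y′ (i k ℕ.+ suc d ∸ j) j k))
          ≈⟨ key (λ i n → f i (letter n)) (λ i n n′ → f i (n ∷ n′ ∷ [])) b d ⟨
        Σ< (suc n) (λ j → D j (suc b) (suc d) * Σ< (suc (suc (n ∸ j))) (λ k → D k 1 (n ∸ j) * y′ (suc (n ∸ j) ∸ k) j k))
          ≈⟨ Σ-cong (suc n) (λ j → D-cong-≤ j (suc b) (suc d) (s≤s z≤n) (right j)) ⟨
        Σ< (suc n) (λ j → D j (suc b) (suc d) * ∫ (T j s) (λ z → ∫ (L (n ∸ j ∷ z)) g))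
          ≈⟨ ∫-Dia (suc b) (suc d) s _ ⟨
        ∫ (Dia (suc b) (suc d) s) (λ w → ∫ (L w) g) ∎
        where
        i : ℕ → ℕ
        i k = suc (suc b) ∸ k
        f : ℕ → Word → Carrier
        f i z = ∫ (shW z s) (λ w → g (i ∷ w))
        y′ : ℕ → ℕ → ℕ → Carrier
        y′ i = Functional.shuffle (λ n → f i (letter n)) (λ n n′ → f i (n ∷ n′ ∷ []))
        left : ∀ k → k ℕ.< suc (suc b) → ∫ (T k s) (λ s′ → ∫ (Dia (i k) (suc d) s′) g) ≈
               Σ< (suc (i k ℕ.+ suc d)) (λ j → D j (i k) (suc d) * y′ (i k ℕ.+ suc d ∸ j) j k)
        left k (s≤s k≤b) = trans (∫-cong (T k s) (λ s′ → ∫-Dia (i k) (suc d) s′ g)) (trans (∫-Σ (T k s) _ _)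
          (Σ-cong (suc (i k ℕ.+ suc d)) (λ j → trans (∫-*ˡ (T k s) _ _) (D-cong-≤ j (i k) (suc d) (ℕₚ.m≤n⇒m≤o+n (i k) (s≤s z≤n))
            (λ j< → trans (T-T j k s vs (total j j<) _) (∫T-letters j k _))))))
          where
          total : ∀ j → j ℕ.< i k ℕ.+ suc d → j ℕ.+ (k ℕ.+ sum s) ℕ.< N
          total j j< = ℕₚ.≤-<-trans (ℕₚ.≤-trans (ℕₚ.≤-reflexive (≡.sym (ℕₚ.+-assoc j k (sum s)))) (ℕₚ.+-monoˡ-≤ (sum s) (ℕₚ.≤-pred
            (ℕₚ.≤-trans (ℕₚ.+-monoˡ-≤ k j<) (ℕₚ.≤-reflexive (≡.trans (≡.cong (ℕ._+ k) (ℕₚ.+-comm (i k) (suc d))) (≡.trans (ℕₚ.+-assoc (suc d) (i k) k)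
              (≡.trans (≡.cong (suc d ℕ.+_) (ℕₚ.m∸n+n≡m (ℕₚ.m≤n⇒m≤1+n k≤b))) (ℕₚ.+-comm (suc d) (suc (suc b)))))))))))
            below-s
        right : ∀ j → j ℕ.< n → ∫ (T j s) (λ z → ∫ (L (n ∸ j ∷ z)) g) ≈ Σ< (suc (suc (n ∸ j))) (λ k → D k 1 (n ∸ j) * y′ (suc (n ∸ j) ∸ k) j k)
        right j j<n = trans (∫-cong (T j s) (λ z → ∫-Dia 1 (n ∸ j) z g)) (trans (∫-Σ (T j s) _ _)
          (Σ-cong (suc (suc (n ∸ j))) (λ k → trans (∫-*ˡ (T j s) _ _) (D-cong-≤ k 1 (n ∸ j) (s≤s z≤n)
            (λ { (s≤s k≤) → trans (T-T k j s vs (total k k≤) _) (trans (T-letter-comm j k _) (∫T-letters j k _)) })))))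
          where
          total : ∀ k → k ℕ.≤ n ∸ j → k ℕ.+ (j ℕ.+ sum s) ℕ.< N
          total k k≤ = ℕₚ.≤-<-trans (ℕₚ.≤-trans (ℕₚ.≤-reflexive (≡.sym (ℕₚ.+-assoc k j (sum s)))) (ℕₚ.+-monoˡ-≤ (sum s)
            (ℕₚ.≤-trans (ℕₚ.+-monoˡ-≤ j k≤) (ℕₚ.≤-reflexive (ℕₚ.m∸n+n≡m (ℕₚ.<⇒≤ j<n)))))) below-s

    LP-tri : ∀ n u v → Valid u → Valid v → (suc n ℕ.+ sum u) ℕ.+ sum v ℕ.≤ N → ∀ g →
             ∫ (LP n u) (λ w → ∫ (triW w v) g) ≈ ∫ (shW u v) (λ w → ∫ (LP n w) g)
    LP-tri zero u v vu vv below g = trans (∫-single _ _) (trans (tri-cons 1 u v g) (∫-cong (shW u v) (λ w → sym (∫-single _ _))))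
    LP-tri (suc n) u v vu vv below g = begin
      ∫ (LP (suc n) u) (λ w → ∫ (triW w v) g)
        ≈⟨ LP-suc n u _ ⟩
      ∫ (LP n u) (λ y → ∫ (L y) (λ w → ∫ (triW w v) g))
        ≈⟨ combination-≈ (supported-LP n vu) (λ { y oy@(vy , weight-y) → L-tri y v vy (nonEmpty oy) vv
             (≡.subst (λ t → suc (t ℕ.+ sum v) ℕ.≤ N) (≡.sym weight-y) below) g }) ⟩
      ∫ (LP n u) (λ y → ∫ (triW y v) (λ w → ∫ (L w) g))
        ≈⟨ LP-tri n u v vu vv (ℕₚ.<⇒≤ below) _ ⟩
      ∫ (shW u v) (λ w → ∫ (LP n w) (λ w′ → ∫ (L w′) g))
        ≈⟨ ∫-cong (shW u v) (λ w → LP-suc n w g) ⟨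
      ∫ (shW u v) (λ w → ∫ (LP (suc n) w) g) ∎

    -- The case `x_1 u ◇ x_1 v = L (x_1 (u ⧢ v))` is the definition of the diamond and accounts for
    -- the extra `suc` in the merged letter. Every further `L` is pulled out by `L-diamond`, from
    -- the right factor after commuting.
    LP-diamond : ∀ n k u v → Valid u → Valid v → (suc n ℕ.+ sum u) ℕ.+ (suc k ℕ.+ sum v) ℕ.≤ N → ∀ g →
                 ∫ (LP n u) (λ u′ → ∫ (LP k v) (λ v′ → ∫ (diamondW u′ v′) g)) ≈ ∫ (shW u v) (λ s → ∫ (LP (suc (n ℕ.+ k)) s) g)
    LP-diamond zero zero u v vu vv below g = trans (∫-single _ _) (trans (∫-single _ _) (trans (diamond-cons 1 u 1 v g)
      (∫-cong (shW u v) (λ s → sym (trans (LP-suc 0 s g) (∫-single _ _))))))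
    LP-diamond zero (suc k) u v vu vv below g = begin
      ∫ (LP 0 u) (λ u′ → ∫ (LP (suc k) v) (λ v′ → ∫ (diamondW u′ v′) g))
        ≈⟨ trans (∫-single _ _) (LP-suc k v _) ⟩
      ∫ (LP k v) (λ w → ∫ (L w) (λ v′ → ∫ (diamondW (1 ∷ u) v′) g))
        ≈⟨ combination-≈ (supported-LP k vv) (λ { w ow@(vw , weight-w) → begin
             ∫ (L w) (λ v′ → ∫ (diamondW (1 ∷ u) v′) g)
               ≈⟨ combination-≈ (supported-L vw) (λ v′ ov′ → diamond-comm cons (nonEmpty ov′) g) ⟩
             ∫ (L w) (λ v′ → ∫ (diamondW v′ (1 ∷ u)) g)
               ≈⟨ L-diamond w (1 ∷ u) vw (nonEmpty ow) (suc 0 vu) cons (≡.subst (λ t → suc (t ℕ.+ _) ℕ.≤ N) (≡.sym weight-w)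
                    (ℕₚ.≤-trans (ℕₚ.≤-reflexive (ℕₚ.+-comm (suc (suc k) ℕ.+ sum v) (suc (sum u)))) below)) g ⟩
             ∫ (diamondW w (1 ∷ u)) (λ z → ∫ (L z) g)
               ≈⟨ diamond-comm (nonEmpty ow) cons _ ⟩
             ∫ (diamondW (1 ∷ u) w) (λ z → ∫ (L z) g) ∎ }) ⟩
      ∫ (LP k v) (λ w → ∫ (diamondW (1 ∷ u) w) (λ z → ∫ (L z) g))
        ≈⟨ ∫-single _ _ ⟨
      ∫ (LP 0 u) (λ u′ → ∫ (LP k v) (λ w → ∫ (diamondW u′ w) (λ z → ∫ (L z) g)))
        ≈⟨ LP-diamond 0 k u v vu vv (ℕₚ.≤-trans (ℕₚ.+-monoʳ-≤ (suc (sum u)) (ℕₚ.n≤1+n _)) below) _ ⟩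
      ∫ (shW u v) (λ s → ∫ (LP (suc k) s) (λ z → ∫ (L z) g))
        ≈⟨ ∫-cong (shW u v) (λ s → LP-suc (suc k) s g) ⟨
      ∫ (shW u v) (λ s → ∫ (LP (suc (suc k)) s) g) ∎
    LP-diamond (suc n) k u v vu vv below g = begin
      ∫ (LP (suc n) u) (λ u′ → ∫ (LP k v) (λ v′ → ∫ (diamondW u′ v′) g))
        ≈⟨ LP-suc n u _ ⟩
      ∫ (LP n u) (λ w → ∫ (L w) (λ u′ → ∫ (LP k v) (λ v′ → ∫ (diamondW u′ v′) g)))
        ≈⟨ combination-≈ (supported-LP n vu) (λ { w ow@(vw , weight-w) → trans (∫-swap (L w) (LP k v) _)
             (combination-≈ (supported-LP k vv) (λ { v′ ov′@(vv′ , weight-v′) → L-diamond w v′ vw (nonEmpty ow) vv′ (nonEmpty ov′)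
               (≡.subst₂ (λ s t → suc (s ℕ.+ t) ℕ.≤ N) (≡.sym weight-w) (≡.sym weight-v′) below) g })) }) ⟩
      ∫ (LP n u) (λ w → ∫ (LP k v) (λ v′ → ∫ (diamondW w v′) (λ z → ∫ (L z) g)))
        ≈⟨ LP-diamond n k u v vu vv (ℕₚ.<⇒≤ below) _ ⟩
      ∫ (shW u v) (λ s → ∫ (LP (suc (n ℕ.+ k)) s) (λ z → ∫ (L z) g))
        ≈⟨ ∫-cong (shW u v) (λ s → LP-suc (suc (n ℕ.+ k)) s g) ⟨
      ∫ (shW u v) (λ s → ∫ (LP (suc (suc n ℕ.+ k)) s) g) ∎

    -- The three parts of the quasi-shuffle recursion correspond to `u ▷ v`, `v ▷ u` and `u ◇ v` in
    -- `sh-split`.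
    ψ-homomorphism : ∀ p r → weight p ℕ.+ weight r ℕ.≤ N → ∀ g →
      ∫ (quasi p r) (λ x → ∫ (ψ x) g) ≈ ∫ (ψ p) (λ u → ∫ (ψ r) (λ v → ∫ (shW u v) g))
    ψ-homomorphism [] r below g = trans (∫-single r _) (sym (trans (∫-single [] _) (∫-cong (ψ r) (λ v → sh-nilˡ v g))))
    ψ-homomorphism P@(n ∷ p) [] below g = trans (∫-single P _) (sym (∫-cong (ψ P) (λ u → trans (∫-single [] _) (sh-nilʳ u g))))
    ψ-homomorphism P@(n ∷ p) R@(k ∷ r) below g = begin
      ∫ (quasi P R) (λ x → ∫ (ψ x) g)
        ≈⟨ quasi-cons n p k r _ ⟩
      ∫ (quasi p R) (λ x → ∫ (ψ (n ∷ x)) g) + (∫ (quasi P r) (λ x → ∫ (ψ (k ∷ x)) g) + ∫ (quasi p r) (λ x → ∫ (ψ (suc (n ℕ.+ k) ∷ x)) g))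
        ≈⟨ +-cong (trans (∫-cong (quasi p R) (λ x → ψ-cons n x g)) (ψ-homomorphism p R (ℕₚ.≤-trans (ℕₚ.+-monoˡ-≤ (weight R) (ℕₚ.m≤n+m (weight p) (suc n))) below) _))
             (+-cong (trans (∫-cong (quasi P r) (λ x → ψ-cons k x g)) (ψ-homomorphism P r (ℕₚ.≤-trans (ℕₚ.+-monoʳ-≤ (weight P) (ℕₚ.m≤n+m (weight r) (suc k))) below) _))
               (trans (∫-cong (quasi p r) (λ x → ψ-cons (suc (n ℕ.+ k)) x g)) (ψ-homomorphism p r
                 (ℕₚ.≤-trans (ℕₚ.+-mono-≤ (ℕₚ.m≤n+m (weight p) (suc n)) (ℕₚ.m≤n+m (weight r) (suc k))) below) _))) ⟩
      ∫ (ψ p) (λ u → ∫ (ψ R) (λ v → ∫ (shW u v) (λ w → ∫ (LP n w) g))) +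
        (∫ (ψ P) (λ u → ∫ (ψ r) (λ v → ∫ (shW u v) (λ w → ∫ (LP k w) g))) + ∫ (ψ p) (λ u → ∫ (ψ r) (λ v → ∫ (shW u v) (λ w → ∫ (LP (suc (n ℕ.+ k)) w) g))))
        ≈⟨ +-cong first (+-cong second third) ⟨
      ∫ (ψ P) (λ u → ∫ (ψ R) (λ v → ∫ (triW u v) g)) + (∫ (ψ P) (λ u → ∫ (ψ R) (λ v → ∫ (triW v u) g)) + ∫ (ψ P) (λ u → ∫ (ψ R) (λ v → ∫ (diamondW u v) g)))
        ≈⟨ trans (∫-+ (ψ P) _ _) (+-congˡ (∫-+ (ψ P) _ _)) ⟨
      ∫ (ψ P) (λ u → ∫ (ψ R) (λ v → ∫ (triW u v) g) + (∫ (ψ R) (λ v → ∫ (triW v u) g) + ∫ (ψ R) (λ v → ∫ (diamondW u v) g)))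
        ≈⟨ ∫-cong (ψ P) (λ u → trans (∫-+ (ψ R) _ _) (+-congˡ (∫-+ (ψ R) _ _))) ⟨
      ∫ (ψ P) (λ u → ∫ (ψ R) (λ v → ∫ (triW u v) g + (∫ (triW v u) g + ∫ (diamondW u v) g)))
        ≈⟨ combination-≈ (supported-ψ P) (λ u ou → combination-≈ (supported-ψ R) (λ v ov → sh-split (nonEmpty ou) (nonEmpty ov) g)) ⟨
      ∫ (ψ P) (λ u → ∫ (ψ R) (λ v → ∫ (shW u v) g)) ∎
      where
      first : ∫ (ψ P) (λ u → ∫ (ψ R) (λ v → ∫ (triW u v) g)) ≈ ∫ (ψ p) (λ u → ∫ (ψ R) (λ v → ∫ (shW u v) (λ w → ∫ (LP n w) g)))
      first = begin
        ∫ (ψ P) (λ u → ∫ (ψ R) (λ v → ∫ (triW u v) g))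
          ≈⟨ ψ-cons n p _ ⟩
        ∫ (ψ p) (λ u → ∫ (LP n u) (λ u′ → ∫ (ψ R) (λ v → ∫ (triW u′ v) g)))
          ≈⟨ combination-≈ (supported-ψ p) (λ { u (vu , weight-u) → trans (∫-swap (LP n u) (ψ R) _)
               (combination-≈ (supported-ψ R) (λ { v (vv , weight-v) → LP-tri n u v vu vv
                 (≡.subst₂ (λ s t → suc n ℕ.+ s ℕ.+ t ℕ.≤ N) (≡.sym weight-u) (≡.sym weight-v) below) g })) }) ⟩
        ∫ (ψ p) (λ u → ∫ (ψ R) (λ v → ∫ (shW u v) (λ w → ∫ (LP n w) g))) ∎
      second : ∫ (ψ P) (λ u → ∫ (ψ R) (λ v → ∫ (triW v u) g)) ≈ ∫ (ψ P) (λ u → ∫ (ψ r) (λ v → ∫ (shW u v) (λ w → ∫ (LP k w) g)))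
      second = combination-≈ (supported-ψ P) (λ { u (vu , weight-u) → trans (ψ-cons k r _)
        (combination-≈ (supported-ψ r) (λ { v (vv , weight-v) → trans (LP-tri k v u vv vu
          (ℕₚ.≤-trans (ℕₚ.≤-reflexive (≡.trans (ℕₚ.+-comm (suc k ℕ.+ sum v) (sum u)) (≡.cong₂ (λ s t → s ℕ.+ (suc k ℕ.+ t)) weight-u weight-v))) below) g)
          (sh-comm v u _) })) })
      third : ∫ (ψ P) (λ u → ∫ (ψ R) (λ v → ∫ (diamondW u v) g)) ≈ ∫ (ψ p) (λ u → ∫ (ψ r) (λ v → ∫ (shW u v) (λ w → ∫ (LP (suc (n ℕ.+ k)) w) g)))
      third = begin
        ∫ (ψ P) (λ u → ∫ (ψ R) (λ v → ∫ (diamondW u v) g))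
          ≈⟨ trans (ψ-cons n p _) (∫-cong (ψ p) (λ u → ∫-cong (LP n u) (λ u′ → ψ-cons k r _))) ⟩
        ∫ (ψ p) (λ u → ∫ (LP n u) (λ u′ → ∫ (ψ r) (λ v → ∫ (LP k v) (λ v′ → ∫ (diamondW u′ v′) g))))
          ≈⟨ combination-≈ (supported-ψ p) (λ { u (vu , weight-u) → trans (∫-swap (LP n u) (ψ r) _)
               (combination-≈ (supported-ψ r) (λ { v (vv , weight-v) → LP-diamond n k u v vu vv
                 (≡.subst₂ (λ s t → (suc n ℕ.+ s) ℕ.+ (suc k ℕ.+ t) ℕ.≤ N) (≡.sym weight-u) (≡.sym weight-v) below) g })) }) ⟩
        ∫ (ψ p) (λ u → ∫ (ψ r) (λ v → ∫ (shW u v) (λ w → ∫ (LP (suc (n ℕ.+ k)) w) g))) ∎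

    -- By linearity all three arguments may be taken in the image of `ψ`, where the claim becomes
    -- associativity of the quasi-shuffle.
    assoc-≤ : ∀ u v w → Valid u → Valid v → Valid w → sum u ℕ.+ (sum v ℕ.+ sum w) ℕ.≤ N → Assoc u v w
    assoc-≤ u v w vu vv vw below g = image-≈ u vu _ _ (λ p weight-p → begin
      ∫ (ψ p) (λ u → ∫ (shW u v) (λ z → ∫ (shW z w) g))
        ≈⟨ image-≈ v vv _ (λ v → ∫ (ψ p) (λ u → ∫ (shW v w) (λ z → ∫ (shW u z) g))) (λ r weight-r →
            image-≈ w vw (λ w → ∫ (ψ r) (λ v → ∫ (ψ p) (λ u → ∫ (shW u v) (λ z → ∫ (shW z w) g))))
                         (λ w → ∫ (ψ r) (λ v → ∫ (ψ p) (λ u → ∫ (shW v w) (λ z → ∫ (shW u z) g)))) (λ t weight-t →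
            triple p r t (≡.subst (ℕ._≤ N) (≡.cong₂ ℕ._+_ (≡.sym weight-p) (≡.cong₂ ℕ._+_ (≡.sym weight-r) (≡.sym weight-t))) below))) ⟩
      ∫ (ψ p) (λ u → ∫ (shW v w) (λ z → ∫ (shW u z) g)) ∎)
      where
      triple : ∀ p r t → weight p ℕ.+ (weight r ℕ.+ weight t) ℕ.≤ N →
        ∫ (ψ t) (λ w → ∫ (ψ r) (λ v → ∫ (ψ p) (λ u → ∫ (shW u v) (λ z → ∫ (shW z w) g)))) ≈
        ∫ (ψ t) (λ w → ∫ (ψ r) (λ v → ∫ (ψ p) (λ u → ∫ (shW v w) (λ z → ∫ (shW u z) g))))
      triple p r t below = begin
        ∫ (ψ t) (λ w → ∫ (ψ r) (λ v → ∫ (ψ p) (λ u → ∫ (shW u v) (λ z → ∫ (shW z w) g))))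
          ≈⟨ ∫-cong (ψ t) (λ w → ∫-swap (ψ r) (ψ p) _) ⟩
        ∫ (ψ t) (λ w → ∫ (ψ p) (λ u → ∫ (ψ r) (λ v → ∫ (shW u v) (λ z → ∫ (shW z w) g))))
          ≈⟨ ∫-cong (ψ t) (λ w → ψ-homomorphism p r (ℕₚ.≤-trans (ℕₚ.+-monoʳ-≤ (weight p) (ℕₚ.m≤m+n _ _)) below) _) ⟨
        ∫ (ψ t) (λ w → ∫ (quasi p r) (λ x → ∫ (ψ x) (λ z → ∫ (shW z w) g)))
          ≈⟨ ∫-swap (ψ t) (quasi p r) _ ⟩
        ∫ (quasi p r) (λ x → ∫ (ψ t) (λ w → ∫ (ψ x) (λ z → ∫ (shW z w) g)))
          ≈⟨ combination-≈ (supported-quasi p r) (λ x weight-x → trans (∫-swap (ψ t) (ψ x) _) (sym (ψ-homomorphism x t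
               (ℕₚ.≤-trans (ℕₚ.≤-reflexive (≡.trans (≡.cong (ℕ._+ weight t) weight-x) (ℕₚ.+-assoc (weight p) _ _))) below) g))) ⟩
        ∫ (quasi p r) (λ x → ∫ (quasi x t) (λ y → ∫ (ψ y) g))
          ≈⟨ quasi-assoc p r t _ ⟩
        ∫ (quasi r t) (λ x → ∫ (quasi p x) (λ y → ∫ (ψ y) g))
          ≈⟨ combination-≈ (supported-quasi r t) (λ x weight-x → ψ-homomorphism p x (≡.subst (λ s → weight p ℕ.+ s ℕ.≤ N) (≡.sym weight-x) below) g) ⟩
        ∫ (quasi r t) (λ x → ∫ (ψ p) (λ u → ∫ (ψ x) (λ z → ∫ (shW u z) g)))
          ≈⟨ ∫-cong (quasi r t) (λ x → ∫-swap (ψ p) (ψ x) _) ⟩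
        ∫ (quasi r t) (λ x → ∫ (ψ x) (λ z → ∫ (ψ p) (λ u → ∫ (shW u z) g)))
          ≈⟨ ψ-homomorphism r t (ℕₚ.≤-trans (ℕₚ.m≤n+m _ (weight p)) below) _ ⟩
        ∫ (ψ r) (λ v → ∫ (ψ t) (λ w → ∫ (shW v w) (λ z → ∫ (ψ p) (λ u → ∫ (shW u z) g))))
          ≈⟨ ∫-swap (ψ r) (ψ t) _ ⟩
        ∫ (ψ t) (λ w → ∫ (ψ r) (λ v → ∫ (shW v w) (λ z → ∫ (ψ p) (λ u → ∫ (shW u z) g))))
          ≈⟨ ∫-cong (ψ t) (λ w → ∫-cong (ψ r) (λ v → ∫-swap (shW v w) (ψ p) _)) ⟩
        ∫ (ψ t) (λ w → ∫ (ψ r) (λ v → ∫ (ψ p) (λ u → ∫ (shW v w) (λ z → ∫ (shW u z) g)))) ∎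

  sh-assoc-below : ∀ N u v w → Valid u → Valid v → Valid w → sum u ℕ.+ (sum v ℕ.+ sum w) ℕ.< N → Assoc u v w
  sh-assoc-below (suc N) u v w vu vv vw (s≤s below) = Step.assoc-≤ N (sh-assoc-below N) u v w vu vv vw below

  sh-assoc : ∀ {u v w} → Valid u → Valid v → Valid w → Assoc u v w
  sh-assoc vu vv vw = sh-assoc-below _ _ _ _ vu vv vw ℕₚ.≤-refl

  L-tri : ∀ {y z} → Valid y → NonEmpty y → Valid z → ∀ g → ∫ (L y) (λ w → ∫ (triW w z) g) ≈ ∫ (triW y z) (λ w → ∫ (L w) g)
  L-tri {y} {z} vy ny vz = Step.L-tri _ (sh-assoc-below _) y z vy ny vz ℕₚ.≤-refl

  ψ-homomorphism : ∀ p r g → ∫ (quasi p r) (λ x → ∫ (ψ x) g) ≈ ∫ (ψ p) (λ u → ∫ (ψ r) (λ v → ∫ (shW u v) g))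
  ψ-homomorphism p r = Step.ψ-homomorphism _ (sh-assoc-below _) p r ℕₚ.≤-refl

-- Deconcatenation of compositions

module Deconcatenation {c ℓ : Level} (F : CommutativeRing c ℓ) (q : ℕ) where
  open CommutativeRing F
  open Relation.Binary.Reasoning.Setoid setoid
  open IntegerSolver F
  open Construction F q
  open Integral F q
  open QuasiShuffle F q

  deconc : Word → 𝔠⊗𝔠
  deconc [] = [ (1# , ([] , [])) ]
  deconc (n ∷ p) = (1# , ([] , n ∷ p)) ∷ map (λ { (k , (a , b)) → (k , (n ∷ a , b)) }) (deconc p)

  deconc-cons : ∀ n p g → ∫ (deconc (n ∷ p)) g ≈ g ([] , n ∷ p) + ∫ (deconc p) (λ x → g (n ∷ proj₁ x , proj₂ x))
  deconc-cons n p g = trans (∫-cons _ _ _ g) (+-cong (*-identityˡ _) (∫-map (λ x → n ∷ proj₁ x , proj₂ x) (λ _ _ → ≡.refl) (deconc p) g))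

  deconc-coassoc : ∀ p (K : Word → Word → Word → Carrier) →
    ∫ (deconc p) (λ x → ∫ (deconc (proj₂ x)) (λ y → K (proj₁ x) (proj₁ y) (proj₂ y))) ≈
    ∫ (deconc p) (λ x → ∫ (deconc (proj₁ x)) (λ y → K (proj₁ y) (proj₂ y) (proj₂ x)))
  deconc-coassoc [] K = trans (∫-single _ _) (trans (∫-single _ _) (sym (trans (∫-single _ _) (∫-single _ _))))
  deconc-coassoc (n ∷ p) K = begin
    ∫ (deconc (n ∷ p)) (λ x → ∫ (deconc (proj₂ x)) (λ y → K (proj₁ x) (proj₁ y) (proj₂ y)))
      ≈⟨ trans (deconc-cons n p _) (+-cong (deconc-cons n p _) (deconc-coassoc p (λ a → K (n ∷ a)))) ⟩
    (K [] [] (n ∷ p) + ∫ (deconc p) (λ y → K [] (n ∷ proj₁ y) (proj₂ y))) + ∫ (deconc p) (λ x → ∫ (deconc (proj₁ x)) (λ y → K (n ∷ proj₁ y) (proj₂ y) (proj₂ x)))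
      ≈⟨ trans (+-assoc _ _ _) (+-congˡ (sym (∫-+ (deconc p) _ _))) ⟩
    K [] [] (n ∷ p) + ∫ (deconc p) (λ x → K [] (n ∷ proj₁ x) (proj₂ x) + ∫ (deconc (proj₁ x)) (λ y → K (n ∷ proj₁ y) (proj₂ y) (proj₂ x)))
      ≈⟨ +-cong (∫-single _ _) (∫-cong (deconc p) (λ x → deconc-cons n (proj₁ x) _)) ⟨
    ∫ (deconc []) (λ y → K (proj₁ y) (proj₂ y) (n ∷ p)) + ∫ (deconc p) (λ x → ∫ (deconc (n ∷ proj₁ x)) (λ y → K (proj₁ y) (proj₂ y) (proj₂ x)))
      ≈⟨ deconc-cons n p _ ⟨
    ∫ (deconc (n ∷ p)) (λ x → ∫ (deconc (proj₁ x)) (λ y → K (proj₁ y) (proj₂ y) (proj₂ x))) ∎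

  quasi₂ : (Word × Word → Carrier) → Word × Word → Word × Word → Carrier
  quasi₂ H x y = ∫ (quasi (proj₁ x) (proj₁ y)) (λ z → ∫ (quasi (proj₂ x) (proj₂ y)) (λ z′ → H (z , z′)))

  -- Pairs of cuts are sorted by which of the two left parts are empty: `h` for both, `d₁` and `d₂`
  -- for one. When neither is empty, the three terms `e₁`, `e₂`, `e₃` reassemble by the recursion of
  -- `quasi` on the left parts.
  deconc-quasi : ∀ p r H → ∫ (quasi p r) (λ x → ∫ (deconc x) H) ≈ ∫ (deconc p) (λ x → ∫ (deconc r) (quasi₂ H x))
  deconc-quasi [] r H = trans (∫-single r _) (sym (trans (∫-single _ _) (∫-cong (deconc r) (λ y → trans (∫-single _ _) (∫-single _ _)))))
  deconc-quasi P@(n ∷ p) [] H = trans (∫-single P _) (sym (∫-cong (deconc P) (λ x → trans (∫-single _ _) (trans (quasi-nilʳ (proj₁ x) _) (quasi-nilʳ (proj₂ x) _)))))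
  deconc-quasi P@(n ∷ p) R@(k ∷ r) H = begin
    ∫ (quasi P R) (λ x → ∫ (deconc x) H)
      ≈⟨ quasi-cons n p k r _ ⟩
    ∫ (quasi p R) (λ x → ∫ (deconc (n ∷ x)) H) + (∫ (quasi P r) (λ x → ∫ (deconc (k ∷ x)) H) + ∫ (quasi p r) (λ x → ∫ (deconc (l ∷ x)) H))
      ≈⟨ +-cong (expand (quasi p R) n) (+-cong (expand (quasi P r) k) (expand (quasi p r) l)) ⟩
    (∫ (quasi p R) (λ x → H ([] , n ∷ x)) + ∫ (quasi p R) (λ x → ∫ (deconc x) (Hₙ n))) + ((∫ (quasi P r) (λ x → H ([] , k ∷ x)) + ∫ (quasi P r) (λ x → ∫ (deconc x) (Hₙ k))) +
      (∫ (quasi p r) (λ x → H ([] , l ∷ x)) + ∫ (quasi p r) (λ x → ∫ (deconc x) (Hₙ l))))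
      ≈⟨ solve 6 (λ a a′ b b′ d d′ → (a :+ a′) :+ ((b :+ b′) :+ (d :+ d′)) := (a :+ (b :+ d)) :+ (a′ :+ (b′ :+ d′))) refl _ _ _ _ _ _ ⟩
    (∫ (quasi p R) (λ x → H ([] , n ∷ x)) + (∫ (quasi P r) (λ x → H ([] , k ∷ x)) + ∫ (quasi p r) (λ x → H ([] , l ∷ x)))) +
      (∫ (quasi p R) (λ x → ∫ (deconc x) (Hₙ n)) + (∫ (quasi P r) (λ x → ∫ (deconc x) (Hₙ k)) + ∫ (quasi p r) (λ x → ∫ (deconc x) (Hₙ l))))
      ≈⟨ +-cong (sym (quasi-cons n p k r _)) (+-cong (deconc-quasi p R _) (+-cong (deconc-quasi P r _) (deconc-quasi p r _))) ⟩
    h + (∫ (deconc p) (λ x → ∫ (deconc R) (quasi₂ (Hₙ n) x)) + (∫ (deconc P) (λ x → ∫ (deconc r) (quasi₂ (Hₙ k) x)) + e₃))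
      ≈⟨ +-congˡ (+-cong (trans (∫-cong (deconc p) (λ x → deconc-cons k r _)) (∫-+ (deconc p) _ _)) (+-congʳ (deconc-cons n p _))) ⟩
    h + ((d₁ + e₁) + ((d₂ + e₂) + e₃))
      ≈⟨ solve 6 (λ h d₁ e₁ d₂ e₂ e₃ → h :+ ((d₁ :+ e₁) :+ ((d₂ :+ e₂) :+ e₃)) := (h :+ d₂) :+ (d₁ :+ (e₁ :+ (e₂ :+ e₃)))) refl _ _ _ _ _ _ ⟩
    (h + d₂) + (d₁ + (e₁ + (e₂ + e₃)))
      ≈⟨ +-cong (+-cong (sym (∫-single _ _)) (∫-cong (deconc r) (λ y → trans (∫-single _ _) (sym (∫-single _ _)))))
           (+-cong (∫-cong (deconc p) (λ x → trans (quasi-nilʳ (proj₁ x) _) (sym (∫-single _ _)))) deep) ⟩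
    (quasi₂ H ([] , P) ([] , R) + ∫ (deconc r) (λ y → quasi₂ H ([] , P) (k ∷ proj₁ y , proj₂ y))) +
      (∫ (deconc p) (λ x → quasi₂ H (n ∷ proj₁ x , proj₂ x) ([] , R)) + ∫ (deconc p) (λ x → ∫ (deconc r) (λ y → quasi₂ H (n ∷ proj₁ x , proj₂ x) (k ∷ proj₁ y , proj₂ y))))
      ≈⟨ +-cong (deconc-cons k r _) (trans (∫-cong (deconc p) (λ x → deconc-cons k r _)) (∫-+ (deconc p) _ _)) ⟨
    ∫ (deconc R) (quasi₂ H ([] , P)) + ∫ (deconc p) (λ x → ∫ (deconc R) (quasi₂ H (n ∷ proj₁ x , proj₂ x)))
      ≈⟨ deconc-cons n p _ ⟨
    ∫ (deconc P) (λ x → ∫ (deconc R) (quasi₂ H x)) ∎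
    where
    l = suc (n ℕ.+ k)
    Hₙ : ℕ → Word × Word → Carrier
    Hₙ i x = H (i ∷ proj₁ x , proj₂ x)
    expand : ∀ s i → ∫ s (λ x → ∫ (deconc (i ∷ x)) H) ≈ ∫ s (λ x → H ([] , i ∷ x)) + ∫ s (λ x → ∫ (deconc x) (Hₙ i))
    expand s i = trans (∫-cong s (λ x → deconc-cons i x H)) (∫-+ s _ _)
    h = ∫ (quasi P R) (λ x → H ([] , x))
    d₁ = ∫ (deconc p) (λ x → quasi₂ (Hₙ n) x ([] , R))
    e₁ = ∫ (deconc p) (λ x → ∫ (deconc r) (λ y → quasi₂ (Hₙ n) x (k ∷ proj₁ y , proj₂ y)))
    d₂ = ∫ (deconc r) (quasi₂ (Hₙ k) ([] , P))
    e₂ = ∫ (deconc p) (λ x → ∫ (deconc r) (quasi₂ (Hₙ k) (n ∷ proj₁ x , proj₂ x)))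
    e₃ = ∫ (deconc p) (λ x → ∫ (deconc r) (quasi₂ (Hₙ l) x))
    deep : e₁ + (e₂ + e₃) ≈ ∫ (deconc p) (λ x → ∫ (deconc r) (λ y → quasi₂ H (n ∷ proj₁ x , proj₂ x) (k ∷ proj₁ y , proj₂ y)))
    deep = sym (trans (∫-cong (deconc p) (λ x → trans (∫-cong (deconc r) (λ y → quasi-cons n (proj₁ x) k (proj₁ y) _))
      (trans (∫-+ (deconc r) _ _) (+-congˡ (∫-+ (deconc r) _ _))))) (trans (∫-+ (deconc p) _ _) (+-congˡ (∫-+ (deconc p) _ _))))

-- The coproduct: recursion, multiplicativity, coassociativity

module Coproduct {c ℓ : Level} (F : CommutativeRing c ℓ) (isField : IsField F)
                 (m : ℕ) (card : HasCardinality F (suc m)) where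
  open CommutativeRing F
  open Algebra.Properties.Ring ring
  open Relation.Binary.Reasoning.Setoid setoid
  open IntegerSolver F
  open Sums F
  open Construction F (suc m)
  open Key F isField m card using (D; D-out)
  open Integral F (suc m)
  open Shuffle F isField m card
  open QuasiShuffle F (suc m)
  open Deconcatenation F (suc m)
  open Presentation F isField m card

  Word₂ : Set
  Word₂ = Word × Word

  opaque
    tri₂ sh₂ : Word₂ → Word₂ → 𝔠⊗𝔠
    tri₂ x y = tensor (triW (proj₁ x) (proj₁ y)) (shW (proj₂ x) (proj₂ y))
    sh₂ x y = tensor (shW (proj₁ x) (proj₁ y)) (shW (proj₂ x) (proj₂ y))

    ∫-tri₂ : ∀ x y g → ∫ (tri₂ x y) g ≈ ∫ (triW (proj₁ x) (proj₁ y)) (λ a → ∫ (shW (proj₂ x) (proj₂ y)) (λ b → g (a , b)))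
    ∫-tri₂ x y g = ∫-tensor _ _ g

    ∫-sh₂ : ∀ x y g → ∫ (sh₂ x y) g ≈ ∫ (shW (proj₁ x) (proj₁ y)) (λ a → ∫ (shW (proj₂ x) (proj₂ y)) (λ b → g (a , b)))
    ∫-sh₂ x y g = ∫-tensor _ _ g

  reduced : (ℕ → 𝔠⊗𝔠) → ℕ → 𝔠⊗𝔠
  reduced dx u = dx u ++ neg [ (1# , ([] , [ u ])) ]

  ∫-reduced : ∀ dx u g → ∫ (reduced dx u) g ≈ ∫ (dx u) g - g ([] , [ u ])
  ∫-reduced dx u g = trans (∫-++ (dx u) _ g) (+-congˡ (trans (∫-neg-list _ g) (-‿cong (∫-single _ g))))

  opaque
    unfolding tri₂

    ΔW-cons : ∀ dx u v vs g → ∫ (ΔW dx (u ∷ v ∷ vs)) g ≈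
      g ([] , u ∷ v ∷ vs) + ∫ (reduced dx u) (λ x → ∫ (ΔW dx (v ∷ vs)) (λ y → ∫ (tri₂ x y) g))
    ΔW-cons dx u v vs g = trans (∫-cons _ _ _ g) (+-cong (*-identityˡ _) (∫-ext₂ _ (reduced dx u) (ΔW dx (v ∷ vs)) g))

  module _ (dx dx′ : ℕ → 𝔠⊗𝔠) where
    ΔW-cong₂ : ∀ u v → (∀ g → ∫ (dx u) g ≈ ∫ (dx′ u) g) → (∀ g → ∫ (dx v) g ≈ ∫ (dx′ v) g) → ∀ g →
               ∫ (ΔW dx (u ∷ v ∷ [])) g ≈ ∫ (ΔW dx′ (u ∷ v ∷ [])) g
    ΔW-cong₂ u v eu ev g = trans (ΔW-cons dx u v [] g) (trans (+-congˡ (begin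
      ∫ (reduced dx u) (λ x → ∫ (dx v) (λ y → ∫ (tri₂ x y) g))     ≈⟨ ∫-cong (reduced dx u) (λ x → ev _) ⟩
      ∫ (reduced dx u) (λ x → ∫ (dx′ v) (λ y → ∫ (tri₂ x y) g))    ≈⟨ ∫-reduced dx u _ ⟩
      ∫ (dx u) _ - _                                               ≈⟨ +-congʳ (eu _) ⟩
      ∫ (dx′ u) _ - _                                              ≈⟨ ∫-reduced dx′ u _ ⟨
      ∫ (reduced dx′ u) (λ x → ∫ (dx′ v) (λ y → ∫ (tri₂ x y) g))   ∎)) (sym (ΔW-cons dx′ u v [] g)))

  opaque
    unfolding sh₂

    ΔXstep-suc : ∀ dx k g → ∫ (ΔXstep dx (suc (suc k))) g ≈
      ∫ (dx 1) (λ x → ∫ (dx (suc k)) (λ y → ∫ (sh₂ x y) g)) + (- ∫ (ΔW dx (1 ∷ suc k ∷ [])) g + (- ∫ (ΔW dx (suc k ∷ 1 ∷ [])) g +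
        - Σ< (suc k) (λ j → Δcoef (suc j) 1 (suc k) * ∫ (ΔW dx (suc k ∸ j ∷ suc j ∷ [])) g)))
    ΔXstep-suc dx k g = trans (∫-++ (dx 1 ⧢₂ dx (suc k)) _ g) (+-cong (∫-ext₂ _ (dx 1) (dx (suc k)) g)
      (trans (∫-++ (neg (ΔW dx (1 ∷ suc k ∷ []))) _ g) (+-cong (∫-neg-list _ g)
      (trans (∫-++ (neg (ΔW dx (suc k ∷ 1 ∷ []))) _ g) (+-cong (∫-neg-list _ g)
      (trans (∫-neg-list _ g) (-‿cong (trans (reflexive (≡.cong (λ js → ∫ (concatMap f js) g) (Listₚ.map-applyUpTo (λ j → j) suc (suc k))))
        (trans (∫-applyUpTo (suc k) suc f g) (Σ-cong (suc k) (λ j → ∫-scale _ _ g)))))))))))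
      where
      f : ℕ → 𝔠⊗𝔠
      f j = scale (Δcoef j 1 (suc k)) (ΔW dx ((suc (suc k) ∸ j) ∷ j ∷ []))

  ΔXstep-cong : ∀ dx dx′ w → (∀ i → suc i ℕ.< w → ∀ g → ∫ (dx (suc i)) g ≈ ∫ (dx′ (suc i)) g) → ∀ g →
                ∫ (ΔXstep dx w) g ≈ ∫ (ΔXstep dx′ w) g
  ΔXstep-cong dx dx′ zero e g = refl
  ΔXstep-cong dx dx′ (suc zero) e g = refl
  ΔXstep-cong dx dx′ (suc (suc k)) e g = trans (ΔXstep-suc dx k g) (trans (+-cong
      (trans (e₁ _) (∫-cong (dx′ 1) (λ x → eₖ _)))
      (+-cong (-‿cong (ΔW-cong₂ dx dx′ 1 (suc k) e₁ eₖ g)) (+-cong (-‿cong (ΔW-cong₂ dx dx′ (suc k) 1 eₖ e₁ g))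
        (-‿cong (Σ-cong< (suc k) (λ j j≤k → *-congˡ (term j j≤k)))))))
    (sym (ΔXstep-suc dx′ k g)))
    where
    e₁ = e 0 (s≤s (s≤s z≤n))
    eₖ = e k ℕₚ.≤-refl
    term : ∀ j → j ℕ.< suc k → ∫ (ΔW dx (suc k ∸ j ∷ suc j ∷ [])) g ≈ ∫ (ΔW dx′ (suc k ∸ j ∷ suc j ∷ [])) g
    term j (s≤s j≤k) rewrite ℕₚ.+-∸-assoc 1 j≤k = ΔW-cong₂ dx dx′ (suc (k ∸ j)) (suc j) (e (k ∸ j) (s≤s (s≤s (ℕₚ.m∸n≤m k j)))) (e j (s≤s (s≤s j≤k))) g

  -- The value at a letter depends only on letters of smaller weight, so it is constant once the
  -- number of iterations reaches the weight. This yields the unbounded recursion `ΔX-suc`.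
  ΔXiter-stable : ∀ n n′ i → suc i ℕ.≤ n → suc i ℕ.≤ n′ → ∀ g → ∫ (ΔXiter n (suc i)) g ≈ ∫ (ΔXiter n′ (suc i)) g
  ΔXiter-stable (suc n) (suc n′) i (s≤s i≤n) (s≤s i≤n′) = ΔXstep-cong (ΔXiter n) (ΔXiter n′) (suc i)
    (λ j j<i → ΔXiter-stable n n′ j (ℕₚ.≤-trans (ℕₚ.≤-pred j<i) i≤n) (ℕₚ.≤-trans (ℕₚ.≤-pred j<i) i≤n′))

  ΔX-suc : ∀ k g → ∫ (ΔX (suc (suc k))) g ≈
    ∫ (ΔX 1) (λ x → ∫ (ΔX (suc k)) (λ y → ∫ (sh₂ x y) g)) + (- ∫ (Δ (1 ∷ suc k ∷ [])) g + (- ∫ (Δ (suc k ∷ 1 ∷ [])) g +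
      - Σ< (suc k) (λ j → Δcoef (suc j) 1 (suc k) * ∫ (Δ (suc k ∸ j ∷ suc j ∷ [])) g)))
  ΔX-suc k g = trans (ΔXstep-cong (ΔXiter (suc k)) ΔX (suc (suc k)) (λ i i<k → ΔXiter-stable (suc k) (suc i) i (ℕₚ.≤-pred i<k) ℕₚ.≤-refl) g)
    (ΔXstep-suc ΔX k g)

  ΔX-1 : ∀ g → ∫ (ΔX 1) g ≈ g ([] , [ 1 ]) + g ([ 1 ] , [])
  ΔX-1 g = trans (∫-cons _ _ _ g) (+-cong (*-identityˡ _) (∫-single _ g))

  -- ∂ u = Δ(x_u) - 1 ⊗ x_u
  ∂ : ℕ → 𝔠⊗𝔠
  ∂ = reduced ΔX

  ΔX-∂ : ∀ u g → ∫ (ΔX u) g ≈ g ([] , [ u ]) + ∫ (∂ u) g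
  ΔX-∂ u g = trans (solve 2 (λ x y → x := y :+ (x :- y)) refl _ _) (+-congˡ (sym (∫-reduced ΔX u g)))

  ∂-1 : ∀ g → ∫ (∂ 1) g ≈ g ([ 1 ] , [])
  ∂-1 g = trans (∫-reduced ΔX 1 g) (trans (+-congʳ (ΔX-1 g)) (solve 2 (λ x y → (x :+ y) :- x := y) refl _ _))

  tri-nilʳ : ∀ a g → ∫ (triW a []) g ≈ g a
  tri-nilʳ [] g = ∫-single [] g
  tri-nilʳ (n ∷ a) g = ∫-single (n ∷ a) g

  -- Multiplying by the empty word changes nothing, for `▷` as for `⧢`, so the clause for a single
  -- letter obeys the formula for longer words.
  Δ-cons : ∀ u v g → ∫ (Δ (u ∷ v)) g ≈ g ([] , u ∷ v) + ∫ (∂ u) (λ x → ∫ (Δ v) (λ y → ∫ (tri₂ x y) g))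
  Δ-cons u [] g = trans (ΔX-∂ u g) (+-congˡ (∫-cong (∂ u) (λ x → sym (trans (∫-single _ _) (trans (∫-tri₂ x _ g)
    (trans (tri-nilʳ (proj₁ x) _) (sh-nilʳ (proj₂ x) _)))))))
  Δ-cons u (v ∷ vs) g = ΔW-cons ΔX u v vs g

  Δ-1-cons : ∀ v g → ∫ (Δ (1 ∷ v)) g ≈ g ([] , 1 ∷ v) + ∫ (Δ v) (λ x → g (1 ∷ proj₁ x , proj₂ x))
  Δ-1-cons v g = trans (Δ-cons 1 v g) (+-congˡ (trans (∂-1 _) (∫-cong (Δ v) (λ y → trans (∫-tri₂ _ y g)
    (trans (tri-cons 1 [] (proj₁ y) _) (trans (sh-nilˡ (proj₁ y) _) (sh-nilˡ (proj₂ y) _)))))))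

  -- `Reduced` excludes an empty left factor because `tri-cons`, `sh-1` and `L-tri` concern nonempty
  -- words; the last two are false for the empty one.
  Valid₂ Reduced : Word₂ → Set
  Valid₂ x = Valid (proj₁ x) × Valid (proj₂ x)
  Reduced x = NonEmpty (proj₁ x) × Valid₂ x

  L₁ : (Word₂ → Carrier) → Word₂ → Carrier
  L₁ g x = ∫ (L (proj₁ x)) (λ a → g (a , proj₂ x))

  L₁-nil : ∀ g b → L₁ g ([] , b) ≈ 0#
  L₁-nil g b = ∫-nil _

  ΔX-L₁ : ∀ u g → ∫ (ΔX u) (L₁ g) ≈ ∫ (∂ u) (L₁ g)
  ΔX-L₁ u g = trans (ΔX-∂ u _) (trans (+-congʳ (L₁-nil g _)) (+-identityˡ _))

  -- The part of depth two is the sum that the definition of `Δ(x_w)` subtracts, for `w = k + 2`;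
  -- this is how `L` enters the coproduct.
  L-letter : ∀ k f → ∫ (L [ suc k ]) f ≈ f [ suc (suc k) ] + Σ< (suc k) (λ j → Δcoef (suc j) 1 (suc k) * f (suc k ∸ j ∷ suc j ∷ []))
  L-letter k f = begin
    ∫ (L [ suc k ]) f
      ≈⟨ trans (∫-Dia 1 (suc k) [] f) (Σ-suc (suc (suc k)) _) ⟩
    1# * ∫ (T 0 []) (λ z → f (suc (suc k) ∷ z)) + Σ< (suc (suc k)) (λ j → Δcoef (suc j) 1 (suc k) * ∫ (T (suc j) []) (λ z → f (suc k ∸ j ∷ z)))
      ≈⟨ +-cong (trans (*-identityˡ _) (∫-single _ _)) (trans (Σ-cong (suc (suc k)) (λ j → *-congˡ (∫-single _ _))) (trans (Σ-last (suc k) _)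
           (trans (+-congˡ (trans (*-congʳ (D-out (suc k) 1 (suc k) ℕₚ.≤-refl)) (zeroˡ _))) (+-identityʳ _)))) ⟩
    f [ suc (suc k) ] + Σ< (suc k) (λ j → Δcoef (suc j) 1 (suc k) * f (suc k ∸ j ∷ suc j ∷ [])) ∎

  sh-1 : ∀ a f → NonEmpty a → ∫ (shW [ 1 ] a) f ≈ f (1 ∷ a) + (∫ (triW a [ 1 ]) f + ∫ (L a) f)
  sh-1 (α ∷ a) f cons = trans (sh-split {[ 1 ]} {α ∷ a} cons cons f) (+-cong (trans (tri-cons 1 [] (α ∷ a) f) (sh-nilˡ _ _))
    (+-congˡ (trans (diamond-cons 1 [] α a f) (sh-nilˡ _ _))))

  -- By the recursion the left side is `Δ(x_1) ⧢ Δ(x_b) - Δ(x_1 x_b) - Δ(x_b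
  -- x_1)`. After `sh-1` has been applied in `A₁` and `A₄`, everything cancels except their diamond
  -- parts `E` and `G`. The support hypothesis makes `sh-1` applicable to the left factors of `∂ b`.
  Δ-L-letter : ∀ k → Supported Reduced (∫ (∂ (suc k))) → ∀ g →
    ∫ (L [ suc k ]) (λ u → ∫ (Δ u) g) ≈ ∫ (L [ suc k ]) (λ u → g ([] , u)) + ∫ (ΔX (suc k)) (L₁ g)
  Δ-L-letter k s g = begin
    ∫ (L [ b ]) (λ u → ∫ (Δ u) g)
      ≈⟨ trans (L-letter k _) (+-congʳ (ΔX-suc k g)) ⟩
    (A + (- B + (- C₀ + - S))) + S
      ≈⟨ solve 4 (λ a b c s → (a :+ (:- b :+ (:- c :+ :- s))) :+ s := a :- b :- c) refl A B C₀ S ⟩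
    A - B - C₀
      ≈⟨ +-cong (+-cong A-expand (-‿cong B-expand)) (-‿cong C₀-expand) ⟩
    ((A₁ + A₂) + (A₃ + A₄)) - (B₁ + (A₃ + B₃)) - (C₁ + (A₂ + C₂))
      ≈⟨ +-congʳ (+-congʳ (+-cong (+-congʳ A₁-expand) (+-congˡ A₄-expand))) ⟩
    (((B₁ + (C₁ + E)) + A₂) + (A₃ + (B₃ + (C₂ + G)))) - (B₁ + (A₃ + B₃)) - (C₁ + (A₂ + C₂))
      ≈⟨ solve 8 (λ a₂ a₃ b₁ b₃ c₁ c₂ e g → (((b₁ :+ (c₁ :+ e)) :+ a₂) :+ (a₃ :+ (b₃ :+ (c₂ :+ g)))) :- (b₁ :+ (a₃ :+ b₃)) :- (c₁ :+ (a₂ :+ c₂)) := e :+ g)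
           refl A₂ A₃ B₁ B₃ C₁ C₂ E G ⟩
    E + G
      ≈⟨ +-congˡ (ΔX-L₁ b g) ⟨
    ∫ (L [ b ]) (λ u → g ([] , u)) + ∫ (ΔX b) (L₁ g) ∎
    where
    b = suc k
    A = ∫ (ΔX 1) (λ x → ∫ (ΔX b) (λ y → ∫ (sh₂ x y) g))
    B = ∫ (Δ (1 ∷ b ∷ [])) g
    C₀ = ∫ (Δ (b ∷ 1 ∷ [])) g
    S = Σ< (suc k) (λ j → Δcoef (suc j) 1 (suc k) * ∫ (Δ (suc k ∸ j ∷ suc j ∷ [])) g)
    A₁ = ∫ (shW [ 1 ] [ b ]) (λ u → g ([] , u))
    A₂ = ∫ (∂ b) (λ x → ∫ (shW [ 1 ] (proj₂ x)) (λ v → g (proj₁ x , v)))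
    A₃ = g ([ 1 ] , [ b ])
    A₄ = ∫ (∂ b) (λ x → ∫ (shW [ 1 ] (proj₁ x)) (λ v → g (v , proj₂ x)))
    B₁ = g ([] , 1 ∷ b ∷ [])
    B₃ = ∫ (∂ b) (λ x → g (1 ∷ proj₁ x , proj₂ x))
    C₁ = g ([] , b ∷ 1 ∷ [])
    C₂ = ∫ (∂ b) (λ x → ∫ (triW (proj₁ x) [ 1 ]) (λ v → g (v , proj₂ x)))
    E = ∫ (L [ b ]) (λ u → g ([] , u))
    G = ∫ (∂ b) (L₁ g)
    A-expand : A ≈ (A₁ + A₂) + (A₃ + A₄)
    A-expand = trans (ΔX-1 _) (+-cong
      (trans (∫-cong (ΔX b) (λ y → trans (∫-sh₂ _ y g) (sh-nilˡ (proj₁ y) _))) (ΔX-∂ b _))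
      (trans (∫-cong (ΔX b) (λ y → trans (∫-sh₂ _ y g) (∫-cong (shW [ 1 ] (proj₁ y)) (λ a → sh-nilˡ (proj₂ y) _))))
        (trans (ΔX-∂ b _) (+-congʳ (sh-nilʳ [ 1 ] _)))))
    B-expand : B ≈ B₁ + (A₃ + B₃)
    B-expand = trans (Δ-1-cons [ b ] g) (+-congˡ (ΔX-∂ b _))
    C₀-expand : C₀ ≈ C₁ + (A₂ + C₂)
    C₀-expand = trans (Δ-cons b [ 1 ] g) (+-congˡ (trans (∫-cong (∂ b) (λ x → trans (ΔX-1 _) (+-cong
        (trans (∫-tri₂ x _ g) (trans (tri-nilʳ (proj₁ x) _) (sh-comm (proj₂ x) [ 1 ] _)))
        (trans (∫-tri₂ x _ g) (∫-cong (triW (proj₁ x) [ 1 ]) (λ a → sh-nilʳ (proj₂ x) _))))))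
      (∫-+ (∂ b) _ _)))
    A₁-expand : A₁ ≈ B₁ + (C₁ + E)
    A₁-expand = trans (sh-1 [ b ] _ cons) (+-congˡ (+-congʳ (trans (tri-cons b [] [ 1 ] _) (sh-nilˡ _ _))))
    A₄-expand : A₄ ≈ B₃ + (C₂ + G)
    A₄-expand = trans (combination-≈ s (λ { x (ne , _) → sh-1 (proj₁ x) _ ne })) (trans (∫-+ (∂ b) _ _) (+-congˡ (∫-+ (∂ b) _ _)))

  supported-tri₂ : ∀ x y → Reduced x → Valid₂ y → Supported Reduced (∫ (tri₂ x y))
  supported-tri₂ (.(suc a ∷ as) , b) (a′ , b′) (cons , suc a {as} va , vb) (va′ , vb′) = combination-cong (λ g → trans (∫-tri₂ _ _ g) (tri-cons (suc a) as a′ _))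
    (combination-bind _ (supported-sh va va′) (λ { w (vw , _) → combination-bind _ (supported-sh vb vb′)
      (λ { z (vz , _) → combination-return (suc a ∷ w , z) (cons , suc a vw , vz) }) }))

  valid-letterΔ : ∀ k → Supported Reduced (∫ (∂ (suc k))) → Supported Valid₂ (∫ (ΔX (suc k)))
  valid-letterΔ k s = combination-cong (λ g → ΔX-∂ (suc k) g) (combination-+ (combination-return ([] , [ suc k ]) ([] , suc k []))
    (combination-bind (λ g → g) s (λ { x (_ , v) → combination-return x v })))

  -- Rewritten through `Δ-L-letter`, the recursion builds `∂` of a letter from earlier values by
  -- applying `L` to left factors or extending them by `▷`, and both operations keep them nonempty.
  supported-∂ : ∀ k → Supported Reduced (∫ (∂ (suc k)))
  supported-∂ = <-rec (λ k → Supported Reduced (∫ (∂ (suc k)))) step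
    where
    step : ∀ k → (∀ {i} → i ℕ.< k → Supported Reduced (∫ (∂ (suc i)))) → Supported Reduced (∫ (∂ (suc k)))
    step zero below = combination-cong (λ g → ∂-1 g) (combination-return ([ 1 ] , []) (cons , suc 0 [] , []))
    step (suc k) below = combination-cong expand (combination-+
      (combination-bind L₁ (below ℕₚ.≤-refl) (λ { x (_ , va , vb) → combination-bind (λ g a → g (a , proj₂ x)) (supported-L va)
        (λ { a oa@(va′ , _) → combination-return (a , proj₂ x) (nonEmpty oa , va′ , vb) }) }))
      (combination-* (- 1#) (supported-Σ< (suc k) _ (λ j j<k → combination-* _ (lower j j<k)))))
      where
      supported-Σ< : ∀ n (T : ℕ → Functional Word₂) → (∀ i → i ℕ.< n → Supported Reduced (T i)) → Supported Reduced (λ g → Σ< n (λ i → T i g))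
      supported-Σ< zero T s = combination-cong (λ g → Σ-nil _) combination-0
      supported-Σ< (suc n) T s = combination-cong (λ g → Σ-suc n _) (combination-+ (s 0 (s≤s z≤n)) (supported-Σ< n (T ∘ suc) (λ i i<n → s (suc i) (s≤s i<n))))
      lower : ∀ j → j ℕ.< suc k → Supported Reduced (λ g → ∫ (∂ (suc k ∸ j)) (λ x → ∫ (ΔX (suc j)) (λ y → ∫ (tri₂ x y) g)))
      lower j (s≤s j≤k) rewrite ℕₚ.+-∸-assoc 1 j≤k = combination-bind _ (below (s≤s (ℕₚ.m∸n≤m k j))) (λ x rx →
        combination-bind _ (valid-letterΔ j (below (s≤s j≤k))) (λ y vy → supported-tri₂ x y rx vy))
      expand : ∀ g → ∫ (∂ (suc (suc k))) g ≈ ∫ (∂ (suc k)) (L₁ g) +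
        - 1# * Σ< (suc k) (λ j → Δcoef (suc j) 1 (suc k) * ∫ (∂ (suc k ∸ j)) (λ x → ∫ (ΔX (suc j)) (λ y → ∫ (tri₂ x y) g)))
      expand g = begin
        ∫ (∂ (suc (suc k))) g
          ≈⟨ ∫-reduced ΔX (suc (suc k)) g ⟩
        a - b
          ≈⟨ solve 4 (λ a b s t → a :- b := ((a :+ (s :+ t)) :- (b :+ s)) :+ (:- :1) :* t) refl a b S₁ S₂ ⟩
        ((a + (S₁ + S₂)) - (b + S₁)) + - 1# * S₂
          ≈⟨ +-congʳ (+-congʳ (trans (+-congˡ (trans (sym (Σ-+ (suc k) _ _)) (Σ-cong (suc k) (λ j → trans (sym (distribˡ _ _ _)) (*-congˡ (sym (Δ-cons (suc k ∸ j) [ suc j ] g)))))))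
               (trans (sym (L-letter k _)) (trans (Δ-L-letter k (below ℕₚ.≤-refl) g) (+-congʳ (L-letter k _)))))) ⟩
        (((b + S₁) + ∫ (ΔX (suc k)) (L₁ g)) - (b + S₁)) + - 1# * S₂
          ≈⟨ +-congʳ (trans (solve 2 (λ x y → (x :+ y) :- x := y) refl _ _) (ΔX-L₁ (suc k) g)) ⟩
        ∫ (∂ (suc k)) (L₁ g) + - 1# * S₂ ∎
        where
        a = ∫ (ΔX (suc (suc k))) g
        b = g ([] , [ suc (suc k) ])
        S₁ = Σ< (suc k) (λ j → Δcoef (suc j) 1 (suc k) * g ([] , suc k ∸ j ∷ suc j ∷ []))
        S₂ = Σ< (suc k) (λ j → Δcoef (suc j) 1 (suc k) * ∫ (∂ (suc k ∸ j)) (λ x → ∫ (ΔX (suc j)) (λ y → ∫ (tri₂ x y) g)))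

  supported-Δ : ∀ {u} → Valid u → Supported Valid₂ (∫ (Δ u))
  supported-Δ [] = combination-cong (λ g → ∫-single _ g) (combination-return ([] , []) ([] , []))
  supported-Δ (suc a {v} vv) = combination-cong (λ g → Δ-cons (suc a) v g) (combination-+ (combination-return ([] , suc a ∷ v) ([] , suc a vv))
    (combination-bind _ (supported-∂ a) (λ x rx → combination-bind _ (supported-Δ vv) (λ y vy →
      combination-bind (λ g → g) (supported-tri₂ x y rx vy) (λ { z (_ , vz) → combination-return z vz })))))

  -- In the left factor the first letter of `x` stays in front on both sides, so each tensor factor
  -- reduces to associativity of the shuffle.
  tri₂-sh₂ : ∀ x x′ y → Reduced x → Valid₂ x′ → Valid₂ y → ∀ g →
    ∫ (sh₂ x′ y) (λ y′ → ∫ (tri₂ x y′) g) ≈ ∫ (tri₂ x x′) (λ w → ∫ (tri₂ w y) g)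
  tri₂-sh₂ (.(suc α ∷ a) , b) (c₁ , d₁) (c₂ , d₂) (cons , suc α {a} va , vb) (vc₁ , vd₁) (vc₂ , vd₂) g = begin
    ∫ (sh₂ (c₁ , d₁) (c₂ , d₂)) (λ y′ → ∫ (tri₂ (suc α ∷ a , b) y′) g)
      ≈⟨ trans (∫-sh₂ _ _ _) (∫-cong (shW c₁ c₂) (λ a₂ → ∫-cong (shW d₁ d₂) (λ b₂ → trans (∫-tri₂ _ _ g) (tri-cons (suc α) a a₂ _)))) ⟩
    ∫ (shW c₁ c₂) (λ a₂ → ∫ (shW d₁ d₂) (λ b₂ → ∫ (shW a a₂) (λ s → ∫ (shW b b₂) (λ t → g (suc α ∷ s , t)))))
      ≈⟨ ∫-cong (shW c₁ c₂) (λ a₂ → trans (∫-swap (shW d₁ d₂) (shW a a₂) _) (∫-cong (shW a a₂) (λ s → sym (sh-assoc vb vd₁ vd₂ _)))) ⟩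
    ∫ (shW c₁ c₂) (λ a₂ → ∫ (shW a a₂) (λ s → ∫ (shW b d₁) (λ z → ∫ (shW z d₂) (λ t → g (suc α ∷ s , t)))))
      ≈⟨ sh-assoc va vc₁ vc₂ _ ⟨
    ∫ (shW a c₁) (λ e → ∫ (shW e c₂) (λ s → ∫ (shW b d₁) (λ z → ∫ (shW z d₂) (λ t → g (suc α ∷ s , t)))))
      ≈⟨ ∫-cong (shW a c₁) (λ e → ∫-swap (shW e c₂) (shW b d₁) _) ⟩
    ∫ (shW a c₁) (λ e → ∫ (shW b d₁) (λ z → ∫ (shW e c₂) (λ s → ∫ (shW z d₂) (λ t → g (suc α ∷ s , t)))))
      ≈⟨ ∫-cong (shW a c₁) (λ e → ∫-cong (shW b d₁) (λ z → trans (∫-tri₂ _ _ g) (tri-cons (suc α) e c₂ _))) ⟨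
    ∫ (shW a c₁) (λ e → ∫ (shW b d₁) (λ z → ∫ (tri₂ (suc α ∷ e , z) (c₂ , d₂)) g))
      ≈⟨ trans (∫-tri₂ _ _ _) (tri-cons (suc α) a c₁ _) ⟨
    ∫ (tri₂ (suc α ∷ a , b) (c₁ , d₁)) (λ w → ∫ (tri₂ w (c₂ , d₂)) g) ∎

  L₁-tri₂ : ∀ x y → Reduced x → Valid₂ y → ∀ g → L₁ (λ w → ∫ (tri₂ w y) g) x ≈ ∫ (tri₂ x y) (L₁ g)
  L₁-tri₂ (a , b) (c₁ , d₁) (ne , va , vb) (vc , vd) g = begin
    ∫ (L a) (λ a′ → ∫ (tri₂ (a′ , b) (c₁ , d₁)) g)
      ≈⟨ ∫-cong (L a) (λ a′ → ∫-tri₂ _ _ g) ⟩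
    ∫ (L a) (λ a′ → ∫ (triW a′ c₁) (λ s → ∫ (shW b d₁) (λ t → g (s , t))))
      ≈⟨ L-tri va ne vc _ ⟩
    ∫ (triW a c₁) (λ w → ∫ (L w) (λ s → ∫ (shW b d₁) (λ t → g (s , t))))
      ≈⟨ ∫-cong (triW a c₁) (λ w → ∫-swap (L w) (shW b d₁) _) ⟩
    ∫ (triW a c₁) (λ w → ∫ (shW b d₁) (λ t → ∫ (L w) (λ s → g (s , t))))
      ≈⟨ ∫-tri₂ _ _ _ ⟨
    ∫ (tri₂ (a , b) (c₁ , d₁)) (L₁ g) ∎

  Multiplicative : Word → Word → Set (c ⊔ ℓ)
  Multiplicative u v = ∀ g → ∫ (shW u v) (λ w → ∫ (Δ w) g) ≈ ∫ (Δ u) (λ x → ∫ (Δ v) (λ y → ∫ (sh₂ x y) g))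

  module StepΔ (N : ℕ) (multiplicative : ∀ u v → Valid u → Valid v → sum u ℕ.+ sum v ℕ.< N → Multiplicative u v) where

    -- Write `y = x_b v`. Multiplicativity for `x_j ⧢ v`, of weight below `N`, turns the summand
    -- with letters `x_i`, `x_j` into `∂ x_i ▷ (Δ x_j ⧢ Δ v) = (∂ x_i ▷ Δ x_j) ▷ Δ v`. The claim is
    -- thus the letter case followed by `▷ Δ v`, which is the test function `G`.
    Δ-L : ∀ y → Valid y → NonEmpty y → sum y ℕ.< N → ∀ g →
          ∫ (L y) (λ u → ∫ (Δ u) g) ≈ ∫ (L y) (λ u → g ([] , u)) + ∫ (Δ y) (L₁ g)
    Δ-L .(suc k ∷ v) (suc k {v} vv) cons below g = begin
      ∫ (L (b ∷ v)) (λ u → ∫ (Δ u) g)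
        ≈⟨ ∫-Dia 1 b v _ ⟩
      Σ< (suc (suc b)) (λ j → D j 1 b * ∫ (T j v) (λ z → ∫ (Δ (suc b ∸ j ∷ z)) g))
        ≈⟨ Σ-cong (suc (suc b)) (λ j → trans (*-congˡ (trans (∫-cong (T j v) (λ z → Δ-cons (suc b ∸ j) z g)) (∫-+ (T j v) _ _))) (trans (distribˡ _ _ _)
             (+-congˡ (D-cong-≤ j 1 b (s≤s z≤n) (λ j≤b → term j j≤b))))) ⟩
      Σ< (suc (suc b)) (λ j → D j 1 b * ∫ (T j v) (λ z → g ([] , suc b ∸ j ∷ z)) + D j 1 b * (∫ (Δ (suc b ∸ j ∷ letter j)) G - G ([] , suc b ∸ j ∷ letter j)))
        ≈⟨ trans (Σ-+ (suc (suc b)) _ _) (+-cong (sym (∫-Dia 1 b v _)) (trans (Σ-cong (suc (suc b)) (λ j → *-congˡ (sym (T-nil j _)))) (sym (∫-Dia 1 b [] _)))) ⟩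
      ∫ (L (b ∷ v)) (λ u → g ([] , u)) + ∫ (L [ b ]) (λ u → ∫ (Δ u) G - G ([] , u))
        ≈⟨ +-congˡ (begin
             ∫ (L [ b ]) (λ u → ∫ (Δ u) G - G ([] , u))
               ≈⟨ trans (∫-+ (L [ b ]) _ _) (+-cong (Δ-L-letter k (supported-∂ k) G) (∫-neg (L [ b ]) _)) ⟩
             (∫ (L [ b ]) (λ u → G ([] , u)) + ∫ (ΔX b) (L₁ G)) - ∫ (L [ b ]) (λ u → G ([] , u))
               ≈⟨ solve 2 (λ x y → (x :+ y) :- x := y) refl _ _ ⟩
             ∫ (ΔX b) (L₁ G)
               ≈⟨ ΔX-L₁ b G ⟩
             ∫ (∂ b) (L₁ G)
               ≈⟨ combination-≈ (supported-∂ k) (λ x rx → trans (∫-swap (L (proj₁ x)) (Δ v) _) (combination-≈ (supported-Δ vv) (λ y vy → L₁-tri₂ x y rx vy g))) ⟩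
             ∫ (∂ b) (λ x → ∫ (Δ v) (λ y → ∫ (tri₂ x y) (L₁ g)))
               ≈⟨ trans (+-congʳ (L₁-nil g _)) (+-identityˡ _) ⟨
             L₁ g ([] , b ∷ v) + ∫ (∂ b) (λ x → ∫ (Δ v) (λ y → ∫ (tri₂ x y) (L₁ g)))
               ≈⟨ Δ-cons b v _ ⟨
             ∫ (Δ (b ∷ v)) (L₁ g) ∎) ⟩
      ∫ (L (b ∷ v)) (λ u → g ([] , u)) + ∫ (Δ (b ∷ v)) (L₁ g) ∎
      where
      b = suc k
      G : Word₂ → Carrier
      G x = ∫ (Δ v) (λ y → ∫ (tri₂ x y) g)
      T-nil : ∀ j f → ∫ (T j []) f ≈ f (letter j)
      T-nil zero f = ∫-single _ f
      T-nil (suc j) f = ∫-single _ f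
      supported-∂′ : ∀ i → 0 ℕ.< i → Supported Reduced (∫ (∂ i))
      supported-∂′ (suc i) _ = supported-∂ i
      term : ∀ j → j ℕ.< suc b → ∫ (T j v) (λ z → ∫ (∂ (suc b ∸ j)) (λ x → ∫ (Δ z) (λ y → ∫ (tri₂ x y) g))) ≈
             ∫ (Δ (suc b ∸ j ∷ letter j)) G - G ([] , suc b ∸ j ∷ letter j)
      term j j≤b = begin
        ∫ (T j v) (λ z → ∫ (∂ i) (λ x → ∫ (Δ z) (λ y → ∫ (tri₂ x y) g)))
          ≈⟨ trans (∫-swap (T j v) (∂ i) _) (∫-cong (∂ i) (λ x → trans (T-sh j v _) (multiplicative (letter j) v (valid-letter j) vv bound _))) ⟩
        ∫ (∂ i) (λ x → ∫ (Δ (letter j)) (λ x′ → ∫ (Δ v) (λ y → ∫ (sh₂ x′ y) (λ y′ → ∫ (tri₂ x y′) g))))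
          ≈⟨ combination-≈ (supported-∂′ i (ℕₚ.m<n⇒0<n∸m j≤b)) (λ x rx → combination-≈ (supported-Δ (valid-letter j)) (λ x′ vx′ →
               trans (combination-≈ (supported-Δ vv) (λ y vy → tri₂-sh₂ x x′ y rx vx′ vy g)) (∫-swap (Δ v) (tri₂ x x′) _))) ⟩
        ∫ (∂ i) (λ x → ∫ (Δ (letter j)) (λ x′ → ∫ (tri₂ x x′) G))
          ≈⟨ trans (solve 2 (λ s t → s := (t :+ s) :- t) refl _ _) (+-congʳ (sym (Δ-cons i (letter j) G))) ⟩
        ∫ (Δ (i ∷ letter j)) G - G ([] , i ∷ letter j) ∎
        where
        i = suc b ∸ j
        bound : sum (letter j) ℕ.+ sum v ℕ.< N
        bound = ℕₚ.≤-<-trans (ℕₚ.+-monoˡ-≤ (sum v) (ℕₚ.≤-trans (ℕₚ.≤-reflexive (sum-letter j)) (ℕₚ.≤-pred j≤b))) below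

    LP₁ : ℕ → (Word₂ → Carrier) → Word₂ → Carrier
    LP₁ n g x = ∫ (LP n (proj₁ x)) (λ a → g (a , proj₂ x))

    -- Under iteration only one term with left factor `1` survives, because `L` is zero on the empty
    -- word.
    Δ-LP : ∀ n w → Valid w → suc n ℕ.+ sum w ℕ.≤ N → ∀ g →
           ∫ (LP n w) (λ u → ∫ (Δ u) g) ≈ ∫ (LP n w) (λ u → g ([] , u)) + ∫ (Δ w) (LP₁ n g)
    Δ-LP zero w vw below g = trans (∫-single _ _) (trans (Δ-1-cons w g) (+-cong (sym (∫-single _ _)) (∫-cong (Δ w) (λ x → sym (∫-single _ _)))))
    Δ-LP (suc n) w vw below g = begin
      ∫ (LP (suc n) w) (λ u → ∫ (Δ u) g)
        ≈⟨ LP-suc n w _ ⟩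
      ∫ (LP n w) (λ y → ∫ (L y) (λ u → ∫ (Δ u) g))
        ≈⟨ combination-≈ (supported-LP n vw) (λ { y oy@(vy , weight-y) → Δ-L y vy (nonEmpty oy) (≡.subst (ℕ._< N) (≡.sym weight-y) below) g }) ⟩
      ∫ (LP n w) (λ y → ∫ (L y) (λ u → g ([] , u)) + ∫ (Δ y) (L₁ g))
        ≈⟨ trans (∫-+ (LP n w) _ _) (+-cong (sym (LP-suc n w _)) (Δ-LP n w vw (ℕₚ.<⇒≤ below) (L₁ g))) ⟩
      ∫ (LP (suc n) w) (λ u → g ([] , u)) + (∫ (LP n w) (λ u → L₁ g ([] , u)) + ∫ (Δ w) (LP₁ n (L₁ g)))
        ≈⟨ +-congˡ (trans (+-cong (trans (∫-cong (LP n w) (λ u → L₁-nil g u)) (∫-0 (LP n w))) (∫-cong (Δ w) (λ x → sym (LP-suc n (proj₁ x) _)))) (+-identityˡ _)) ⟩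
      ∫ (LP (suc n) w) (λ u → g ([] , u)) + ∫ (Δ w) (LP₁ (suc n) g) ∎

    ψ₂ : (Word₂ → Carrier) → Word₂ → Carrier
    ψ₂ g x = ∫ (ψ (proj₁ x)) (λ a → ∫ (ψ (proj₂ x)) (λ b → g (a , b)))

    Δ-ψ : ∀ p → weight p ℕ.≤ N → ∀ g → ∫ (ψ p) (λ u → ∫ (Δ u) g) ≈ ∫ (deconc p) (ψ₂ g)
    Δ-ψ [] below g = trans (∫-single _ _) (trans (∫-single _ _) (sym (trans (∫-single _ _) (trans (∫-single _ _) (∫-single _ _)))))
    Δ-ψ (n ∷ p) below g = begin
      ∫ (ψ (n ∷ p)) (λ u → ∫ (Δ u) g)
        ≈⟨ ψ-cons n p _ ⟩
      ∫ (ψ p) (λ w → ∫ (LP n w) (λ u → ∫ (Δ u) g))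
        ≈⟨ combination-≈ (supported-ψ p) (λ { w (vw , weight-w) → Δ-LP n w vw (≡.subst (λ t → suc n ℕ.+ t ℕ.≤ N) (≡.sym weight-w) below) g }) ⟩
      ∫ (ψ p) (λ w → ∫ (LP n w) (λ u → g ([] , u)) + ∫ (Δ w) (LP₁ n g))
        ≈⟨ trans (∫-+ (ψ p) _ _) (+-cong (sym (ψ-cons n p _)) (Δ-ψ p (ℕₚ.≤-trans (ℕₚ.m≤n+m (weight p) (suc n)) below) _)) ⟩
      ∫ (ψ (n ∷ p)) (λ u → g ([] , u)) + ∫ (deconc p) (ψ₂ (LP₁ n g))
        ≈⟨ +-cong (sym (∫-single _ _)) (∫-cong (deconc p) (λ x → trans (∫-cong (ψ (proj₁ x)) (λ a → ∫-swap (ψ (proj₂ x)) (LP n a) _)) (sym (ψ-cons n (proj₁ x) _)))) ⟩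
      ψ₂ g ([] , n ∷ p) + ∫ (deconc p) (λ x → ψ₂ g (n ∷ proj₁ x , proj₂ x))
        ≈⟨ deconc-cons n p _ ⟨
      ∫ (deconc (n ∷ p)) (ψ₂ g) ∎

    ψ₂-quasi₂ : ∀ x y g → quasi₂ (ψ₂ g) x y ≈ ψ₂ (λ z → ψ₂ (λ w → ∫ (sh₂ z w) g) y) x
    ψ₂-quasi₂ (p₁ , p₂) (r₁ , r₂) g = begin
      ∫ (quasi p₁ r₁) (λ z → ∫ (quasi p₂ r₂) (λ z′ → ∫ (ψ z) (λ e → ∫ (ψ z′) (λ f → g (e , f)))))
        ≈⟨ ∫-cong (quasi p₁ r₁) (λ z → ∫-swap (quasi p₂ r₂) (ψ z) _) ⟩
      ∫ (quasi p₁ r₁) (λ z → ∫ (ψ z) (λ e → ∫ (quasi p₂ r₂) (λ z′ → ∫ (ψ z′) (λ f → g (e , f)))))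
        ≈⟨ ∫-cong (quasi p₁ r₁) (λ z → ∫-cong (ψ z) (λ e → ψ-homomorphism p₂ r₂ _)) ⟩
      ∫ (quasi p₁ r₁) (λ z → ∫ (ψ z) (λ e → ∫ (ψ p₂) (λ b → ∫ (ψ r₂) (λ b′ → ∫ (shW b b′) (λ f → g (e , f))))))
        ≈⟨ ψ-homomorphism p₁ r₁ _ ⟩
      ∫ (ψ p₁) (λ a → ∫ (ψ r₁) (λ a′ → ∫ (shW a a′) (λ e → ∫ (ψ p₂) (λ b → ∫ (ψ r₂) (λ b′ → ∫ (shW b b′) (λ f → g (e , f)))))))
        ≈⟨ ∫-cong (ψ p₁) (λ a → ∫-cong (ψ r₁) (λ a′ → trans (∫-swap (shW a a′) (ψ p₂) _) (∫-cong (ψ p₂) (λ b → trans (∫-swap (shW a a′) (ψ r₂) _)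
             (∫-cong (ψ r₂) (λ b′ → sym (∫-sh₂ (a , b) (a′ , b′) g))))))) ⟩
      ∫ (ψ p₁) (λ a → ∫ (ψ r₁) (λ a′ → ∫ (ψ p₂) (λ b → ∫ (ψ r₂) (λ b′ → ∫ (sh₂ (a , b) (a′ , b′)) g))))
        ≈⟨ ∫-cong (ψ p₁) (λ a → ∫-swap (ψ r₁) (ψ p₂) _) ⟩
      ∫ (ψ p₁) (λ a → ∫ (ψ p₂) (λ b → ∫ (ψ r₁) (λ a′ → ∫ (ψ r₂) (λ b′ → ∫ (sh₂ (a , b) (a′ , b′)) g)))) ∎

    -- On the image of `ψ` the claim becomes the compatibility of deconcatenation with the
    -- quasi-shuffle, `deconc-quasi`.
    multiplicative-≤ : ∀ u v → Valid u → Valid v → sum u ℕ.+ sum v ℕ.≤ N → Multiplicative u v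
    multiplicative-≤ u v vu vv below g = image-≈ u vu _ _ (λ p weight-p →
      image-≈ v vv (λ v → ∫ (ψ p) (λ u → ∫ (shW u v) (λ w → ∫ (Δ w) g))) (λ v → ∫ (ψ p) (λ u → ∫ (Δ u) (λ x → ∫ (Δ v) (λ y → ∫ (sh₂ x y) g))))
        (λ r weight-r → pair p r (≡.subst (ℕ._≤ N) (≡.cong₂ ℕ._+_ (≡.sym weight-p) (≡.sym weight-r)) below)))
      where
      pair : ∀ p r → weight p ℕ.+ weight r ℕ.≤ N → ∫ (ψ r) (λ v → ∫ (ψ p) (λ u → ∫ (shW u v) (λ w → ∫ (Δ w) g))) ≈
             ∫ (ψ r) (λ v → ∫ (ψ p) (λ u → ∫ (Δ u) (λ x → ∫ (Δ v) (λ y → ∫ (sh₂ x y) g))))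
      pair p r below = begin
        ∫ (ψ r) (λ v → ∫ (ψ p) (λ u → ∫ (shW u v) (λ w → ∫ (Δ w) g)))
          ≈⟨ trans (∫-swap (ψ r) (ψ p) _) (sym (ψ-homomorphism p r _)) ⟩
        ∫ (quasi p r) (λ x → ∫ (ψ x) (λ w → ∫ (Δ w) g))
          ≈⟨ combination-≈ (supported-quasi p r) (λ x weight-x → Δ-ψ x (≡.subst (ℕ._≤ N) (≡.sym weight-x) below) g) ⟩
        ∫ (quasi p r) (λ x → ∫ (deconc x) (ψ₂ g))
          ≈⟨ deconc-quasi p r (ψ₂ g) ⟩
        ∫ (deconc p) (λ x → ∫ (deconc r) (quasi₂ (ψ₂ g) x))
          ≈⟨ ∫-cong (deconc p) (λ x → ∫-cong (deconc r) (λ y → ψ₂-quasi₂ x y g)) ⟩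
        ∫ (deconc p) (λ x → ∫ (deconc r) (λ y → ψ₂ (λ z → ψ₂ (λ w → ∫ (sh₂ z w) g) y) x))
          ≈⟨ ∫-cong (deconc p) (λ x → trans (∫-swap (deconc r) (ψ (proj₁ x)) _) (∫-cong (ψ (proj₁ x)) (λ a → ∫-swap (deconc r) (ψ (proj₂ x)) _))) ⟩
        ∫ (deconc p) (ψ₂ (λ z → ∫ (deconc r) (ψ₂ (λ w → ∫ (sh₂ z w) g))))
          ≈⟨ Δ-ψ p (ℕₚ.≤-trans (ℕₚ.m≤m+n _ _) below) _ ⟨
        ∫ (ψ p) (λ u → ∫ (Δ u) (λ x → ∫ (deconc r) (ψ₂ (λ w → ∫ (sh₂ x w) g))))
          ≈⟨ ∫-cong (ψ p) (λ u → ∫-cong (Δ u) (λ x → Δ-ψ r (ℕₚ.≤-trans (ℕₚ.m≤n+m _ _) below) _)) ⟨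
        ∫ (ψ p) (λ u → ∫ (Δ u) (λ x → ∫ (ψ r) (λ v → ∫ (Δ v) (λ y → ∫ (sh₂ x y) g))))
          ≈⟨ trans (∫-cong (ψ p) (λ u → ∫-swap (Δ u) (ψ r) _)) (∫-swap (ψ p) (ψ r) _) ⟩
        ∫ (ψ r) (λ v → ∫ (ψ p) (λ u → ∫ (Δ u) (λ x → ∫ (Δ v) (λ y → ∫ (sh₂ x y) g)))) ∎

  multiplicative-below : ∀ N u v → Valid u → Valid v → sum u ℕ.+ sum v ℕ.< N → Multiplicative u v
  multiplicative-below (suc N) u v vu vv (s≤s below) = StepΔ.multiplicative-≤ N (multiplicative-below N) u v vu vv below

  Δ-ψ : ∀ p g → ∫ (ψ p) (λ u → ∫ (Δ u) g) ≈ ∫ (deconc p) (λ x → ∫ (ψ (proj₁ x)) (λ a → ∫ (ψ (proj₂ x)) (λ b → g (a , b))))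
  Δ-ψ p = StepΔ.Δ-ψ _ (multiplicative-below _) p ℕₚ.≤-refl

  ∫-Id⊗Δ : ∀ l g → ∫ (Id⊗Δ l) g ≈ ∫ l (λ x → ∫ (Δ (proj₂ x)) (λ y → g (proj₁ x , proj₁ y , proj₂ y)))
  ∫-Id⊗Δ l g = trans (∫-ext _ l g) (∫-cong l (λ x → ∫-map (λ y → proj₁ x , proj₁ y , proj₂ y) (λ _ _ → ≡.refl) (Δ (proj₂ x)) g))

  ∫-Δ⊗Id : ∀ l g → ∫ (Δ⊗Id l) g ≈ ∫ l (λ x → ∫ (Δ (proj₁ x)) (λ y → g (proj₁ y , proj₂ y , proj₂ x)))
  ∫-Δ⊗Id l g = trans (∫-ext _ l g) (∫-cong l (λ x → ∫-map (λ y → proj₁ y , proj₂ y , proj₂ x) (λ _ _ → ≡.refl) (Δ (proj₁ x)) g))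

  coassociative : ∀ u → Valid u → ∀ g → ∫ (Id⊗Δ (Δ u)) g ≈ ∫ (Δ⊗Id (Δ u)) g
  coassociative u vu g = trans (∫-Id⊗Δ (Δ u) g) (trans (image-≈ u vu
    (λ u → ∫ (Δ u) (λ x → ∫ (Δ (proj₂ x)) (λ y → g (proj₁ x , proj₁ y , proj₂ y))))
    (λ u → ∫ (Δ u) (λ x → ∫ (Δ (proj₁ x)) (λ y → g (proj₁ y , proj₂ y , proj₂ x)))) (λ p _ → on-ψ p)) (sym (∫-Δ⊗Id (Δ u) g)))
    where
    ψ₃ : Word → Word → Word → Carrier
    ψ₃ p₁ p₂ p₃ = ∫ (ψ p₁) (λ a → ∫ (ψ p₂) (λ b → ∫ (ψ p₃) (λ d → g (a , b , d))))
    on-ψ : ∀ p → ∫ (ψ p) (λ u → ∫ (Δ u) (λ x → ∫ (Δ (proj₂ x)) (λ y → g (proj₁ x , proj₁ y , proj₂ y)))) ≈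
                 ∫ (ψ p) (λ u → ∫ (Δ u) (λ x → ∫ (Δ (proj₁ x)) (λ y → g (proj₁ y , proj₂ y , proj₂ x))))
    on-ψ p = begin
      ∫ (ψ p) (λ u → ∫ (Δ u) (λ x → ∫ (Δ (proj₂ x)) (λ y → g (proj₁ x , proj₁ y , proj₂ y))))
        ≈⟨ trans (Δ-ψ p _) (∫-cong (deconc p) (λ x → trans (∫-cong (ψ (proj₁ x)) (λ a → Δ-ψ (proj₂ x) _)) (∫-swap (ψ (proj₁ x)) (deconc (proj₂ x)) _))) ⟩
      ∫ (deconc p) (λ x → ∫ (deconc (proj₂ x)) (λ y → ψ₃ (proj₁ x) (proj₁ y) (proj₂ y)))
        ≈⟨ deconc-coassoc p ψ₃ ⟩
      ∫ (deconc p) (λ x → ∫ (deconc (proj₁ x)) (λ y → ψ₃ (proj₁ y) (proj₂ y) (proj₂ x)))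
        ≈⟨ ∫-cong (deconc p) (λ x → ∫-cong (deconc (proj₁ x)) (λ y → trans (∫-cong (ψ (proj₁ y)) (λ a → ∫-swap (ψ (proj₂ y)) (ψ (proj₂ x)) _)) (∫-swap (ψ (proj₁ y)) (ψ (proj₂ x)) _))) ⟩
      ∫ (deconc p) (λ x → ∫ (deconc (proj₁ x)) (λ y → ∫ (ψ (proj₂ x)) (λ d → ∫ (ψ (proj₁ y)) (λ a → ∫ (ψ (proj₂ y)) (λ b → g (a , b , d))))))
        ≈⟨ ∫-cong (deconc p) (λ x → trans (∫-swap (deconc (proj₁ x)) (ψ (proj₂ x)) _) (∫-cong (ψ (proj₂ x)) (λ d → sym (Δ-ψ (proj₁ x) _)))) ⟩
      ∫ (deconc p) (λ x → ∫ (ψ (proj₂ x)) (λ d → ∫ (ψ (proj₁ x)) (λ a → ∫ (Δ a) (λ y → g (proj₁ y , proj₂ y , d)))))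
        ≈⟨ ∫-cong (deconc p) (λ x → ∫-swap (ψ (proj₂ x)) (ψ (proj₁ x)) _) ⟩
      ∫ (deconc p) (λ x → ∫ (ψ (proj₁ x)) (λ a → ∫ (ψ (proj₂ x)) (λ d → ∫ (Δ a) (λ y → g (proj₁ y , proj₂ y , d)))))
        ≈⟨ Δ-ψ p _ ⟨
      ∫ (ψ p) (λ u → ∫ (Δ u) (λ x → ∫ (Δ (proj₁ x)) (λ y → g (proj₁ y , proj₂ y , proj₂ x)))) ∎

theorem7p6 : {c ℓ : Level} (q : ℕ) (F : CommutativeRing c ℓ) → IsField F → HasCardinality F q →
    (u : Word) → All (1 ≤_) u →
    let open Construction F q in
    Id⊗Δ (Δ u) ≈₃ Δ⊗Id (Δ u)
theorem7p6 zero F isField card with () ← Inverse.from card (CommutativeRing.0# F)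
theorem7p6 (suc m) F isField card u positive b =
  -- The coefficient at `b` is the integral of the indicator function of `b`, so it is one of the
  -- tests covered by `coassociative`.
  trans (coef-∫ _≟₃_ (Id⊗Δ (Δ u)) b)
    (trans (coassociative u (valid positive) _) (sym (coef-∫ _≟₃_ (Δ⊗Id (Δ u)) b)))
  where
  open CommutativeRing F using (sym; trans)
  open Construction F (suc m)
  open Integral F (suc m)
  open Shuffle F isField m card
  open Coproduct F isField m card
  valid : ∀ {w} → All (1 ≤_) w → Valid w
  valid [] = []
  valid (s≤s z≤n ∷ positive) = suc _ (valid positive)
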